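{- Let $A$ and $B$ be finite sets, let $\Delta$ be a positive integer, and let $f : A \times B \to \{0, 1, \dots, \Delta\}$ be a function of rank $r$. Then there exists a deterministic communication protocol computing $f$ whose length is at most $\Delta^{O(\Delta)} \cdot \sqrt{r} \cdot \log r$ bits, where the constant in the $O(\cdot)$ is absolute.
   Context: The rank of a function $f : A \times B \to \mathbb{R}$ is the rank of the real matrix $\mathbf{M} \in \mathbb{R}^{A \times B}$ with $\mathbf{M}_{a,b} = f(a,b)$. In the deterministic two-party communication model, Alice receives $a \in A$, Bob receives $b \in B$, and they exchange bits according to a protocol fixed in advance (with unlimited local computation) so that at the end both know $f(a,b)$; the length of a protocol is the maximum number of bits exchanged over all inputs $(a,b)$.
   Formalization: The factor log r is read as ⌈log₂(r+1)⌉ and a leading absolute constant is allowed in Δ^{O(Δ)}, because at r = 1 the literal bound is 0 bits although a non-constant rank-1 function needs at least one. -}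

module Defs where

open import Data.Nat using (ℕ; zero; suc; _⊔_)
open import Data.Bool using (Bool; true; false; if_then_else_)
open import Data.Fin using (Fin)
open import Data.Rational using (ℚ; 0ℚ; _+_; _*_)
open import Data.Integer using (+_)
import Data.Rational as Q

sumℚ : (k : ℕ) → (Fin k → ℚ) → ℚ
sumℚ zero    g = 0ℚ
sumℚ (suc k) g = g Fin.zero + sumℚ k (λ i → g (Fin.suc i))

ℕ→ℚ : ℕ → ℚ
ℕ→ℚ n = (+ n) Q./ 1

FactorsThrough : {m n : ℕ} → (Fin m → Fin n → ℕ) → ℕ → Set
FactorsThrough {m} {n} M k =
  Σ' (Fin m → Fin k → ℚ) (λ U → Σ' (Fin k → Fin n → ℚ) (λ V →
    (a : Fin m) (b : Fin n) → ℕ→ℚ (M a b) ≡' sumℚ k (λ i → U a i * V i b)))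
  where
  open import Data.Product renaming (Σ to Σ')
  open import Relation.Binary.PropositionalEquality renaming (_≡_ to _≡'_)

-- rank of M (over ℚ, equal to its rank over ℝ since entries are integers):
-- the least k such that M = U V with U : m×k, V : k×n
RankIs : {m n : ℕ} → (Fin m → Fin n → ℕ) → ℕ → Set
RankIs M r = FactorsThrough M r × (∀ k → k < r → ¬ FactorsThrough M k)
  where
  open import Data.Product using (_×_)
  open import Data.Nat using (_<_)
  open import Relation.Nullary using (¬_)

-- deterministic two-party protocol trees: at each internal node one party
-- sends one bit computed from its own input; leaves carry the output
-- (known to both parties, since it is determined by the transcript)
data Protocol (A B O : Set) : Set where
  leaf  : O → Protocol A B O
  alice : (A → Bool) → Protocol A B O → Protocol A B O → Protocol A B O
  bob   : (B → Bool) → Protocol A B O → Protocol A B O → Protocol A B O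

run : {A B O : Set} → Protocol A B O → A → B → O
run (leaf o)      a b = o
run (alice g p q) a b = if g a then run p a b else run q a b
run (bob g p q)   a b = if g b then run p a b else run q a b

depth : {A B O : Set} → Protocol A B O → ℕ
depth (leaf o)      = 0
depth (alice g p q) = suc (depth p ⊔ depth q)
depth (bob g p q)   = suc (depth p ⊔ depth q)

{-# OPTIONS --safe #-}
module Submission where

-- By a discrete John ellipsoid argument (rows of maximal Gram determinant have
-- small leverage scores) a rank-k matrix with values in {0, ..., Δ} is, up to a
-- factor Δ√(2k), a matrix of inner products of unit vectors. By Grothendieck's
-- inequality some (E - f)/(4E) with E = O(Δ√k) is then a convex combination of
-- rectangles, and so is its T-th power, which damps the larger values of f. For
-- a well chosen value v this yields a rectangle of density 2^(-Δ^O(Δ) √k log k)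
-- on which almost all entries are v, and, as the rank is small, a monochromatic
-- one of similar size. As in Nisan and Wigderson's argument, the rows or the
-- columns through it have rank about k/2. Sweeping the matrix by such blocks,
-- the players find the block containing their input by announcing logarithms of
-- the number of blocks, and recurse; the costs form a geometric series.

open import Defs
open import Data.Bool using (Bool; true; false; _∧_; not; if_then_else_; _∨_)
open import Data.Bool.ListAction using (all)
open import Data.Empty using (⊥-elim)
open import Data.Fin as Fin using (Fin; zero; suc; punchIn)
open import Data.List using (List; []; _∷_; length; lookup; map; _++_; cartesianProductWith; cartesianProduct; tabulate; allFin; filterᵇ)
open import Data.List.Membership.Propositional using (_∈_)
open import Data.List.Membership.Propositional.Properties using (∈-lookup; ∈-cartesianProductWith⁺; ∈-cartesianProductWith⁻; ∈-cartesianProduct⁺; ∈-tabulate⁺; ∈-tabulate⁻; ∈-++⁺ˡ; ∈-++⁺ʳ; ∈-++⁻; ∈-allFin)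
open import Data.List.Relation.Unary.Any using (here; there)
open import Data.List.Properties using (length-tabulate; length-++)
open import Data.Product using (_,_; ∃; Σ; _×_; proj₁; proj₂)
open import Data.Sum using (inj₁; inj₂; _⊎_)
open import Data.Unit using (⊤; tt)
open import Function using (_∋_; _∘_; id)
open import Relation.Nullary using (yes; no; Dec; ¬_)
open import Relation.Nullary.Decidable using (dec⇒maybe; _×-dec_; ⌊_⌋)
open import Relation.Binary.PropositionalEquality

-- Powers of E - f favour the smallest value, but that value may be too rare to matter. Damping the
-- values above v against a density 2^(-ℓκ) of the entries up to v also weakens v relative to the
-- values below it, by a factor 2^(O(Δ)ℓκ); so the entries below v must be rarer than 2^(-6Δℓκ). The
-- exponent thus grows by the factor 6Δ at each of up to Δ values, and (6Δ)^Δ is where Δ^O(Δ) comes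
-- from. Identical rows and columns are merged before the recursion starts. This bounds the area of
-- the matrix by (Δ+1)^(2r), so that the number of blocks needed to exhaust it depends on Δ and r
-- alone. All numbers are rational, so each compactness argument has a finite substitute: the
-- determinant is maximised over finitely many tuples of rows, Grothendieck's inequality is iterated
-- finitely often down to a trivial bound, and convex combinations of rectangles appear only through
-- the linear inequalities dual to them. Square roots are avoided by an integer s with 2k ≤ s², by
-- families whose size is a perfect square, and by bounding the square of the depth.

-- Ordered-field arithmetic and finite sums over ℚ.

module Rationals where
  open import Data.Nat as ℕ using (ℕ; zero; suc)
  import Data.Integer as ℤ
  import Data.Integer.Properties as ℤP
  open import Data.Rational using (ℚ; 0ℚ; 1ℚ; _+_; _*_; _-_; -_; _≤_; _<_; 1/_; ≢-nonZero; nonNegative; positive; toℚᵘ)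
  open import Data.Rational.Properties as ℚP using (≤-trans; ≤-refl; ≤-reflexive; <⇒≤; <-≤-trans)
  import Data.Rational.Unnormalised as ℚᵘ
  import Data.Rational.Unnormalised.Properties as ℚᵘP
  open import Relation.Binary using (tri<; tri≈; tri>)
  open import Tactic.RingSolver using (solve-∀)
  open import Tactic.RingSolver.Core.AlmostCommutativeRing using (AlmostCommutativeRing; fromCommutativeRing)
  open import Level using (0ℓ)

  ℚ-ring : AlmostCommutativeRing 0ℓ 0ℓ
  ℚ-ring = fromCommutativeRing ℚP.+-*-commutativeRing (λ x → dec⇒maybe (0ℚ ℚP.≟ x))

  private variable
    a b c d : ℚ
    A B : Set

  0≤⇒≤ : ∀ c → 0ℚ ≤ c → b ≡ a + c → a ≤ b
  0≤⇒≤ {b} {a} c p q = subst₂ _≤_ (ℚP.+-identityʳ a) (sym q) (ℚP.+-monoʳ-≤ a p)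

  ≤⇒0≤ : a ≤ b → 0ℚ ≤ b - a
  ≤⇒0≤ {a} {b} p = subst (_≤ b - a) (ℚP.+-inverseʳ a) (ℚP.+-monoˡ-≤ (- a) p)

  *-monoˡ : 0ℚ ≤ c → a ≤ b → c * a ≤ c * b
  *-monoˡ {c} p q = ℚP.*-monoˡ-≤-nonNeg c {{nonNegative p}} q

  *-monoʳ : 0ℚ ≤ c → a ≤ b → a * c ≤ b * c
  *-monoʳ {c} p q = ℚP.*-monoʳ-≤-nonNeg c {{nonNegative p}} q

  *-cancelˡ : 0ℚ < c → c * a ≤ c * b → a ≤ b
  *-cancelˡ {c} p q = ℚP.*-cancelˡ-≤-pos c {{positive p}} q

  0≤+ : 0ℚ ≤ a → 0ℚ ≤ b → 0ℚ ≤ a + b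
  0≤+ p q = ℚP.+-mono-≤ p q

  0≤* : 0ℚ ≤ a → 0ℚ ≤ b → 0ℚ ≤ a * b
  0≤* {a} {b} p q = subst (_≤ a * b) (ℚP.*-zeroʳ a) (*-monoˡ p q)

  0<* : 0ℚ < a → 0ℚ < b → 0ℚ < a * b
  0<* {a} {b} p q = subst (_< a * b) (ℚP.*-zeroʳ a) (ℚP.*-monoʳ-<-pos a {{positive p}} q)

  0<+≤ : 0ℚ < a → 0ℚ ≤ b → 0ℚ < a + b
  0<+≤ p q = ℚP.+-mono-<-≤ p q

  0<+ : 0ℚ < a → 0ℚ < b → 0ℚ < a + b
  0<+ p q = 0<+≤ p (<⇒≤ q)

  0≤sq : ∀ a → 0ℚ ≤ a * a
  0≤sq a with ℚP.≤-total 0ℚ a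
  ... | inj₁ p = 0≤* p p
  ... | inj₂ p = subst (0ℚ ≤_) (((∀ a → (0ℚ - a) * (0ℚ - a) ≡ a * a) ∋ solve-∀ ℚ-ring) a) (0≤* q q)
    where q = ≤⇒0≤ p

  sq-mono : 0ℚ ≤ a → a ≤ b → a * a ≤ b * b
  sq-mono p q = ≤-trans (*-monoˡ p q) (*-monoʳ (≤-trans p q) q)

  0<1 : 0ℚ < 1ℚ
  0<1 = ℚP.positive⁻¹ 1ℚ

  0≤1 : 0ℚ ≤ 1ℚ
  0≤1 = <⇒≤ 0<1

  -- Total, with value 0 at 0, so that pivots can be inverted inside definitions made before any
  -- positivity is known.
  inv : ℚ → ℚ
  inv p with p ℚP.≟ 0ℚ
  ... | yes _ = 0ℚ
  ... | no p≢0 = (1/ p) {{≢-nonZero p≢0}}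

  inv-right : ∀ p → p ≢ 0ℚ → p * inv p ≡ 1ℚ
  inv-right p p≢0 with p ℚP.≟ 0ℚ
  ... | yes e = ⊥-elim (p≢0 e)
  ... | no q = ℚP.*-inverseʳ p {{≢-nonZero q}}

  0<⇒≢0 : 0ℚ < a → a ≢ 0ℚ
  0<⇒≢0 p e = ℚP.<-irrefl (sym e) p

  inv-rightᵖ : 0ℚ < a → a * inv a ≡ 1ℚ
  inv-rightᵖ {a} p = inv-right a (0<⇒≢0 p)

  0<inv : 0ℚ < a → 0ℚ < inv a
  0<inv {a} p with ℚP.<-cmp 0ℚ (inv a)
  ... | tri< q _ _ = q
  ... | tri≈ _ q _ = ⊥-elim (0<⇒≢0 0<1 (trans (sym (inv-rightᵖ p)) (trans (cong (a *_) (sym q)) (ℚP.*-zeroʳ a))))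
  ... | tri> _ _ q = ⊥-elim (ℚP.<-irrefl refl (ℚP.<-trans 0<1 (subst₂ _<_ (inv-rightᵖ p) (ℚP.*-zeroʳ a) (ℚP.*-monoʳ-<-pos a {{positive p}} q))))

  private
    ℕ→ℚᵘ : ∀ n → toℚᵘ (ℕ→ℚ n) ℚᵘ.≃ ℚᵘ.mkℚᵘ (ℤ.+ n) 0
    ℕ→ℚᵘ n = ℚP.toℚᵘ-fromℚᵘ (ℚᵘ.mkℚᵘ (ℤ.+ n) 0)

  ℕ→ℚ-+ : ∀ m n → ℕ→ℚ (m ℕ.+ n) ≡ ℕ→ℚ m + ℕ→ℚ n
  ℕ→ℚ-+ m n = ℚP.toℚᵘ-injective (begin
    toℚᵘ (ℕ→ℚ (m ℕ.+ n)) ≈⟨ ℕ→ℚᵘ (m ℕ.+ n) ⟩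
    ℚᵘ.mkℚᵘ (ℤ.+ (m ℕ.+ n)) 0 ≈⟨ ℚᵘ.*≡* (cong (ℤ._* ℤ.+ 1) (trans (ℤP.pos-+ m n) (cong₂ ℤ._+_ (sym (ℤP.*-identityʳ (ℤ.+ m))) (sym (ℤP.*-identityʳ (ℤ.+ n)))))) ⟩
    ℚᵘ.mkℚᵘ (ℤ.+ m) 0 ℚᵘ.+ ℚᵘ.mkℚᵘ (ℤ.+ n) 0 ≈⟨ ℚᵘP.+-cong (ℕ→ℚᵘ m) (ℕ→ℚᵘ n) ⟨
    toℚᵘ (ℕ→ℚ m) ℚᵘ.+ toℚᵘ (ℕ→ℚ n) ≈⟨ ℚP.toℚᵘ-homo-+ (ℕ→ℚ m) (ℕ→ℚ n) ⟨
    toℚᵘ (ℕ→ℚ m + ℕ→ℚ n) ∎)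
    where open ℚᵘP.≃-Reasoning

  ℕ→ℚ-* : ∀ m n → ℕ→ℚ (m ℕ.* n) ≡ ℕ→ℚ m * ℕ→ℚ n
  ℕ→ℚ-* m n = ℚP.toℚᵘ-injective (begin
    toℚᵘ (ℕ→ℚ (m ℕ.* n)) ≈⟨ ℕ→ℚᵘ (m ℕ.* n) ⟩
    ℚᵘ.mkℚᵘ (ℤ.+ (m ℕ.* n)) 0 ≈⟨ ℚᵘ.*≡* (cong (ℤ._* ℤ.+ 1) (ℤP.pos-* m n)) ⟩
    ℚᵘ.mkℚᵘ (ℤ.+ m) 0 ℚᵘ.* ℚᵘ.mkℚᵘ (ℤ.+ n) 0 ≈⟨ ℚᵘP.*-cong (ℕ→ℚᵘ m) (ℕ→ℚᵘ n) ⟨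
    toℚᵘ (ℕ→ℚ m) ℚᵘ.* toℚᵘ (ℕ→ℚ n) ≈⟨ ℚP.toℚᵘ-homo-* (ℕ→ℚ m) (ℕ→ℚ n) ⟨
    toℚᵘ (ℕ→ℚ m * ℕ→ℚ n) ∎)
    where open ℚᵘP.≃-Reasoning

  ℕ→ℚ-mono : ∀ {m n} → m ℕ.≤ n → ℕ→ℚ m ≤ ℕ→ℚ n
  ℕ→ℚ-mono {m} {n} p = ℚP.toℚᵘ-cancel-≤ (ℚᵘP.≤-respʳ-≃ (ℚᵘP.≃-sym (ℕ→ℚᵘ n)) (ℚᵘP.≤-respˡ-≃ (ℚᵘP.≃-sym (ℕ→ℚᵘ m))
    (ℚᵘ.*≤* (ℤP.*-monoʳ-≤-nonNeg (ℤ.+ 1) (ℤ.+≤+ p)))))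

  ℕ→ℚ-cancel : ∀ {m n} → ℕ→ℚ m ≤ ℕ→ℚ n → m ℕ.≤ n
  ℕ→ℚ-cancel {m} {n} p = ℤP.drop‿+≤+ (ℤP.*-cancelʳ-≤-pos (ℤ.+ m) (ℤ.+ n) (ℤ.+ 1) (ℚᵘP.drop-*≤*
    (ℚᵘP.≤-respʳ-≃ (ℕ→ℚᵘ n) (ℚᵘP.≤-respˡ-≃ (ℕ→ℚᵘ m) (ℚP.toℚᵘ-mono-≤ p)))))

  0≤ℕ : ∀ n → 0ℚ ≤ ℕ→ℚ n
  0≤ℕ n = ℕ→ℚ-mono {0} {n} ℕ.z≤n

  0<ℕ : ∀ n → 0ℚ < ℕ→ℚ (suc n)
  0<ℕ n = <-≤-trans 0<1 (ℕ→ℚ-mono {1} {suc n} (ℕ.s≤s ℕ.z≤n))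

  S-cong : ∀ k {g h : Fin k → ℚ} → (∀ i → g i ≡ h i) → sumℚ k g ≡ sumℚ k h
  S-cong zero e = refl
  S-cong (suc k) e = cong₂ _+_ (e zero) (S-cong k (e ∘ suc))

  S-+ : ∀ k (g h : Fin k → ℚ) → sumℚ k (λ i → g i + h i) ≡ sumℚ k g + sumℚ k h
  S-+ zero g h = refl
  S-+ (suc k) g h = trans (cong ((g zero + h zero) +_) (S-+ k (g ∘ suc) (h ∘ suc)))
    (((∀ a b c d → (a + b) + (c + d) ≡ (a + c) + (b + d)) ∋ solve-∀ ℚ-ring) (g zero) (h zero) (sumℚ k (g ∘ suc)) (sumℚ k (h ∘ suc)))

  S-* : ∀ k c (g : Fin k → ℚ) → sumℚ k (λ i → c * g i) ≡ c * sumℚ k g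
  S-* zero c g = sym (ℚP.*-zeroʳ c)
  S-* (suc k) c g = trans (cong (c * g zero +_) (S-* k c (g ∘ suc))) (sym (ℚP.*-distribˡ-+ c (g zero) (sumℚ k (g ∘ suc))))

  S-*ʳ : ∀ k c (g : Fin k → ℚ) → sumℚ k (λ i → g i * c) ≡ sumℚ k g * c
  S-*ʳ k c g = trans (S-cong k (λ i → ℚP.*-comm (g i) c)) (trans (S-* k c g) (ℚP.*-comm c (sumℚ k g)))

  S-lin : ∀ k c d (g h : Fin k → ℚ) → sumℚ k (λ i → c * g i + d * h i) ≡ c * sumℚ k g + d * sumℚ k h
  S-lin k c d g h = trans (S-+ k _ _) (cong₂ _+_ (S-* k c g) (S-* k d h))

  S-0 : ∀ k {g : Fin k → ℚ} → (∀ i → g i ≡ 0ℚ) → sumℚ k g ≡ 0ℚ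
  S-0 zero e = refl
  S-0 (suc k) e = cong₂ _+_ (e zero) (S-0 k (e ∘ suc))

  S-swap : ∀ m n (g : Fin m → Fin n → ℚ) → sumℚ m (λ i → sumℚ n (λ j → g i j)) ≡ sumℚ n (λ j → sumℚ m (λ i → g i j))
  S-swap zero n g = sym (S-0 n (λ _ → refl))
  S-swap (suc m) n g = trans (cong (sumℚ n (g zero) +_) (S-swap m n (g ∘ suc))) (sym (S-+ n (g zero) _))

  S-mono : ∀ k {g h : Fin k → ℚ} → (∀ i → g i ≤ h i) → sumℚ k g ≤ sumℚ k h
  S-mono zero e = ≤-refl
  S-mono (suc k) e = ℚP.+-mono-≤ (e zero) (S-mono k (e ∘ suc))

  0≤S : ∀ k {g : Fin k → ℚ} → (∀ i → 0ℚ ≤ g i) → 0ℚ ≤ sumℚ k g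
  0≤S k {g} e = subst (_≤ sumℚ k g) (S-0 k (λ _ → refl)) (S-mono k e)

  S-const : ∀ k c → sumℚ k (λ _ → c) ≡ ℕ→ℚ k * c
  S-const zero c = sym (ℚP.*-zeroˡ c)
  S-const (suc k) c = trans (cong (c +_) (S-const k c)) (trans (((∀ c k → c + k * c ≡ (1ℚ + k) * c) ∋ solve-∀ ℚ-ring) c (ℕ→ℚ k)) (cong (_* c) (sym (ℕ→ℚ-+ 1 k))))

  S-punch : ∀ k (g : Fin (suc k) → ℚ) i → sumℚ (suc k) g ≡ g i + sumℚ k (λ j → g (punchIn i j))
  S-punch k g zero = refl
  S-punch (suc k) g (suc i) = trans (cong (g zero +_) (S-punch k (g ∘ suc) i))
    (((∀ a b c → a + (b + c) ≡ b + (a + c)) ∋ solve-∀ ℚ-ring) (g zero) (g (suc i)) (sumℚ k (λ j → g (suc (punchIn i j)))))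

  S-average : ∀ k (g : Fin (suc k) → ℚ) → ∃ λ i → ℕ→ℚ (suc k) * g i ≤ sumℚ (suc k) g
  S-average zero g = zero , ≤-reflexive (((∀ a → 1ℚ * a ≡ a + 0ℚ) ∋ solve-∀ ℚ-ring) (g zero))
  S-average (suc k) g with S-average k (g ∘ suc)
  ... | i , p with ℚP.≤-total (g zero) (g (suc i))
  ...   | inj₁ q = zero , ≤-trans (≤-reflexive (trans (cong (_* g zero) (ℕ→ℚ-+ 1 (suc k))) (((∀ k a → (1ℚ + k) * a ≡ a + k * a) ∋ solve-∀ ℚ-ring) (ℕ→ℚ (suc k)) (g zero))))
                     (ℚP.+-monoʳ-≤ (g zero) (≤-trans (*-monoˡ (0≤ℕ (suc k)) q) p))
  ...   | inj₂ q = suc i , ≤-trans (≤-reflexive (trans (cong (_* g (suc i)) (ℕ→ℚ-+ 1 (suc k))) (((∀ k a → (1ℚ + k) * a ≡ a + k * a) ∋ solve-∀ ℚ-ring) (ℕ→ℚ (suc k)) (g (suc i)))))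
                     (ℚP.+-mono-≤ q p)

  δ : ∀ {k} → Fin k → Fin k → ℚ
  δ zero zero = 1ℚ
  δ zero (suc j) = 0ℚ
  δ (suc i) zero = 0ℚ
  δ (suc i) (suc j) = δ i j

  S-δ : ∀ k i (g : Fin k → ℚ) → sumℚ k (λ j → δ i j * g j) ≡ g i
  S-δ (suc k) zero g = trans (cong₂ _+_ (ℚP.*-identityˡ (g zero)) (S-0 k (λ j → ℚP.*-zeroˡ (g (suc j))))) (ℚP.+-identityʳ (g zero))
  S-δ (suc k) (suc i) g = trans (cong₂ _+_ (ℚP.*-zeroˡ (g zero)) (S-δ k i (g ∘ suc))) (ℚP.+-identityˡ (g (suc i)))

  ∑ : List A → (A → ℚ) → ℚ
  ∑ xs g = sumℚ (length xs) (λ i → g (lookup xs i))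

  ∑-cong∈ : ∀ (xs : List A) {g h : A → ℚ} → (∀ {x} → x ∈ xs → g x ≡ h x) → ∑ xs g ≡ ∑ xs h
  ∑-cong∈ xs e = S-cong (length xs) (λ i → e (∈-lookup {xs = xs} i))

  ∑-mono∈ : ∀ (xs : List A) {g h : A → ℚ} → (∀ {x} → x ∈ xs → g x ≤ h x) → ∑ xs g ≤ ∑ xs h
  ∑-mono∈ xs e = S-mono (length xs) (λ i → e (∈-lookup {xs = xs} i))

  ∑-cong : ∀ (xs : List A) {g h : A → ℚ} → (∀ x → g x ≡ h x) → ∑ xs g ≡ ∑ xs h
  ∑-cong xs e = ∑-cong∈ xs (λ {x} _ → e x)

  ∑-mono : ∀ (xs : List A) {g h : A → ℚ} → (∀ x → g x ≤ h x) → ∑ xs g ≤ ∑ xs h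
  ∑-mono xs e = ∑-mono∈ xs (λ {x} _ → e x)

  ∑-* : ∀ (xs : List A) c (g : A → ℚ) → ∑ xs (λ x → c * g x) ≡ c * ∑ xs g
  ∑-* xs c g = S-* (length xs) c _

  ∑-*ʳ : ∀ (xs : List A) c (g : A → ℚ) → ∑ xs (λ x → g x * c) ≡ ∑ xs g * c
  ∑-*ʳ xs c g = S-*ʳ (length xs) c _

  ∑-lin : ∀ (xs : List A) c d (g h : A → ℚ) → ∑ xs (λ x → c * g x + d * h x) ≡ c * ∑ xs g + d * ∑ xs h
  ∑-lin xs c d g h = S-lin (length xs) c d _ _

  0≤∑ : ∀ (xs : List A) {g : A → ℚ} → (∀ x → 0ℚ ≤ g x) → 0ℚ ≤ ∑ xs g
  0≤∑ xs e = 0≤S (length xs) (λ i → e (lookup xs i))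

  ∑-++ : ∀ (xs ys : List A) (g : A → ℚ) → ∑ (xs ++ ys) g ≡ ∑ xs g + ∑ ys g
  ∑-++ [] ys g = sym (ℚP.+-identityˡ _)
  ∑-++ (x ∷ xs) ys g = trans (cong (g x +_) (∑-++ xs ys g)) (sym (ℚP.+-assoc (g x) _ _))

  ∑-map : ∀ (f : A → B) (xs : List A) (g : B → ℚ) → ∑ (map f xs) g ≡ ∑ xs (g ∘ f)
  ∑-map f [] g = refl
  ∑-map f (x ∷ xs) g = cong (g (f x) +_) (∑-map f xs g)

-- Linear algebra by elimination: bases, orthogonal families, rank halving.

module Linear where
  open Rationals
  open import Data.Nat as ℕ using (ℕ; zero; suc)
  import Data.Nat.Properties as ℕP
  open import Data.Rational using (ℚ; 0ℚ; 1ℚ; _+_; _*_; _-_; -_)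
  import Data.Rational.Properties as ℚP
  open import Tactic.RingSolver using (solve-∀)

  private variable
    A B : Set

  infixr 5 _◂_
  _◂_ : ∀ {k} → A → (Fin k → A) → Fin (suc k) → A
  (x ◂ g) zero = x
  (x ◂ g) (suc i) = g i

  nonzero? : (X : List A) (g : A → ℚ) → (∃ λ c → c ∈ X × g c ≢ 0ℚ) ⊎ (∀ {a} → a ∈ X → g a ≡ 0ℚ)
  nonzero? [] g = inj₂ (λ ())
  nonzero? (x ∷ X) g with g x ℚP.≟ 0ℚ
  ... | no p = inj₁ (x , here refl , p)
  ... | yes p with nonzero? X g
  ...   | inj₁ (c , m , q) = inj₁ (c , there m , q)
  ...   | inj₂ q = inj₂ λ { (here refl) → p ; (there m) → q m }

  -- The rows `e j` form a basis of the span and `W` holds the coordinates in it. The field `vanish`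
  -- carries the induction: clearing the pivot row leaves a zero row, whose coordinates in the
  -- smaller basis must be 0 for `dual` to hold.
  record Basis (k : ℕ) (X : List A) (u : A → Fin k → ℚ) : Set where
    field
      dim    : ℕ
      dim≤   : dim ℕ.≤ k
      e      : Fin dim → A
      e∈     : ∀ j → e j ∈ X
      W      : A → Fin dim → ℚ
      expand : ∀ {a} → a ∈ X → ∀ i → u a i ≡ sumℚ dim (λ j → W a j * u (e j) i)
      vanish : ∀ {a} → (∀ i → u a i ≡ 0ℚ) → ∀ j → W a j ≡ 0ℚ
      dual   : ∀ j j' → W (e j) j' ≡ δ j j'

  basis : ∀ k (X : List A) (u : A → Fin k → ℚ) → Basis k X u
  basis zero X u = record
    { dim = 0 ; dim≤ = ℕ.z≤n ; e = λ () ; e∈ = λ () ; W = λ _ () ; expand = λ _ () ; vanish = λ _ () ; dual = λ () }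
  basis {A} (suc k) X u with nonzero? X (λ a → u a zero)
  ... | inj₂ z = record
    { Basis IH hiding (expand; vanish; dim≤)
    ; dim≤ = ℕP.m≤n⇒m≤1+n (Basis.dim≤ IH)
    ; expand = λ m → λ
        { zero → trans (z m) (sym (S-0 dim (λ j → trans (cong (W _ j *_) (z (e∈ j))) (ℚP.*-zeroʳ (W _ j)))))
        ; (suc i) → expand m i }
    ; vanish = λ p → vanish (p ∘ suc) }
    where
      IH = basis k X (λ a i → u a (suc i))
      open Basis IH
  ... | inj₁ (c , c∈ , c≢0) = record
    { dim = suc dim
    ; dim≤ = ℕ.s≤s dim≤
    ; e = c ◂ e
    ; e∈ = λ { zero → c∈ ; (suc j) → e∈ j }
    -- Each `ũ (e j)` is `u (e j)` minus `t (e j)` times the pivot row, so expanding in the original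
    -- rows brings in `Q a` unwanted copies of the pivot row, which are taken off `t a`.
    ; W = λ a → (t a - Q a) ◂ W a
    ; expand = λ {a} m i → trans
        (((∀ x y z → x ≡ (x - y * z) + y * z) ∋ solve-∀ ℚ-ring) (u a i) (t a) (u c i))
        (trans (cong (_+ t a * u c i) (trans (expandũ m i) (S-ũ a i)))
        (((∀ p q y z → (p - q * z) + y * z ≡ (y - q) * z + p) ∋ solve-∀ ℚ-ring) (P a i) (Q a) (t a) (u c i)))
    ; vanish = λ {a} p → λ
        { zero → trans (cong₂ _-_ (t0 p) (S-0 dim (λ j → trans (cong (_* t (e j)) (W0 p j)) (ℚP.*-zeroˡ (t (e j)))))) (ℚP.+-inverseʳ 0ℚ)
        ; (suc j) → W0 p j }
    ; dual = λ
        { zero zero → trans (cong₂ _-_ tc (S-0 dim (λ j → trans (cong (_* t (e j)) (Wc j)) (ℚP.*-zeroˡ (t (e j)))))) (ℚP.+-identityʳ 1ℚ)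
        ; zero (suc j) → Wc j
        ; (suc j) zero → trans (cong (λ x → t (e j) - x) (trans (S-cong dim (λ j' → cong (_* t (e j')) (dual j j'))) (S-δ dim j (t ∘ e)))) (ℚP.+-inverseʳ (t (e j)))
        ; (suc j) (suc j') → dual j j' } }
    where
      i₀ = inv (u c zero)
      t : A → ℚ
      t a = u a zero * i₀
      ũ : A → Fin (suc k) → ℚ
      ũ a i = u a i - t a * u c i
      IH = basis k X (λ a i → ũ a (suc i))
      open Basis IH
      P : A → Fin (suc k) → ℚ
      P a i = sumℚ dim (λ j → W a j * u (e j) i)
      Q : A → ℚ
      Q a = sumℚ dim (λ j → W a j * t (e j))
      tc : t c ≡ 1ℚ
      tc = inv-right (u c zero) c≢0
      ũ0 : ∀ a → ũ a zero ≡ 0ℚ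
      ũ0 a = trans (((∀ x y z → x - x * y * z ≡ x * (1ℚ - z * y)) ∋ solve-∀ ℚ-ring) (u a zero) i₀ (u c zero))
        (trans (cong (λ w → u a zero * (1ℚ - w)) tc) (ℚP.*-zeroʳ (u a zero)))
      expandũ : ∀ {a} → a ∈ X → ∀ i → ũ a i ≡ sumℚ dim (λ j → W a j * ũ (e j) i)
      expandũ {a} m zero = trans (ũ0 a) (sym (S-0 dim (λ j → trans (cong (W a j *_) (ũ0 (e j))) (ℚP.*-zeroʳ (W a j)))))
      expandũ m (suc i) = expand m i
      S-ũ : ∀ a i → sumℚ dim (λ j → W a j * ũ (e j) i) ≡ P a i - Q a * u c i
      S-ũ a i = trans (S-cong dim (λ j → ((∀ w x y z → w * (x - y * z) ≡ 1ℚ * (w * x) + (- z) * (w * y)) ∋ solve-∀ ℚ-ring) (W a j) (u (e j) i) (t (e j)) (u c i)))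
        (trans (S-lin dim 1ℚ (- u c i) (λ j → W a j * u (e j) i) (λ j → W a j * t (e j)))
        (((∀ p q z → 1ℚ * p + (- z) * q ≡ p - q * z) ∋ solve-∀ ℚ-ring) (P a i) (Q a) (u c i)))
      t0 : ∀ {a} → (∀ i → u a i ≡ 0ℚ) → t a ≡ 0ℚ
      t0 p = trans (cong (_* i₀) (p zero)) (ℚP.*-zeroˡ i₀)
      W0 : ∀ {a} → (∀ i → u a i ≡ 0ℚ) → ∀ j → W a j ≡ 0ℚ
      W0 {a} p = vanish (λ i → trans (cong₂ (λ x y → x - y * u c (suc i)) (p (suc i)) (t0 p)) (((∀ z → 0ℚ - 0ℚ * z ≡ 0ℚ) ∋ solve-∀ ℚ-ring) (u c (suc i))))
      Wc : ∀ j → W c j ≡ 0ℚ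
      Wc = vanish (λ i → trans (cong (λ y → u c (suc i) - y * u c (suc i)) tc) (((∀ z → z - 1ℚ * z ≡ 0ℚ) ∋ solve-∀ ℚ-ring) (u c (suc i))))

  Spans : ∀ {K} → List A → (A → Fin K → ℚ) → ℕ → Set
  Spans {A} {K} X u p = Σ (A → Fin p → ℚ) λ α → Σ (Fin p → Fin K → ℚ) λ s →
    ∀ {a} → a ∈ X → ∀ i → u a i ≡ sumℚ p (λ j → α a j * s j i)

  Split : ∀ {K} → List A → List B → (A → Fin K → ℚ) → (B → Fin K → ℚ) → Set
  Split {K = K} X Y u v = ∃ λ p → ∃ λ q → p ℕ.+ q ℕ.≤ K × Spans X u p × Spans Y v q

  Orthogonal : ∀ {K} → List A → List B → (A → Fin K → ℚ) → (B → Fin K → ℚ) → Set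
  Orthogonal {A} {B} {K} X Y u v = ∀ {a b} → a ∈ X → b ∈ Y → sumℚ K (λ i → u a i * v b i) ≡ 0ℚ

  private
    zero-orthogonal : ∀ {K} {X : List A} {Y : List B} (u : A → Fin (suc K) → ℚ) (v : B → Fin (suc K) → ℚ) →
      (∀ {a} → a ∈ X → u a zero ≡ 0ℚ) → Orthogonal X Y u v → Orthogonal X Y (λ a i → u a (suc i)) (λ b i → v b (suc i))
    zero-orthogonal {K = K} u v z o {a} {b} m n = trans
      (((∀ x y → y ≡ (x + y) - x) ∋ solve-∀ ℚ-ring) (u a zero * v b zero) (sumℚ K (λ i → u a (suc i) * v b (suc i))))
      (trans (cong₂ (λ x y → x - y * v b zero) (o m n) (z m)) (((∀ x → 0ℚ - 0ℚ * x ≡ 0ℚ) ∋ solve-∀ ℚ-ring) (v b zero)))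

    -- Orthogonality says nothing about the first coordinate of the v's here, so this dimension is
    -- charged to their side.
    zero-split : ∀ {K} {X : List A} {Y : List B} (u : A → Fin (suc K) → ℚ) (v : B → Fin (suc K) → ℚ) →
      (∀ {a} → a ∈ X → u a zero ≡ 0ℚ) → Split X Y (λ a i → u a (suc i)) (λ b i → v b (suc i)) → Split X Y u v
    zero-split {K = K} u v z (p , q , pq , (α , s , hu) , (β , r , hv)) =
          p , suc q , subst (ℕ._≤ suc K) (sym (ℕP.+-suc p q)) (ℕ.s≤s pq)
        , (α , (λ j → 0ℚ ◂ s j) , λ {a} m → λ
            { zero → trans (z m) (sym (S-0 p (λ j → ℚP.*-zeroʳ (α a j))))
            ; (suc i) → hu m i })
        , ((λ b → v b zero ◂ β b) , ((1ℚ ◂ (λ _ → 0ℚ)) ◂ (λ j → 0ℚ ◂ r j)) , λ {b} m → λ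
            { zero → sym (trans (cong (v b zero * 1ℚ +_) (S-0 q (λ j → ℚP.*-zeroʳ (β b j)))) (((∀ x → x * 1ℚ + 0ℚ ≡ x) ∋ solve-∀ ℚ-ring) (v b zero)))
            ; (suc i) → trans (hv m i) (sym (((∀ x y → x * 0ℚ + y ≡ y) ∋ solve-∀ ℚ-ring) (v b zero) (sumℚ q (λ j → β b j * r j i)))) })

  module Pivot {A B : Set} {K : ℕ} {X : List A} {Y : List B} (u : A → Fin (suc K) → ℚ) (v : B → Fin (suc K) → ℚ)
    (o : Orthogonal X Y u v) {c : A} (c∈ : c ∈ X) (c≢0 : u c zero ≢ 0ℚ) where
    i₀ : ℚ
    i₀ = inv (u c zero)

    t : A → ℚ
    t a = u a zero * i₀

    u' : A → Fin K → ℚ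
    u' a i = u a (suc i) - t a * u c (suc i)

    v' : B → Fin K → ℚ
    v' b i = v b (suc i)

    tail : A → B → ℚ
    tail a b = sumℚ K (λ i → u a (suc i) * v b (suc i))

    private
      cancel : ∀ x y z w r s → z * y ≡ 1ℚ → x * w + r ≡ 0ℚ → z * w + s ≡ 0ℚ → 1ℚ * r + (- (x * y)) * s ≡ 0ℚ
      cancel x y z w r s e₁ e₂ e₃ = trans (((∀ x y z w r s → 1ℚ * r + (- (x * y)) * s ≡ (x * w + r) - (x * y) * (z * w + s) - x * w * (1ℚ - z * y)) ∋ solve-∀ ℚ-ring) x y z w r s)
        (trans (cong (λ t → t - (x * y) * (z * w + s) - x * w * (1ℚ - z * y)) e₂)
        (trans (cong₂ (λ t t' → 0ℚ - (x * y) * t - x * w * (1ℚ - t')) e₃ e₁)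
        (((∀ a b → 0ℚ - a * 0ℚ - b * (1ℚ - 1ℚ) ≡ 0ℚ) ∋ solve-∀ ℚ-ring) (x * y) (x * w))))

    orthogonal : Orthogonal X Y u' v'
    orthogonal {a} {b} m n = trans
      (S-cong K (λ i → ((∀ x y z w → (x - y * z) * w ≡ 1ℚ * (x * w) + (- y) * (z * w)) ∋ solve-∀ ℚ-ring) (u a (suc i)) (t a) (u c (suc i)) (v b (suc i))))
      (trans (S-lin K 1ℚ (- t a) (λ i → u a (suc i) * v b (suc i)) (λ i → u c (suc i) * v b (suc i)))
      (cancel (u a zero) i₀ (u c zero) (v b zero) (tail a b) (tail c b) (inv-right (u c zero) c≢0) (o m n) (o c∈ n)))

    split : Split X Y u' v' → Split X Y u v
    split (p , q , pq , (α , s , hu) , (β , r , hv)) =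
        suc p , q , ℕ.s≤s pq
      , ((λ a → t a ◂ α a) , (u c ◂ (λ j → 0ℚ ◂ s j)) , λ {a} m → λ
          { zero → sym (trans (cong (t a * u c zero +_) (S-0 p (λ j → ℚP.*-zeroʳ (α a j))))
                    (trans (((∀ x y z → x * y * z + 0ℚ ≡ x * (z * y)) ∋ solve-∀ ℚ-ring) (u a zero) i₀ (u c zero))
                    (trans (cong (u a zero *_) (inv-right (u c zero) c≢0)) (ℚP.*-identityʳ (u a zero)))))
          ; (suc i) → trans (((∀ x y → x ≡ y + (x - y)) ∋ solve-∀ ℚ-ring) (u a (suc i)) (t a * u c (suc i))) (cong (t a * u c (suc i) +_) (hu m i)) })
      -- Orthogonality to the pivot row expresses the first coordinate of every v linearly in the
      -- others, so the v side gains no dimension; the pivot row itself is charged to the u side.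
      , (β , (λ j → (- i₀) * R j ◂ r j) , λ {b} m → λ
          { zero → first m
          ; (suc i) → hv m i })
      where
      R : Fin q → ℚ
      R j = sumℚ K (λ i → u c (suc i) * r j i)
      sum-R : ∀ {b} → b ∈ Y → sumℚ q (λ j → β b j * R j) ≡ tail c b
      sum-R {b} m = begin
        sumℚ q (λ j → β b j * R j) ≡⟨ S-cong q (λ j → sym (S-* K (β b j) (λ i → u c (suc i) * r j i))) ⟩
        sumℚ q (λ j → sumℚ K (λ i → β b j * (u c (suc i) * r j i))) ≡⟨ S-swap q K (λ j i → β b j * (u c (suc i) * r j i)) ⟩
        sumℚ K (λ i → sumℚ q (λ j → β b j * (u c (suc i) * r j i)))
          ≡⟨ S-cong K (λ i → trans (S-cong q (λ j → ((∀ x y z → x * (y * z) ≡ y * (x * z)) ∋ solve-∀ ℚ-ring) (β b j) (u c (suc i)) (r j i)))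
               (trans (S-* q (u c (suc i)) (λ j → β b j * r j i)) (cong (u c (suc i) *_) (sym (hv m i))))) ⟩
        tail c b ∎
        where open ≡-Reasoning
      first : ∀ {b} → b ∈ Y → v b zero ≡ sumℚ q (λ j → β b j * ((- i₀) * R j))
      first {b} m = sym (begin
        sumℚ q (λ j → β b j * ((- i₀) * R j)) ≡⟨ S-cong q (λ j → ((∀ x y z → x * (y * z) ≡ y * (x * z)) ∋ solve-∀ ℚ-ring) (β b j) (- i₀) (R j)) ⟩
        sumℚ q (λ j → (- i₀) * (β b j * R j)) ≡⟨ S-* q (- i₀) (λ j → β b j * R j) ⟩
        (- i₀) * sumℚ q (λ j → β b j * R j) ≡⟨ cong ((- i₀) *_) (sum-R m) ⟩
        (- i₀) * tail c b ≡⟨ ((∀ y z w s → (- y) * s ≡ (z * y) * w - y * (z * w + s)) ∋ solve-∀ ℚ-ring) i₀ (u c zero) (v b zero) (tail c b) ⟩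
        (u c zero * i₀) * v b zero - i₀ * (u c zero * v b zero + tail c b) ≡⟨ cong₂ (λ x y → x * v b zero - i₀ * y) (inv-right (u c zero) c≢0) (o c∈ m) ⟩
        1ℚ * v b zero - i₀ * 0ℚ ≡⟨ ((∀ x y → 1ℚ * x - y * 0ℚ ≡ x) ∋ solve-∀ ℚ-ring) (v b zero) i₀ ⟩
        v b zero ∎)
        where open ≡-Reasoning

  -- The inequality dim V + dim W ≤ K for orthogonal subspaces, with explicit spanning families:
  -- each coordinate eliminated is charged to exactly one of the two sides.
  orthogonal-split : ∀ K (X : List A) (Y : List B) (u : A → Fin K → ℚ) (v : B → Fin K → ℚ) → Orthogonal X Y u v → Split X Y u v
  orthogonal-split zero X Y u v o = 0 , 0 , ℕ.z≤n , ((λ _ ()) , (λ ()) , (λ _ ())) , ((λ _ ()) , (λ ()) , (λ _ ()))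
  orthogonal-split (suc K) X Y u v o with nonzero? X (λ a → u a zero)
  ... | inj₂ z = zero-split u v z (orthogonal-split K X Y (λ a i → u a (suc i)) (λ b i → v b (suc i)) (zero-orthogonal {X = X} {Y = Y} u v z o))
  ... | inj₁ (c , c∈ , c≢0) = split (orthogonal-split K X Y u' v' orthogonal)
    where open Pivot {X = X} {Y = Y} u v o c∈ c≢0

  FactorsOn : List A → List B → (A → B → ℚ) → ℕ → Set
  FactorsOn {A} {B} X Y g k = Σ (A → Fin k → ℚ) λ U → Σ (B → Fin k → ℚ) λ V →
    ∀ {a b} → a ∈ X → b ∈ Y → g a b ≡ sumℚ k (λ i → U a i * V b i)

  FactorsOn-swap : ∀ {k} {X : List A} {Y : List B} {g : A → B → ℚ} → FactorsOn X Y g k → FactorsOn Y X (λ b a → g a b) k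
  FactorsOn-swap {k = k} (U , V , h) = V , U , λ m n → trans (h n m) (S-cong k (λ i → ℚP.*-comm (U _ i) (V _ i)))

  -- One more coordinate factors g - w in dimension k + 1. This difference vanishes on X₁ × Y₁, so
  -- its left vectors on X₁ and its right vectors on Y₁ are orthogonal and their dimensions add up
  -- to at most k + 1. Adding w back costs one dimension on each side.
  halve-rank : ∀ {k} {X X₁ : List A} {Y Y₁ : List B} {g : A → B → ℚ} {w : ℚ} →
    (∀ {a} → a ∈ X₁ → a ∈ X) → (∀ {b} → b ∈ Y₁ → b ∈ Y) →
    FactorsOn X Y g k → (∀ {a b} → a ∈ X₁ → b ∈ Y₁ → g a b ≡ w) →
    ∃ λ p → ∃ λ q → p ℕ.+ q ℕ.≤ suc k × FactorsOn X₁ Y g (suc p) × FactorsOn X Y₁ g (suc q)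
  halve-rank {A} {B} {k} {X} {X₁} {Y} {Y₁} {g} {w} X⊆ Y⊆ (U , V , h) mono =
    result (orthogonal-split (suc k) X₁ Y₁ u v o)
    where
      u : A → Fin (suc k) → ℚ
      u a = (- w) ◂ U a
      v : B → Fin (suc k) → ℚ
      v b = 1ℚ ◂ V b
      g≡ : ∀ {a b} → a ∈ X → b ∈ Y → g a b ≡ w * 1ℚ + sumℚ (suc k) (λ i → u a i * v b i)
      g≡ {a} {b} m n = trans (h m n) (((∀ w s → s ≡ w * 1ℚ + ((- w) * 1ℚ + s)) ∋ solve-∀ ℚ-ring) w (sumℚ k (λ i → U a i * V b i)))
      o : Orthogonal X₁ Y₁ u v
      o {a} {b} m n = trans (cong₂ (λ x y → (- x) * 1ℚ + y) (sym (mono m n)) (sym (h (X⊆ m) (Y⊆ n)))) (((∀ x → (- x) * 1ℚ + x ≡ 0ℚ) ∋ solve-∀ ℚ-ring) (g a b))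
      result : Split X₁ Y₁ u v → ∃ λ p → ∃ λ q → p ℕ.+ q ℕ.≤ suc k × FactorsOn X₁ Y g (suc p) × FactorsOn X Y₁ g (suc q)
      result (p , q , pq , (α , s , hu) , (β , r , hv)) = p , q , pq
        , ((λ a → w ◂ α a) , (λ b → 1ℚ ◂ (λ j → sumℚ (suc k) (λ i → s j i * v b i))) , λ {a} {b} m n →
            trans (g≡ (X⊆ m) n) (cong (w * 1ℚ +_)
              (trans (S-cong (suc k) (λ i → trans (cong (_* v b i) (hu m i)) (trans (sym (S-*ʳ p (v b i) (λ j → α a j * s j i))) (S-cong p (λ j → ℚP.*-assoc (α a j) (s j i) (v b i))))))
              (trans (S-swap (suc k) p (λ i j → α a j * (s j i * v b i))) (S-cong p (λ j → S-* (suc k) (α a j) (λ i → s j i * v b i)))))))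
        , ((λ a → w ◂ (λ j → sumℚ (suc k) (λ i → u a i * r j i))) , (λ b → 1ℚ ◂ β b) , λ {a} {b} m n →
            trans (g≡ m (Y⊆ n)) (cong (w * 1ℚ +_)
              (trans (S-cong (suc k) (λ i → trans (cong (u a i *_) (hv n i)) (trans (sym (S-* q (u a i) (λ j → β b j * r j i))) (S-cong q (λ j → ((∀ x y z → x * (y * z) ≡ x * z * y) ∋ solve-∀ ℚ-ring) (u a i) (β b j) (r j i))))))
              (trans (S-swap (suc k) q (λ i j → u a i * r j i * β b j)) (S-cong q (λ j → S-*ʳ (suc k) (β b j) (λ i → u a i * r j i)))))))

-- Gram matrices, determinants and leverage scores through pivots.

module Design where
  open Rationals
  open Linear
  open import Data.Nat using (ℕ; zero; suc)
  open import Data.Rational using (ℚ; 0ℚ; 1ℚ; _+_; _*_; _-_; -_; _≤_; _<_)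
  open import Data.Rational.Properties as ℚP using (≤-refl; <⇒≤; <-≤-trans)
  open import Tactic.RingSolver using (solve-∀)

  private variable
    A B : Set
    k N : ℕ

  Mat : ℕ → Set
  Mat k = Fin k → Fin k → ℚ

  _≐_ : Mat k → Mat k → Set
  G ≐ H = ∀ i j → G i j ≡ H i j

  Schur : Mat (suc k) → Mat k
  Schur G i j = G (suc i) (suc j) - inv (G zero zero) * (G (suc i) zero * G (suc j) zero)

  reduce : Mat (suc k) → (Fin (suc k) → ℚ) → Fin k → ℚ
  reduce G u i = u (suc i) - u zero * inv (G zero zero) * G (suc i) zero

  -- Positive definiteness, the determinant and the quadratic form u ↦ uᵀG⁻¹u are
  -- all read off the pivots of Gaussian elimination; no inverse matrix is formed.
  PosDef : ∀ k → Mat k → Set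
  PosDef zero G = ⊤
  PosDef (suc k) G = 0ℚ < G zero zero × PosDef k (Schur G)

  det : ∀ k → Mat k → ℚ
  det zero G = 1ℚ
  det (suc k) G = G zero zero * det k (Schur G)

  nrm : ∀ k → Mat k → (Fin k → ℚ) → ℚ
  nrm zero G u = 0ℚ
  nrm (suc k) G u = u zero * u zero * inv (G zero zero) + nrm k (Schur G) (reduce G u)

  Schur-cong : {G H : Mat (suc k)} → G ≐ H → Schur G ≐ Schur H
  Schur-cong e i j = cong₂ _-_ (e (suc i) (suc j)) (cong₂ _*_ (cong inv (e zero zero)) (cong₂ _*_ (e (suc i) zero) (e (suc j) zero)))

  reduce-cong : {G H : Mat (suc k)} {u v : Fin (suc k) → ℚ} → G ≐ H → u ≗ v → reduce G u ≗ reduce H v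
  reduce-cong e f i = cong₂ _-_ (f (suc i)) (cong₂ _*_ (cong₂ _*_ (f zero) (cong inv (e zero zero))) (e (suc i) zero))

  PosDef-cong : ∀ k {G H : Mat k} → G ≐ H → PosDef k G → PosDef k H
  PosDef-cong zero e p = tt
  PosDef-cong (suc k) e (p , q) = subst (0ℚ <_) (e zero zero) p , PosDef-cong k (Schur-cong e) q

  det-cong : ∀ k {G H : Mat k} → G ≐ H → det k G ≡ det k H
  det-cong zero e = refl
  det-cong (suc k) e = cong₂ _*_ (e zero zero) (det-cong k (Schur-cong e))

  nrm-cong : ∀ k {G H : Mat k} {u v : Fin k → ℚ} → G ≐ H → u ≗ v → nrm k G u ≡ nrm k H v
  nrm-cong zero e f = refl
  nrm-cong (suc k) e f = cong₂ _+_ (cong₂ _*_ (cong₂ _*_ (f zero) (f zero)) (cong inv (e zero zero))) (nrm-cong k (Schur-cong e) (reduce-cong e f))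

  PosDef? : ∀ k (G : Mat k) → Dec (PosDef k G)
  PosDef? zero G = yes tt
  PosDef? (suc k) G = (0ℚ ℚP.<? G zero zero) ×-dec PosDef? k (Schur G)

  0<det : ∀ k {G : Mat k} → PosDef k G → 0ℚ < det k G
  0<det zero p = 0<1
  0<det (suc k) (p , q) = 0<* p (0<det k q)

  0≤nrm : ∀ k {G : Mat k} → PosDef k G → ∀ u → 0ℚ ≤ nrm k G u
  0≤nrm zero p u = ≤-refl
  0≤nrm (suc k) (p , q) u = 0≤+ (0≤* (0≤sq (u zero)) (<⇒≤ (0<inv p))) (0≤nrm k q _)

  update : ℚ → (Fin k → ℚ) → Mat k → Mat k
  update κ u G i j = G i j + κ * (u i * u j)

  inv-unique : ∀ {x y} → 0ℚ < x → x * y ≡ 1ℚ → inv x ≡ y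
  inv-unique {x} {y} p e = begin
    inv x ≡⟨ ℚP.*-identityʳ (inv x) ⟨
    inv x * 1ℚ ≡⟨ cong (inv x *_) e ⟨
    inv x * (x * y) ≡⟨ ((∀ i x y → i * (x * y) ≡ (x * i) * y) ∋ solve-∀ ℚ-ring) (inv x) x y ⟩
    (x * inv x) * y ≡⟨ cong (_* y) (inv-rightᵖ p) ⟩
    1ℚ * y ≡⟨ ℚP.*-identityˡ y ⟩
    y ∎
    where open ≡-Reasoning

  -- The case of interest is κ < 0, the removal of a row: 1 + κt then decreases in t, so positivity
  -- at the full norm implies it at the part seen by the first pivot.
  0<1+*-interpolate : ∀ {κ p q} → 0ℚ ≤ p → 0ℚ ≤ q → 0ℚ < 1ℚ + κ * (p + q) → 0ℚ < 1ℚ + κ * p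
  0<1+*-interpolate {κ} {p} {q} 0≤p 0≤q h with ℚP.≤-total 0ℚ κ
  ... | inj₁ 0≤κ = 0<+≤ 0<1 (0≤* 0≤κ 0≤p)
  ... | inj₂ κ≤0 = <-≤-trans h (0≤⇒≤ ((0ℚ - κ) * q) (0≤* (≤⇒0≤ κ≤0) 0≤q)
    (((∀ κ p q → 1ℚ + κ * p ≡ (1ℚ + κ * (p + q)) + (0ℚ - κ) * q) ∋ solve-∀ ℚ-ring) κ p q))

  -- The matrix determinant lemma. The Schur complement of an update by κ is again a rank-one update
  -- of the Schur complement, with κ divided by 1 + κz²/g; hence the induction is over all κ, of
  -- either sign.
  rank-one : ∀ k (G : Mat k) u κ → PosDef k G → 0ℚ < 1ℚ + κ * nrm k G u →
    PosDef k (update κ u G) × det k (update κ u G) ≡ (1ℚ + κ * nrm k G u) * det k G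
  rank-one zero G u κ pd h = tt , ((∀ κ → 1ℚ ≡ (1ℚ + κ * 0ℚ) * 1ℚ) ∋ solve-∀ ℚ-ring) κ
  rank-one (suc k) G u κ (0<g , pd) h =
    (subst (0ℚ <_) (sym corner) (0<* 0<g 0<f) , PosDef-cong k (λ i j → sym (schur i j)) (proj₁ IH)) ,
    (begin
      (g + κ * (z * z)) * det k (Schur (update κ u G)) ≡⟨ cong₂ _*_ corner (trans (det-cong k schur) (proj₂ IH)) ⟩
      (g * f) * ((1ℚ + κ * η * n) * d) ≡⟨ cong (λ x → (g * f) * (x * d)) step ⟩
      (g * f) * (η * (1ℚ + κ * (p + n)) * d) ≡⟨ ((∀ g f η x d → (g * f) * (η * x * d) ≡ (f * η) * (x * (g * d))) ∋ solve-∀ ℚ-ring) g f η (1ℚ + κ * (p + n)) d ⟩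
      (f * η) * ((1ℚ + κ * (p + n)) * (g * d)) ≡⟨ cong (_* ((1ℚ + κ * (p + n)) * (g * d))) fη ⟩
      1ℚ * ((1ℚ + κ * (p + n)) * (g * d)) ≡⟨ ℚP.*-identityˡ ((1ℚ + κ * (p + n)) * (g * d)) ⟩
      (1ℚ + κ * (p + n)) * (g * d) ∎)
    where
    open ≡-Reasoning
    g z ι p f η n d : ℚ
    g = G zero zero
    z = u zero
    ι = inv g
    p = z * z * ι
    f = 1ℚ + κ * p
    η = inv f
    n = nrm k (Schur G) (reduce G u)
    d = det k (Schur G)
    0<f : 0ℚ < f
    0<f = 0<1+*-interpolate {κ} {p} {n} (0≤* (0≤sq z) (<⇒≤ (0<inv 0<g))) (0≤nrm k pd (reduce G u)) h
    gι : g * ι ≡ 1ℚ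
    gι = inv-rightᵖ 0<g
    fη : f * η ≡ 1ℚ
    fη = inv-rightᵖ 0<f
    corner : g + κ * (z * z) ≡ g * f
    corner = trans (cong (λ x → g + κ * (z * z) * x) (sym gι) ∙ʳ) (((∀ g κ z ι → g + κ * (z * z) * (g * ι) ≡ g * (1ℚ + κ * (z * z * ι))) ∋ solve-∀ ℚ-ring) g κ z ι)
      where
      infix 9 _∙ʳ
      _∙ʳ : ∀ {y} → g + κ * (z * z) * 1ℚ ≡ y → g + κ * (z * z) ≡ y
      e ∙ʳ = trans (cong (g +_) (sym (ℚP.*-identityʳ (κ * (z * z))))) e
    corner-inv : inv (g + κ * (z * z)) ≡ ι * η
    corner-inv = trans (cong inv corner) (inv-unique (0<* 0<g 0<f) (trans (((∀ g f ι η → (g * f) * (ι * η) ≡ (g * ι) * (f * η)) ∋ solve-∀ ℚ-ring) g f ι η)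
      (cong₂ _*_ gι fη)))
    schur : Schur (update κ u G) ≐ update (κ * η) (reduce G u) (Schur G)
    schur i j = trans (cong (λ w → (G (suc i) (suc j) + κ * (a * b)) - w * ((x + κ * (a * z)) * (y + κ * (b * z)))) corner-inv)
      (trans (((∀ m κ a b x y z ι η →
         (m + κ * (a * b)) - (ι * η) * ((x + κ * (a * z)) * (y + κ * (b * z))) ≡
         ((m - ι * (x * y)) + κ * η * ((a - z * ι * x) * (b - z * ι * y))) + (κ * a * b + ι * x * y) * (1ℚ - (1ℚ + κ * (z * z * ι)) * η)) ∋ solve-∀ ℚ-ring)
         (G (suc i) (suc j)) κ a b x y z ι η)
      (trans (cong (λ w → rhs + (κ * a * b + ι * x * y) * (1ℚ - w)) fη)
      (((∀ r c → r + c * (1ℚ - 1ℚ) ≡ r) ∋ solve-∀ ℚ-ring) rhs (κ * a * b + ι * x * y))))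
      where
      a b x y rhs : ℚ
      a = u (suc i)
      b = u (suc j)
      x = G (suc i) zero
      y = G (suc j) zero
      rhs = (G (suc i) (suc j) - ι * (x * y)) + κ * η * ((a - z * ι * x) * (b - z * ι * y))
    step : 1ℚ + κ * η * n ≡ η * (1ℚ + κ * (p + n))
    step = trans (cong (_+ κ * η * n) (sym fη)) (((∀ κ η n p → (1ℚ + κ * p) * η + κ * η * n ≡ η * (1ℚ + κ * (p + n))) ∋ solve-∀ ℚ-ring) κ η n p)
    IH = rank-one k (Schur G) (reduce G u) (κ * η) pd (subst (0ℚ <_) (sym step) (0<* (0<inv 0<f) h))

  gram : (Fin N → Fin k → ℚ) → Mat k
  gram {N} w i j = sumℚ N (λ c → w c i * w c j)

  -- One Gram-Schmidt step on the columns of w: `reduce` subtracts from each later column its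
  -- component along the first.
  gram-reduce : ∀ {k N} (w : Fin N → Fin (suc k) → ℚ) → 0ℚ < gram w zero zero → Schur (gram w) ≐ gram (λ c → reduce (gram w) (w c))
  gram-reduce {k} {N} w 0<g i j = sym (begin
    sumℚ N (λ c → (w c (suc i) - w c zero * ι * x) * (w c (suc j) - w c zero * ι * y))
      ≡⟨ S-cong N (λ c → ((∀ a b z ι x y → (a - z * ι * x) * (b - z * ι * y) ≡
           (1ℚ * (a * b) + (- (ι * y)) * (a * z)) + ((- (ι * x)) * (b * z) + (ι * x * (ι * y)) * (z * z))) ∋ solve-∀ ℚ-ring)
           (w c (suc i)) (w c (suc j)) (w c zero) ι x y) ⟩
    sumℚ N (λ c → (1ℚ * (w c (suc i) * w c (suc j)) + (- (ι * y)) * (w c (suc i) * w c zero)) + ((- (ι * x)) * (w c (suc j) * w c zero) + (ι * x * (ι * y)) * (w c zero * w c zero)))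
      ≡⟨ S-+ N _ _ ⟩
    _ ≡⟨ cong₂ _+_ (S-lin N 1ℚ (- (ι * y)) _ _) (S-lin N (- (ι * x)) (ι * x * (ι * y)) _ _) ⟩
    (1ℚ * m + (- (ι * y)) * x) + ((- (ι * x)) * y + (ι * x * (ι * y)) * g)
      ≡⟨ ((∀ m ι x y g → (1ℚ * m + (- (ι * y)) * x) + ((- (ι * x)) * y + (ι * x * (ι * y)) * g) ≡ m - ι * (x * y) - ι * x * y * (1ℚ - g * ι)) ∋ solve-∀ ℚ-ring) m ι x y g ⟩
    m - ι * (x * y) - ι * x * y * (1ℚ - g * ι) ≡⟨ cong (λ t → m - ι * (x * y) - ι * x * y * (1ℚ - t)) (inv-rightᵖ 0<g) ⟩
    m - ι * (x * y) - ι * x * y * (1ℚ - 1ℚ) ≡⟨ ((∀ m c → m - c * (1ℚ - 1ℚ) ≡ m) ∋ solve-∀ ℚ-ring) (m - ι * (x * y)) (ι * x * y) ⟩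
    m - ι * (x * y) ∎)
    where
    open ≡-Reasoning
    g m x y ι : ℚ
    g = gram w zero zero
    m = gram w (suc i) (suc j)
    x = gram w (suc i) zero
    y = gram w (suc j) zero
    ι = inv g

  -- The leverage scores are the diagonal of the projection onto the column space of w, whose trace
  -- is its dimension; each elimination step contributes 1.
  trace : ∀ k (w : Fin N → Fin k → ℚ) → PosDef k (gram w) → sumℚ N (λ c → nrm k (gram w) (w c)) ≡ ℕ→ℚ k
  trace {N} zero w pd = S-0 N (λ _ → refl)
  trace {N} (suc k) w (0<g , pd) = begin
    sumℚ N (λ c → w c zero * w c zero * ι + nrm k (Schur (gram w)) (w' c)) ≡⟨ S-+ N _ _ ⟩
    sumℚ N (λ c → w c zero * w c zero * ι) + sumℚ N (λ c → nrm k (Schur (gram w)) (w' c))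
      ≡⟨ cong₂ _+_ (trans (S-*ʳ N ι _) (inv-rightᵖ 0<g)) (trans (S-cong N (λ c → nrm-cong k e (λ _ → refl))) (trace k w' (PosDef-cong k e pd))) ⟩
    1ℚ + ℕ→ℚ k ≡⟨ ℕ→ℚ-+ 1 k ⟨
    ℕ→ℚ (suc k) ∎
    where
    open ≡-Reasoning
    ι = inv (gram w zero zero)
    w' = λ c → reduce (gram w) (w c)
    e = gram-reduce w 0<g

  Sym : Mat k → Set
  Sym G = ∀ i j → G i j ≡ G j i

  solution : ∀ k (G : Mat k) → Sym G → PosDef k G → ∀ u →
    Σ (Fin k → ℚ) λ y → (∀ i → sumℚ k (λ j → G i j * y j) ≡ u i) × sumℚ k (λ i → y i * u i) ≡ nrm k G u
  solution zero G s pd u = (λ ()) , (λ ()) , refl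
  solution (suc k) G s (0<g , pd) u = result (solution k (Schur G) sym' pd (reduce G u))
    where
    open ≡-Reasoning
    g ι z : ℚ
    g = G zero zero
    ι = inv g
    z = u zero
    sym' : Sym (Schur G)
    sym' i j = cong₂ _-_ (s (suc i) (suc j)) (cong (ι *_) (ℚP.*-comm (G (suc i) zero) (G (suc j) zero)))
    result : (Σ (Fin k → ℚ) λ y → (∀ i → sumℚ k (λ j → Schur G i j * y j) ≡ reduce G u i) × sumℚ k (λ i → y i * reduce G u i) ≡ nrm k (Schur G) (reduce G u)) →
      Σ (Fin (suc k) → ℚ) λ y → (∀ i → sumℚ (suc k) (λ j → G i j * y j) ≡ u i) × sumℚ (suc k) (λ i → y i * u i) ≡ nrm (suc k) G u
    result (y , row , val) = (ι * (z - T) ◂ y) , rows , value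
      where
      T : ℚ
      T = sumℚ k (λ j → G (suc j) zero * y j)
      rows : ∀ i → sumℚ (suc k) (λ j → G i j * (ι * (z - T) ◂ y) j) ≡ u i
      rows zero = begin
        g * (ι * (z - T)) + sumℚ k (λ j → G zero (suc j) * y j) ≡⟨ cong (g * (ι * (z - T)) +_) (S-cong k (λ j → cong (_* y j) (s zero (suc j)))) ⟩
        g * (ι * (z - T)) + T ≡⟨ ((∀ g ι z t → g * (ι * (z - t)) + t ≡ (g * ι) * (z - t) + t) ∋ solve-∀ ℚ-ring) g ι z T ⟩
        (g * ι) * (z - T) + T ≡⟨ cong (λ x → x * (z - T) + T) (inv-rightᵖ 0<g) ⟩
        1ℚ * (z - T) + T ≡⟨ ((∀ z t → 1ℚ * (z - t) + t ≡ z) ∋ solve-∀ ℚ-ring) z T ⟩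
        z ∎
      rows (suc i) = begin
        x * (ι * (z - T)) + R ≡⟨ ((∀ x ι z t r → x * (ι * (z - t)) + r ≡ (1ℚ * r + (- (ι * x)) * t) + z * ι * x) ∋ solve-∀ ℚ-ring) x ι z T R ⟩
        (1ℚ * R + (- (ι * x)) * T) + z * ι * x ≡⟨ cong (_+ z * ι * x) (S-lin k 1ℚ (- (ι * x)) (λ j → G (suc i) (suc j) * y j) (λ j → G (suc j) zero * y j)) ⟨
        sumℚ k (λ j → 1ℚ * (G (suc i) (suc j) * y j) + (- (ι * x)) * (G (suc j) zero * y j)) + z * ι * x
          ≡⟨ cong (_+ z * ι * x) (S-cong k (λ j → ((∀ m v ι x c → 1ℚ * (m * v) + (- (ι * x)) * (c * v) ≡ (m - ι * (x * c)) * v) ∋ solve-∀ ℚ-ring) (G (suc i) (suc j)) (y j) ι x (G (suc j) zero))) ⟩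
        sumℚ k (λ j → Schur G i j * y j) + z * ι * x ≡⟨ cong (_+ z * ι * x) (row i) ⟩
        (u (suc i) - z * ι * x) + z * ι * x ≡⟨ ((∀ a b → (a - b) + b ≡ a) ∋ solve-∀ ℚ-ring) (u (suc i)) (z * ι * x) ⟩
        u (suc i) ∎
        where
        x R : ℚ
        x = G (suc i) zero
        R = sumℚ k (λ j → G (suc i) (suc j) * y j)
      value : (ι * (z - T)) * z + sumℚ k (λ i → y i * u (suc i)) ≡ nrm (suc k) G u
      value = begin
        (ι * (z - T)) * z + R ≡⟨ ((∀ ι z t r → (ι * (z - t)) * z + r ≡ z * z * ι + (1ℚ * r + (- (z * ι)) * t)) ∋ solve-∀ ℚ-ring) ι z T R ⟩
        z * z * ι + (1ℚ * R + (- (z * ι)) * T) ≡⟨ cong (z * z * ι +_) (S-lin k 1ℚ (- (z * ι)) (λ j → y j * u (suc j)) (λ j → G (suc j) zero * y j)) ⟨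
        z * z * ι + sumℚ k (λ j → 1ℚ * (y j * u (suc j)) + (- (z * ι)) * (G (suc j) zero * y j))
          ≡⟨ cong (z * z * ι +_) (S-cong k (λ j → ((∀ v a z ι c → 1ℚ * (v * a) + (- (z * ι)) * (c * v) ≡ v * (a - z * ι * c)) ∋ solve-∀ ℚ-ring) (y j) (u (suc j)) z ι (G (suc j) zero))) ⟩
        z * z * ι + sumℚ k (λ j → y j * reduce G u j) ≡⟨ cong (z * z * ι +_) val ⟩
        nrm (suc k) G u ∎
        where
        R : ℚ
        R = sumℚ k (λ j → y j * u (suc j))

  -- With y = G⁻¹u, the coefficients β c = ⟨y, w c⟩ are the combination of rows of least norm that
  -- gives u, and their squared length is the leverage score uᵀG⁻¹u.
  represent : ∀ {k N} (w : Fin N → Fin k → ℚ) → PosDef k (gram w) → ∀ u →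
    Σ (Fin N → ℚ) λ β → (∀ i → sumℚ N (λ c → β c * w c i) ≡ u i) × sumℚ N (λ c → β c * β c) ≡ nrm k (gram w) u
  represent {k} {N} w pd u = result (solution k (gram w) (λ i j → S-cong N (λ c → ℚP.*-comm (w c i) (w c j))) pd u)
    where
    open ≡-Reasoning
    result : (Σ (Fin k → ℚ) λ y → (∀ i → sumℚ k (λ j → gram w i j * y j) ≡ u i) × sumℚ k (λ i → y i * u i) ≡ nrm k (gram w) u) →
      Σ (Fin N → ℚ) λ β → (∀ i → sumℚ N (λ c → β c * w c i) ≡ u i) × sumℚ N (λ c → β c * β c) ≡ nrm k (gram w) u
    result (y , row , val) = β , rows , (begin
        sumℚ N (λ c → β c * β c) ≡⟨ S-cong N (λ c → trans (sym (S-* k (β c) (λ i → y i * w c i))) (S-cong k (λ i → ((∀ b y w → b * (y * w) ≡ y * (b * w)) ∋ solve-∀ ℚ-ring) (β c) (y i) (w c i)))) ⟩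
        sumℚ N (λ c → sumℚ k (λ i → y i * (β c * w c i))) ≡⟨ S-swap N k (λ c i → y i * (β c * w c i)) ⟩
        sumℚ k (λ i → sumℚ N (λ c → y i * (β c * w c i))) ≡⟨ S-cong k (λ i → trans (S-* N (y i) (λ c → β c * w c i)) (cong (y i *_) (rows i))) ⟩
        sumℚ k (λ i → y i * u i) ≡⟨ val ⟩
        nrm k (gram w) u ∎)
      where
      β : Fin N → ℚ
      β c = sumℚ k (λ i → y i * w c i)
      rows : ∀ i → sumℚ N (λ c → β c * w c i) ≡ u i
      rows i = begin
        sumℚ N (λ c → β c * w c i) ≡⟨ S-cong N (λ c → trans (sym (S-*ʳ k (w c i) (λ j → y j * w c j))) (S-cong k (λ j → ((∀ y a b → y * a * b ≡ b * a * y) ∋ solve-∀ ℚ-ring) (y j) (w c j) (w c i)))) ⟩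
        sumℚ N (λ c → sumℚ k (λ j → w c i * w c j * y j)) ≡⟨ S-swap N k (λ c j → w c i * w c j * y j) ⟩
        sumℚ k (λ j → sumℚ N (λ c → w c i * w c j * y j)) ≡⟨ S-cong k (λ j → S-*ʳ N (y j) (λ c → w c i * w c j)) ⟩
        sumℚ k (λ j → gram w i j * y j) ≡⟨ row i ⟩
        u i ∎

-- Maximal determinants over finite sets of tuples.

module Exchange where
  open Rationals
  open Linear
  open Design
  open import Data.Nat as ℕ using (ℕ; zero; suc)
  open import Data.Rational using (ℚ; 0ℚ; 1ℚ; _+_; _*_; _-_; -_; _≤_; _<_; nonNegative)
  open import Data.Rational.Properties as ℚP using (≤-trans; ≤-refl; <⇒≤; <-≤-trans)
  open import Tactic.RingSolver using (solve-∀)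

  private variable
    A B Z : Set
    k N : ℕ

  tuples : ∀ N → List A → List (Fin N → A)
  tuples zero X = (λ ()) ∷ []
  tuples (suc N) X = cartesianProductWith _◂_ X (tuples N X)

  -- Completeness is up to pointwise equality, for want of function extensionality; hence all the
  -- congruence lemmas for Gram matrices.
  tuples-complete : ∀ N {X : List A} (c : Fin N → A) → (∀ i → c i ∈ X) → ∃ λ c' → c' ∈ tuples N X × c' ≗ c
  tuples-complete zero c m = (λ ()) , here refl , λ ()
  tuples-complete (suc N) {X} c m = result (tuples-complete N (c ∘ suc) (m ∘ suc))
    where
    result : (∃ λ c' → c' ∈ tuples N X × c' ≗ c ∘ suc) → ∃ λ c' → c' ∈ tuples (suc N) X × c' ≗ c
    result (c' , p , e) = c zero ◂ c' , ∈-cartesianProductWith⁺ _◂_ (m zero) p , λ { zero → refl ; (suc i) → e i }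

  tuples-sound : ∀ N {X : List A} {c : Fin N → A} → c ∈ tuples N X → ∀ i → c i ∈ X
  tuples-sound (suc N) {X} m i with ∈-cartesianProductWith⁻ _◂_ X (tuples N X) m
  tuples-sound (suc N) {X} m zero | x , c , p , q , refl = p
  tuples-sound (suc N) {X} m (suc i) | x , c , p , q , refl = tuples-sound N q i

  module _ (P : Z → Set) (P? : ∀ z → Dec (P z)) (φ : Z → ℚ) where
    Maximal : List Z → Z → Set
    Maximal zs z = P z × (∀ {z'} → z' ∈ zs → P z' → φ z' ≤ φ z)

    argmax-or-empty : ∀ zs → (∃ λ z → z ∈ zs × Maximal zs z) ⊎ (∀ {z} → z ∈ zs → ¬ P z)
    argmax-or-empty [] = inj₂ (λ ())
    argmax-or-empty (x ∷ zs) with argmax-or-empty zs | P? x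
    ... | inj₂ e | no ¬p = inj₂ λ { (here refl) → ¬p ; (there m) → e m }
    ... | inj₂ e | yes p = inj₁ (x , here refl , p , λ { (here refl) _ → ≤-refl ; (there m) q → ⊥-elim (e m q) })
    ... | inj₁ (z , m , p , h) | no ¬p = inj₁ (z , there m , p , λ { (here refl) q → ⊥-elim (¬p q) ; (there m) q → h m q })
    ... | inj₁ (z , m , p , h) | yes q with ℚP.≤-total (φ x) (φ z)
    ...   | inj₁ le = inj₁ (z , there m , p , λ { (here refl) _ → le ; (there m) q → h m q })
    ...   | inj₂ ge = inj₁ (x , here refl , q , λ { (here refl) _ → ≤-refl ; (there m) q → ≤-trans (h m q) ge })

    argmax : ∀ zs {z₀} → z₀ ∈ zs → P z₀ → ∃ λ z → z ∈ zs × Maximal zs z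
    argmax zs m p with argmax-or-empty zs
    ... | inj₁ r = r
    ... | inj₂ e = ⊥-elim (e m p)

  δ-sym : ∀ {k} (i j : Fin k) → δ i j ≡ δ j i
  δ-sym zero zero = refl
  δ-sym zero (suc j) = refl
  δ-sym (suc i) zero = refl
  δ-sym (suc i) (suc j) = δ-sym i j

  PosDef-δ : ∀ k → PosDef k δ
  PosDef-δ zero = _
  PosDef-δ (suc k) = 0<1 , PosDef-cong k (λ i j → ((∀ x y → x ≡ x - y * (0ℚ * 0ℚ)) ∋ solve-∀ ℚ-ring) (δ i j) (inv 1ℚ)) (PosDef-δ k)

  gram-cong : {w w' : Fin N → Fin k → ℚ} → (∀ c → w c ≗ w' c) → gram w ≐ gram w'
  gram-cong {N} e i j = S-cong N (λ c → cong₂ _*_ (e c i) (e c j))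

  gram-add : ∀ (w : Fin (suc N) → Fin k → ℚ) → update 1ℚ (w zero) (gram (w ∘ suc)) ≐ gram w
  gram-add w i j = ((∀ x y → x + 1ℚ * y ≡ y + x) ∋ solve-∀ ℚ-ring) (gram (w ∘ suc) i j) (w zero i * w zero j)

  gram-remove : ∀ (w : Fin (suc N) → Fin k → ℚ) c → update (- 1ℚ) (w c) (gram w) ≐ gram (w ∘ punchIn c)
  gram-remove {N} w c i j = trans (cong (_+ - 1ℚ * (w c i * w c j)) (S-punch N (λ c → w c i * w c j) c))
    (((∀ x y → (x + y) + - 1ℚ * x ≡ y) ∋ solve-∀ ℚ-ring) (w c i * w c j) (gram (w ∘ punchIn c) i j))

  private
    0<*-cancelˡ : ∀ {c x} → 0ℚ < c → 0ℚ < c * x → 0ℚ < x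
    0<*-cancelˡ {c} {x} p q = ℚP.*-cancelˡ-<-nonNeg c {{nonNegative (<⇒≤ p)}} (subst (_< c * x) (sym (ℚP.*-zeroʳ c)) q)

    -- Exchanging the added vector, of norm n, for the one of norm ν.
    exchange : ∀ {m K ν n D} → 0ℚ < D → 0ℚ ≤ n → 0ℚ < m → 0ℚ ≤ K → (m + K) * ν ≤ K → (1ℚ + - 1ℚ * ν) * ((1ℚ + 1ℚ * n) * D) ≤ D → m * n ≤ K
    exchange {m} {K} {ν} {n} {D} 0<D 0≤n 0<m 0≤K h₁ h₂ = 0≤⇒≤ _ (0≤+ (0≤* (≤⇒0≤ h₁) (0≤+ 0≤1 0≤n)) (0≤* (<⇒≤ (0<+≤ 0<m 0≤K)) (≤⇒0≤ h₃)))
      (((∀ m K ν n → K ≡ m * n + ((K - (m + K) * ν) * (1ℚ + n) + (m + K) * (1ℚ - (1ℚ + - 1ℚ * ν) * (1ℚ + 1ℚ * n)))) ∋ solve-∀ ℚ-ring) m K ν n)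
      where
      h₃ : (1ℚ + - 1ℚ * ν) * (1ℚ + 1ℚ * n) ≤ 1ℚ
      h₃ = *-cancelˡ 0<D (subst₂ _≤_ (((∀ a b d → a * (b * d) ≡ d * (a * b)) ∋ solve-∀ ℚ-ring) (1ℚ + - 1ℚ * ν) (1ℚ + 1ℚ * n) D) (sym (ℚP.*-identityʳ D)) h₂)

  -- A D-optimal design: among the multisets of M + k rows with positive
  -- definite Gram matrix, one of largest determinant has small leverage scores.
  module _ {X : List A} (u : A → Fin k → ℚ) (e : Fin k → A) (e∈ : ∀ j → e j ∈ X) (dual : ∀ j i → u (e j) i ≡ δ j i)
    {x₀ : A} (x₀∈ : x₀ ∈ X) where

    -- A first candidate for the maximisation: the basis rows have the identity as Gram matrix, and
    -- further copies of `x₀` keep it positive definite.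
    padded : ∀ M → Fin (M ℕ.+ k) → A
    padded zero = e
    padded (suc M) = x₀ ◂ padded M

    padded∈ : ∀ M i → padded M i ∈ X
    padded∈ zero i = e∈ i
    padded∈ (suc M) zero = x₀∈
    padded∈ (suc M) (suc i) = padded∈ M i

    PosDef-padded : ∀ M → PosDef k (gram (u ∘ padded M))
    PosDef-padded zero = PosDef-cong k (λ i j → sym (trans (S-cong k (λ c → trans (cong₂ _*_ (dual c i) (dual c j)) (cong (_* δ c j) (δ-sym c i)))) (S-δ k i (λ c → δ c j)))) (PosDef-δ k)
    PosDef-padded (suc M) = PosDef-cong k (gram-add (u ∘ padded (suc M)))
      (proj₁ (rank-one k (gram (u ∘ padded M)) (u x₀) 1ℚ pd (0<+≤ 0<1 (0≤* 0≤1 (0≤nrm k pd (u x₀))))))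
      where pd = PosDef-padded M

    -- Add a row a of score n and remove the lightest of the M + 1 + k rows present, of score ν. The
    -- determinant is multiplied by (1 - ν)(1 + n), which maximality keeps at most 1, while ν ≤ k/(M
    -- + 1 + k) by `trace`. Together these give n ≤ k/(M + 1).
    optimal-design : ∀ M → Σ (Fin (M ℕ.+ k) → A) λ c → (∀ i → c i ∈ X) × PosDef k (gram (u ∘ c)) ×
      (∀ {a} → a ∈ X → ℕ→ℚ (suc M) * nrm k (gram (u ∘ c)) (u a) ≤ ℕ→ℚ k)
    optimal-design M = result (argmax P P? φ (tuples (M ℕ.+ k) X) (proj₁ (proj₂ start))
        (PosDef-cong k (gram-cong (λ c i → cong (λ a → u a i) (sym (proj₂ (proj₂ start) c)))) (PosDef-padded M)))
      where
      P : (Fin (M ℕ.+ k) → A) → Set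
      P c = PosDef k (gram (u ∘ c))
      P? : ∀ c → Dec (P c)
      P? c = PosDef? k (gram (u ∘ c))
      φ : (Fin (M ℕ.+ k) → A) → ℚ
      φ c = det k (gram (u ∘ c))
      start = tuples-complete (M ℕ.+ k) (padded M) (padded∈ M)
      result : (∃ λ c → c ∈ tuples (M ℕ.+ k) X × Maximal P P? φ (tuples (M ℕ.+ k) X) c) →
        Σ (Fin (M ℕ.+ k) → A) λ c → (∀ i → c i ∈ X) × PosDef k (gram (u ∘ c)) ×
        (∀ {a} → a ∈ X → ℕ→ℚ (suc M) * nrm k (gram (u ∘ c)) (u a) ≤ ℕ→ℚ k)
      result (c , c∈ , pd , max) = c , tuples-sound (M ℕ.+ k) c∈ , pd , bound
        where
        bound : ∀ {a} → a ∈ X → ℕ→ℚ (suc M) * nrm k (gram (u ∘ c)) (u a) ≤ ℕ→ℚ k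
        bound {a} a∈ = exchange (0<det k pd) 0≤n (0<ℕ M) (0≤ℕ k)
          (subst (λ t → t * ν ≤ ℕ→ℚ k) (ℕ→ℚ-+ (suc M) k) light)
          (subst (λ t → (1ℚ + - 1ℚ * ν) * t ≤ D) (proj₂ added) (subst (_≤ D) (proj₂ removed) competitor))
          where
          G : Mat k
          G = gram (u ∘ c)
          D n : ℚ
          D = det k G
          n = nrm k G (u a)
          0≤n : 0ℚ ≤ n
          0≤n = 0≤nrm k pd (u a)
          c⁺ : Fin (suc (M ℕ.+ k)) → A
          c⁺ = a ◂ c
          W : Mat k
          W = update 1ℚ (u a) G
          added : PosDef k W × det k W ≡ (1ℚ + 1ℚ * n) * D
          added = rank-one k G (u a) 1ℚ pd (0<+≤ 0<1 (0≤* 0≤1 0≤n))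
          W≐ : W ≐ gram (u ∘ c⁺)
          W≐ = gram-add (u ∘ c⁺)
          lightest : ∃ λ i → ℕ→ℚ (suc (M ℕ.+ k)) * nrm k (gram (u ∘ c⁺)) (u (c⁺ i)) ≤ sumℚ (suc (M ℕ.+ k)) (λ i → nrm k (gram (u ∘ c⁺)) (u (c⁺ i)))
          lightest = S-average (M ℕ.+ k) (λ i → nrm k (gram (u ∘ c⁺)) (u (c⁺ i)))
          i : Fin (suc (M ℕ.+ k))
          i = proj₁ lightest
          ν : ℚ
          ν = nrm k W (u (c⁺ i))
          light : ℕ→ℚ (suc M ℕ.+ k) * ν ≤ ℕ→ℚ k
          light = subst₂ (λ x y → ℕ→ℚ (suc M ℕ.+ k) * x ≤ y) (nrm-cong k (λ i j → sym (W≐ i j)) (λ _ → refl))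
            (trace k (u ∘ c⁺) (PosDef-cong k W≐ (proj₁ added))) (proj₂ lightest)
          -- As ν ≤ k/(M + 1 + k) < 1, the removal keeps the Gram matrix positive definite, so the
          -- exchanged tuple really competes for the maximum.
          0<1-ν : 0ℚ < 1ℚ + - 1ℚ * ν
          0<1-ν = 0<*-cancelˡ (0<ℕ (M ℕ.+ k)) (<-≤-trans (0<ℕ M) (0≤⇒≤ (ℕ→ℚ k - ℕ→ℚ (suc M ℕ.+ k) * ν) (≤⇒0≤ light)
            (trans (cong (_* (1ℚ + - 1ℚ * ν)) (ℕ→ℚ-+ (suc M) k))
            (trans (((∀ m K ν → (m + K) * (1ℚ + - 1ℚ * ν) ≡ m + (K - (m + K) * ν)) ∋ solve-∀ ℚ-ring) (ℕ→ℚ (suc M)) (ℕ→ℚ k) ν)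
              (cong (λ t → ℕ→ℚ (suc M) + (ℕ→ℚ k - t * ν)) (sym (ℕ→ℚ-+ (suc M) k)))))))
          removed : PosDef k (update (- 1ℚ) (u (c⁺ i)) W) × det k (update (- 1ℚ) (u (c⁺ i)) W) ≡ (1ℚ + - 1ℚ * ν) * det k W
          removed = rank-one k W (u (c⁺ i)) (- 1ℚ) (proj₁ added) 0<1-ν
          c⁻ : Fin (M ℕ.+ k) → A
          c⁻ = c⁺ ∘ punchIn i
          c⁺∈ : ∀ j → c⁺ j ∈ X
          c⁺∈ zero = a∈
          c⁺∈ (suc j) = tuples-sound (M ℕ.+ k) c∈ j
          found : ∃ λ c' → c' ∈ tuples (M ℕ.+ k) X × c' ≗ c⁻
          found = tuples-complete (M ℕ.+ k) c⁻ (c⁺∈ ∘ punchIn i)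
          same : update (- 1ℚ) (u (c⁺ i)) W ≐ gram (u ∘ proj₁ found)
          same p q = trans (cong (_+ - 1ℚ * (u (c⁺ i) p * u (c⁺ i) q)) (W≐ p q)) (trans (gram-remove (u ∘ c⁺) i p q)
            (gram-cong (λ j l → cong (λ b → u b l) (sym (proj₂ (proj₂ found) j))) p q))
          competitor : det k (update (- 1ℚ) (u (c⁺ i)) W) ≤ D
          competitor = subst (_≤ D) (sym (det-cong k same)) (max (proj₁ (proj₂ found)) (PosDef-cong k same (proj₁ removed)))

-- Low-rank bounded matrices as inner products of unit vectors.

module Vectors where
  open Rationals
  open Linear
  open Design
  open Exchange
  open import Data.Nat as ℕ using (ℕ; zero; suc)
  import Data.Nat.Tactic.RingSolver as ℕR
  open import Data.Rational using (ℚ; 0ℚ; 1ℚ; _+_; _*_; _-_; -_; _≤_; _<_)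
  open import Data.Rational.Properties as ℚP using (≤-trans; ≤-reflexive; <⇒≤)
  open import Tactic.RingSolver using (solve-∀)

  private variable
    A B : Set

  2ℚ : ℚ
  2ℚ = 1ℚ + 1ℚ

  0<2 : 0ℚ < 2ℚ
  0<2 = 0<+ 0<1 0<1

  basis-expand : ∀ {k} {X : List A} {Y : List B} {g : A → B → ℚ} ((U , _) : FactorsOn X Y g k) (Bs : Basis k X U) → let open Basis Bs in
    ∀ {a b} → a ∈ X → b ∈ Y → g a b ≡ sumℚ dim (λ j → W a j * g (e j) b)
  basis-expand {k = k} {g = g} (U , V , h) Bs {a} {b} m n = begin
    g a b ≡⟨ h m n ⟩
    sumℚ k (λ i → U a i * V b i) ≡⟨ S-cong k (λ i → trans (cong (_* V b i) (expand m i)) (sym (S-*ʳ dim (V b i) (λ j → W a j * U (e j) i)))) ⟩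
    sumℚ k (λ i → sumℚ dim (λ j → W a j * U (e j) i * V b i)) ≡⟨ S-swap k dim (λ i j → W a j * U (e j) i * V b i) ⟩
    sumℚ dim (λ j → sumℚ k (λ i → W a j * U (e j) i * V b i))
      ≡⟨ S-cong dim (λ j → trans (S-cong k (λ i → ℚP.*-assoc (W a j) (U (e j) i) (V b i))) (trans (S-* k (W a j) (λ i → U (e j) i * V b i)) (cong (W a j *_) (sym (h (e∈ j) n))))) ⟩
    sumℚ dim (λ j → W a j * g (e j) b) ∎
    where
    open Basis Bs
    open ≡-Reasoning

  record UnitVectors (X : List A) (Y : List B) (h : A → B → ℚ) : Set where
    field
      N  : ℕ
      p  : A → Fin N → ℚ
      q  : B → Fin N → ℚ
      p≤ : ∀ {a} → a ∈ X → sumℚ N (λ i → p a i * p a i) ≤ 1ℚ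
      q≤ : ∀ {b} → b ∈ Y → sumℚ N (λ i → q b i * q b i) ≤ 1ℚ
      pq : ∀ {a b} → a ∈ X → b ∈ Y → sumℚ N (λ i → p a i * q b i) ≡ h a b

  private
    -- For a design of 4K² rows the score is at most K/(4K² - K + 1), hence at most 1/(2K).
    leverage : ∀ {M K n} → 1ℚ ≤ K → 0ℚ ≤ n → M + K ≡ ℕ→ℚ 4 * (K * K) → (1ℚ + M) * n ≤ K → (2ℚ * K) * (2ℚ * K) * n ≤ 2ℚ * K
    leverage {M} {K} {n} 1≤K 0≤n e h = 0≤⇒≤ _ (0≤+ (0≤* (<⇒≤ 0<2) (≤⇒0≤ h)) (0≤* 0≤n (0≤+ (0≤* (0≤* (0≤ℕ 4) 0≤K) (≤⇒0≤ 1≤K)) (0≤+ (0≤* (<⇒≤ 0<2) 0≤K) (<⇒≤ 0<2)))))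
      (trans (((∀ M K n → 2ℚ * K ≡ (2ℚ * K) * (2ℚ * K) * n + (2ℚ * (K - (1ℚ + M) * n) + n * ((ℕ→ℚ 4 * K * (K - 1ℚ) + (2ℚ * K + 2ℚ)) + 2ℚ * ((M + K) - ℕ→ℚ 4 * (K * K))))) ∋ solve-∀ ℚ-ring) M K n)
      (cong (λ t → (2ℚ * K) * (2ℚ * K) * n + (2ℚ * (K - (1ℚ + M) * n) + n * t))
        (trans (cong (λ t → (ℕ→ℚ 4 * K * (K - 1ℚ) + (2ℚ * K + 2ℚ)) + 2ℚ * (t - ℕ→ℚ 4 * (K * K))) e)
        (((∀ a b → a + 2ℚ * (b - b) ≡ a) ∋ solve-∀ ℚ-ring) (ℕ→ℚ 4 * K * (K - 1ℚ) + (2ℚ * K + 2ℚ)) (ℕ→ℚ 4 * (K * K))))))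
      where
      0≤K = ≤-trans 0≤1 1≤K

  -- Row a of g is the combination, with coefficients β a, of N = 4K² design rows. Here ‖β a‖² ≤
  -- 1/(2K), and a column of N entries bounded by D has norm at most 2KD. Scaling the two factors by
  -- 2K/σ and 1/(2KD) makes both short, and the product of the scalings is 1/(σD).
  unit-vectors : ∀ k {X : List A} {Y : List B} (g : A → B → ℚ) {σ D : ℚ} → 0ℚ < σ → 0ℚ < D → 2ℚ * ℕ→ℚ k ≤ σ * σ →
    (∀ {a b} → a ∈ X → b ∈ Y → g a b * g a b ≤ D * D) → FactorsOn X Y g k → UnitVectors X Y (λ a b → inv (σ * D) * g a b)
  unit-vectors {A} {B} k {X} {Y} g {σ} {D} 0<σ 0<D 2k≤ g≤ fac@(U , _) = result (basis k X U)
    where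
    result : Basis k X U → UnitVectors X Y (λ a b → inv (σ * D) * g a b)
    result Bs@record { dim = zero } = record { N = 0 ; p = λ _ () ; q = λ _ () ; p≤ = λ _ → 0≤1 ; q≤ = λ _ → 0≤1
      ; pq = λ m n → sym (trans (cong (inv (σ * D) *_) (basis-expand fac Bs m n)) (ℚP.*-zeroʳ (inv (σ * D)))) }
    result Bs@record { dim = suc d } = design (optimal-design W e e∈ dual (e∈ zero) M)
      where
      open Basis Bs using (W; e; e∈; dual; dim≤)
      open ≡-Reasoning
      M N : ℕ
      -- Chosen to make N = 4(d + 1)² a perfect square, so that the norm bound for columns stays
      -- rational.
      M = suc d ℕ.* (3 ℕ.+ 4 ℕ.* d)
      N = M ℕ.+ suc d
      K t w : ℚ
      K = ℕ→ℚ (suc d)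
      t = 2ℚ * K * inv σ
      w = inv (2ℚ * K) * inv D
      M+K : ℕ→ℚ M + K ≡ ℕ→ℚ 4 * (K * K)
      M+K = trans (sym (ℕ→ℚ-+ M (suc d))) (trans (cong ℕ→ℚ (((∀ d → suc d ℕ.* (3 ℕ.+ 4 ℕ.* d) ℕ.+ suc d ≡ 4 ℕ.* (suc d ℕ.* suc d)) ∋ ℕR.solve-∀) d))
        (trans (ℕ→ℚ-* 4 (suc d ℕ.* suc d)) (cong (ℕ→ℚ 4 *_) (ℕ→ℚ-* (suc d) (suc d)))))
      0<2K : 0ℚ < 2ℚ * K
      0<2K = 0<* 0<2 (0<ℕ d)
      design : (Σ (Fin N → A) λ c → (∀ i → c i ∈ X) × PosDef (suc d) (gram (W ∘ c)) ×
        (∀ {a} → a ∈ X → ℕ→ℚ (suc M) * nrm (suc d) (gram (W ∘ c)) (W a) ≤ K)) → UnitVectors X Y (λ a b → inv (σ * D) * g a b)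
      design (c , c∈ , pd , lev) = record
        { N = N ; p = λ a i → β a i * t ; q = λ b i → g (c i) b * w
        ; p≤ = p≤ ; q≤ = q≤ ; pq = pq }
        where
        rep = λ a → represent (W ∘ c) pd (W a)
        β : A → Fin N → ℚ
        β a = proj₁ (rep a)
        p≤ : ∀ {a} → a ∈ X → sumℚ N (λ i → β a i * t * (β a i * t)) ≤ 1ℚ
        p≤ {a} m = subst₂ _≤_ (sym lhs) rhs (*-monoʳ (0≤sq (inv σ)) (≤-trans
            (leverage {ℕ→ℚ M} {K} {n} (ℕ→ℚ-mono {1} {suc d} (ℕ.s≤s ℕ.z≤n)) (0≤nrm (suc d) {gram (W ∘ c)} pd (W a)) M+K (subst (λ t → t * n ≤ K) (ℕ→ℚ-+ 1 M) (lev m)))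
            (≤-trans (*-monoˡ (<⇒≤ 0<2) (ℕ→ℚ-mono dim≤)) 2k≤)))
          where
          n = nrm (suc d) (gram (W ∘ c)) (W a)
          lhs : sumℚ N (λ i → β a i * t * (β a i * t)) ≡ (2ℚ * K) * (2ℚ * K) * n * (inv σ * inv σ)
          lhs = begin
            sumℚ N (λ i → β a i * t * (β a i * t)) ≡⟨ S-cong N (λ i → ((∀ b t → b * t * (b * t) ≡ t * t * (b * b)) ∋ solve-∀ ℚ-ring) (β a i) t) ⟩
            sumℚ N (λ i → t * t * (β a i * β a i)) ≡⟨ S-* N (t * t) (λ i → β a i * β a i) ⟩
            t * t * sumℚ N (λ i → β a i * β a i) ≡⟨ cong (t * t *_) (proj₂ (proj₂ (rep a))) ⟩
            t * t * n ≡⟨ ((∀ k s n → (k * s) * (k * s) * n ≡ k * k * n * (s * s)) ∋ solve-∀ ℚ-ring) (2ℚ * K) (inv σ) n ⟩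
            (2ℚ * K) * (2ℚ * K) * n * (inv σ * inv σ) ∎
          rhs : σ * σ * (inv σ * inv σ) ≡ 1ℚ
          rhs = trans (((∀ s i → s * s * (i * i) ≡ (s * i) * (s * i)) ∋ solve-∀ ℚ-ring) σ (inv σ)) (cong (λ x → x * x) (inv-rightᵖ 0<σ))
        q≤ : ∀ {b} → b ∈ Y → sumℚ N (λ i → g (c i) b * w * (g (c i) b * w)) ≤ 1ℚ
        q≤ {b} n = ≤-trans (≤-reflexive (trans
            (S-cong N (λ i → ((∀ b t → b * t * (b * t) ≡ t * t * (b * b)) ∋ solve-∀ ℚ-ring) (g (c i) b) w))
            (S-* N (w * w) (λ i → g (c i) b * g (c i) b))))
          (≤-trans (*-monoˡ (0≤sq w) (S-mono N (λ i → g≤ (c∈ i) n))) (≤-reflexive (begin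
            w * w * sumℚ N (λ _ → D * D) ≡⟨ cong (w * w *_) (trans (S-const N (D * D)) (cong (_* (D * D)) (trans (ℕ→ℚ-+ M (suc d)) M+K))) ⟩
            w * w * (ℕ→ℚ 4 * (K * K) * (D * D)) ≡⟨ ((∀ i j K D → (i * j) * (i * j) * (ℕ→ℚ 4 * (K * K) * (D * D)) ≡ (2ℚ * K * i) * (2ℚ * K * i) * ((D * j) * (D * j))) ∋ solve-∀ ℚ-ring) (inv (2ℚ * K)) (inv D) K D ⟩
            (2ℚ * K * inv (2ℚ * K)) * (2ℚ * K * inv (2ℚ * K)) * ((D * inv D) * (D * inv D)) ≡⟨ cong₂ (λ x y → x * x * (y * y)) (inv-rightᵖ 0<2K) (inv-rightᵖ 0<D) ⟩
            1ℚ ∎)))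
        pq : ∀ {a b} → a ∈ X → b ∈ Y → sumℚ N (λ i → β a i * t * (g (c i) b * w)) ≡ inv (σ * D) * g a b
        pq {a} {b} m n = begin
          sumℚ N (λ i → β a i * t * (g (c i) b * w)) ≡⟨ S-cong N (λ i → ((∀ b t g w → b * t * (g * w) ≡ t * w * (b * g)) ∋ solve-∀ ℚ-ring) (β a i) t (g (c i) b) w) ⟩
          sumℚ N (λ i → t * w * (β a i * g (c i) b)) ≡⟨ S-* N (t * w) (λ i → β a i * g (c i) b) ⟩
          t * w * sumℚ N (λ i → β a i * g (c i) b) ≡⟨ cong₂ _*_ scale mix ⟩
          inv (σ * D) * g a b ∎
          where
          scale : t * w ≡ inv (σ * D)
          scale = sym (inv-unique (0<* 0<σ 0<D) (trans (((∀ s D k i j l → (s * D) * (k * i * (j * l)) ≡ (s * i) * (D * l) * (k * j)) ∋ solve-∀ ℚ-ring) σ D (2ℚ * K) (inv σ) (inv (2ℚ * K)) (inv D))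
            (trans (cong₂ (λ x y → x * y * (2ℚ * K * inv (2ℚ * K))) (inv-rightᵖ 0<σ) (inv-rightᵖ 0<D)) (cong (1ℚ * 1ℚ *_) (inv-rightᵖ 0<2K)))))
          mix : sumℚ N (λ i → β a i * g (c i) b) ≡ g a b
          mix = begin
            sumℚ N (λ i → β a i * g (c i) b) ≡⟨ S-cong N (λ i → trans (cong (β a i *_) (basis-expand fac Bs (c∈ i) n))
               (trans (sym (S-* (suc d) (β a i) (λ j → W (c i) j * g (e j) b))) (S-cong (suc d) (λ j → sym (ℚP.*-assoc (β a i) (W (c i) j) (g (e j) b)))))) ⟩
            sumℚ N (λ i → sumℚ (suc d) (λ j → β a i * W (c i) j * g (e j) b)) ≡⟨ S-swap N (suc d) (λ i j → β a i * W (c i) j * g (e j) b) ⟩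
            sumℚ (suc d) (λ j → sumℚ N (λ i → β a i * W (c i) j * g (e j) b))
              ≡⟨ S-cong (suc d) (λ j → trans (S-*ʳ N (g (e j) b) (λ i → β a i * W (c i) j)) (cong (_* g (e j) b) (proj₁ (proj₂ (rep a)) j))) ⟩
            sumℚ (suc d) (λ j → W a j * g (e j) b) ≡⟨ basis-expand fac Bs m n ⟨
            g a b ∎

-- Grothendieck's inequality by truncating random sign sums.

module Grothendieck where
  open Rationals
  open import Data.Nat as ℕ using (ℕ; zero; suc)
  import Data.Nat.Properties as ℕP
  open import Data.Rational using (ℚ; 0ℚ; 1ℚ; ½; _+_; _*_; _-_; -_; _≤_)
  open import Data.Rational.Properties as ℚP using (≤-trans; ≤-refl; ≤-reflexive; <⇒≤)
  open import Tactic.RingSolver using (solve-∀)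

  private variable
    I : Set

  -- Expectations over independent random signs. Every sign pattern occurs twice
  -- as often as needed, so that the normalising factor has a rational square root.
  signs : List I → List (List ℚ)
  signs [] = [] ∷ []
  signs (i ∷ is) = (map (1ℚ ∷_) (signs is) ++ map (1ℚ ∷_) (signs is)) ++ (map (- 1ℚ ∷_) (signs is) ++ map (- 1ℚ ∷_) (signs is))

  root : List I → ℚ
  root [] = 1ℚ
  root (i ∷ is) = ½ * root is

  𝔼 : List I → (List ℚ → ℚ) → ℚ
  𝔼 is g = root is * root is * ∑ (signs is) g

  rademacher : List I → (I → ℚ) → List ℚ → ℚ
  rademacher [] u ω = 0ℚ
  rademacher (i ∷ is) u [] = 0ℚ
  rademacher (i ∷ is) u (σ ∷ ω) = σ * u i + rademacher is u ω

  𝔼-cong : ∀ (is : List I) {g h : List ℚ → ℚ} → (∀ ω → g ω ≡ h ω) → 𝔼 is g ≡ 𝔼 is h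
  𝔼-cong is e = cong (root is * root is *_) (∑-cong (signs is) e)

  𝔼-lin : ∀ (is : List I) c d (g h : List ℚ → ℚ) → 𝔼 is (λ ω → c * g ω + d * h ω) ≡ c * 𝔼 is g + d * 𝔼 is h
  𝔼-lin is c d g h = trans (cong (root is * root is *_) (∑-lin (signs is) c d g h))
    (((∀ r c d x y → r * (c * x + d * y) ≡ c * (r * x) + d * (r * y)) ∋ solve-∀ ℚ-ring) (root is * root is) c d (∑ (signs is) g) (∑ (signs is) h))

  𝔼-mono : ∀ (is : List I) {g h : List ℚ → ℚ} → (∀ ω → g ω ≤ h ω) → 𝔼 is g ≤ 𝔼 is h
  𝔼-mono is e = *-monoˡ (0≤sq (root is)) (∑-mono (signs is) e)

  𝔼-∷ : ∀ i (is : List I) g → 𝔼 (i ∷ is) g ≡ 𝔼 is (λ ω → ½ * g (1ℚ ∷ ω) + ½ * g (- 1ℚ ∷ ω))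
  𝔼-∷ i is g = begin
    ½ * r * (½ * r) * ∑ (signs (i ∷ is)) g ≡⟨ cong (½ * r * (½ * r) *_) (trans (∑-++ (P ++ P) (Q ++ Q) g) (cong₂ _+_ (trans (∑-++ P P g) (cong (λ t → t + t) (∑-map (1ℚ ∷_) (signs is) g))) (trans (∑-++ Q Q g) (cong (λ t → t + t) (∑-map (- 1ℚ ∷_) (signs is) g))))) ⟩
    ½ * r * (½ * r) * ((a + a) + (b + b)) ≡⟨ ((∀ r a b → ½ * r * (½ * r) * ((a + a) + (b + b)) ≡ ½ * (r * r * a) + ½ * (r * r * b)) ∋ solve-∀ ℚ-ring) r a b ⟩
    ½ * 𝔼 is (λ ω → g (1ℚ ∷ ω)) + ½ * 𝔼 is (λ ω → g (- 1ℚ ∷ ω)) ≡⟨ 𝔼-lin is ½ ½ (λ ω → g (1ℚ ∷ ω)) (λ ω → g (- 1ℚ ∷ ω)) ⟨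
    𝔼 is (λ ω → ½ * g (1ℚ ∷ ω) + ½ * g (- 1ℚ ∷ ω)) ∎
    where
    open ≡-Reasoning
    r = root is
    P = map (1ℚ ∷_) (signs is)
    Q = map (- 1ℚ ∷_) (signs is)
    a = ∑ (signs is) (λ ω → g (1ℚ ∷ ω))
    b = ∑ (signs is) (λ ω → g (- 1ℚ ∷ ω))

  𝔼-const : ∀ (is : List I) c → 𝔼 is (λ _ → c) ≡ c
  𝔼-const [] c = ((∀ c → 1ℚ * 1ℚ * (c + 0ℚ) ≡ c) ∋ solve-∀ ℚ-ring) c
  𝔼-const (i ∷ is) c = trans (𝔼-∷ i is (λ _ → c)) (trans (𝔼-cong is (λ _ → ((∀ c → ½ * c + ½ * c ≡ c) ∋ solve-∀ ℚ-ring) c)) (𝔼-const is c))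

  second-moment : ∀ (is : List I) (u v : I → ℚ) → 𝔼 is (λ ω → rademacher is u ω * rademacher is v ω) ≡ ∑ is (λ i → u i * v i)
  second-moment [] u v = refl
  second-moment (i ∷ is) u v = begin
    𝔼 (i ∷ is) (λ ω → rademacher (i ∷ is) u ω * rademacher (i ∷ is) v ω) ≡⟨ 𝔼-∷ i is (λ ω → rademacher (i ∷ is) u ω * rademacher (i ∷ is) v ω) ⟩
    _ ≡⟨ 𝔼-cong is (λ ω → ((∀ a b x y → ½ * ((1ℚ * a + x) * (1ℚ * b + y)) + ½ * ((- 1ℚ * a + x) * (- 1ℚ * b + y)) ≡ 1ℚ * (a * b) + 1ℚ * (x * y)) ∋ solve-∀ ℚ-ring) (u i) (v i) (rademacher is u ω) (rademacher is v ω)) ⟩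
    𝔼 is (λ ω → 1ℚ * (u i * v i) + 1ℚ * (rademacher is u ω * rademacher is v ω)) ≡⟨ 𝔼-lin is 1ℚ 1ℚ (λ _ → u i * v i) (λ ω → rademacher is u ω * rademacher is v ω) ⟩
    1ℚ * 𝔼 is (λ _ → u i * v i) + 1ℚ * 𝔼 is (λ ω → rademacher is u ω * rademacher is v ω) ≡⟨ cong₂ _+_ (trans (ℚP.*-identityˡ _) (𝔼-const is (u i * v i))) (trans (ℚP.*-identityˡ _) (second-moment is u v)) ⟩
    u i * v i + ∑ is (λ i → u i * v i) ∎
    where open ≡-Reasoning

  3ℚ : ℚ
  3ℚ = ℕ→ℚ 3

  -- Khintchine's inequality for exponent 4. Odd powers of the new sign average out, and completing
  -- the square on the right leaves 2(u i)⁴ to spare.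
  fourth-moment : ∀ (is : List I) (u : I → ℚ) → 𝔼 is (λ ω → rademacher is u ω * rademacher is u ω * (rademacher is u ω * rademacher is u ω)) ≤ 3ℚ * (∑ is (λ i → u i * u i) * ∑ is (λ i → u i * u i))
  fourth-moment [] u = ≤-refl
  fourth-moment (i ∷ is) u = ≤-trans (≤-reflexive step) (0≤⇒≤ _ (0≤+ (≤⇒0≤ (fourth-moment is u)) (0≤* (0≤ℕ 2) (0≤sq (u i * u i))))
    (((∀ a n q → 3ℚ * ((a * a + n) * (a * a + n)) ≡ (1ℚ * (a * a * (a * a)) + 1ℚ * (ℕ→ℚ 6 * (a * a) * n + 1ℚ * q)) + ((3ℚ * (n * n) - q) + ℕ→ℚ 2 * (a * a * (a * a)))) ∋ solve-∀ ℚ-ring) (u i) n Q))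
    where
    open ≡-Reasoning
    R : List ℚ → ℚ
    R = rademacher is u
    n Q : ℚ
    n = ∑ is (λ i → u i * u i)
    Q = 𝔼 is (λ ω → R ω * R ω * (R ω * R ω))
    a = u i
    step : 𝔼 (i ∷ is) (λ ω → rademacher (i ∷ is) u ω * rademacher (i ∷ is) u ω * (rademacher (i ∷ is) u ω * rademacher (i ∷ is) u ω)) ≡ 1ℚ * (a * a * (a * a)) + 1ℚ * (ℕ→ℚ 6 * (a * a) * n + 1ℚ * Q)
    step = begin
      _ ≡⟨ 𝔼-∷ i is (λ ω → rademacher (i ∷ is) u ω * rademacher (i ∷ is) u ω * (rademacher (i ∷ is) u ω * rademacher (i ∷ is) u ω)) ⟩
      _ ≡⟨ 𝔼-cong is (λ ω → ((∀ a x → ½ * ((1ℚ * a + x) * (1ℚ * a + x) * ((1ℚ * a + x) * (1ℚ * a + x))) + ½ * ((- 1ℚ * a + x) * (- 1ℚ * a + x) * ((- 1ℚ * a + x) * (- 1ℚ * a + x))) ≡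
             1ℚ * (a * a * (a * a)) + 1ℚ * (ℕ→ℚ 6 * (a * a) * (x * x) + 1ℚ * (x * x * (x * x)))) ∋ solve-∀ ℚ-ring) a (R ω)) ⟩
      𝔼 is (λ ω → 1ℚ * (a * a * (a * a)) + 1ℚ * (ℕ→ℚ 6 * (a * a) * (R ω * R ω) + 1ℚ * (R ω * R ω * (R ω * R ω))))
        ≡⟨ 𝔼-lin is 1ℚ 1ℚ (λ _ → a * a * (a * a)) (λ ω → ℕ→ℚ 6 * (a * a) * (R ω * R ω) + 1ℚ * (R ω * R ω * (R ω * R ω))) ⟩
      1ℚ * 𝔼 is (λ _ → a * a * (a * a)) + 1ℚ * 𝔼 is (λ ω → ℕ→ℚ 6 * (a * a) * (R ω * R ω) + 1ℚ * (R ω * R ω * (R ω * R ω)))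
        ≡⟨ cong₂ (λ x y → 1ℚ * x + 1ℚ * y) (𝔼-const is (a * a * (a * a)))
             (trans (𝔼-lin is (ℕ→ℚ 6 * (a * a)) 1ℚ (λ ω → R ω * R ω) (λ ω → R ω * R ω * (R ω * R ω))) (cong (λ t → ℕ→ℚ 6 * (a * a) * t + 1ℚ * Q) (second-moment is u u))) ⟩
      1ℚ * (a * a * (a * a)) + 1ℚ * (ℕ→ℚ 6 * (a * a) * n + 1ℚ * Q) ∎

  -- The truncation level. With the weights ½ and 8 used below, the squared norm of a remainder
  -- vector is at most ¼ + 64 · 3/L², which is 1 for L = 16.
  L : ℚ
  L = ℕ→ℚ 16

  0≤L : 0ℚ ≤ L
  0≤L = 0≤ℕ 16

  -- The field `hi²` says that the part cut off is at most x²/L in absolute value, so its second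
  -- moment is controlled by the fourth moment of x.
  record Clamped (x : ℚ) : Set where
    field
      lo   : ℚ
      -L≤  : - L ≤ lo
      ≤L   : lo ≤ L
      lo²  : lo * lo ≤ x * x
      hi²  : (x - lo) * (x - lo) * (L * L) ≤ x * x * (x * x)

  clamp : ∀ x → Clamped x
  clamp x with L ℚP.≤? x | x ℚP.≤? - L
  ... | yes p | _ = record { lo = L ; -L≤ = ≤-trans (ℚP.neg-antimono-≤ 0≤L) 0≤L ; ≤L = ≤-refl ; lo² = sq-mono 0≤L p
        ; hi² = ≤-trans (*-monoʳ (0≤sq L) (sq-mono (≤⇒0≤ p) (0≤⇒≤ L 0≤L (((∀ x l → x ≡ x - l + l) ∋ solve-∀ ℚ-ring) x L)))) (*-monoˡ (0≤sq x) (sq-mono 0≤L p)) }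
  ... | no _ | yes p = record { lo = - L ; -L≤ = ≤-refl ; ≤L = ≤-trans (ℚP.neg-antimono-≤ 0≤L) 0≤L
        ; lo² = subst₂ _≤_ (sq- L) (sq- x) (sq-mono 0≤L p')
        ; hi² = ≤-trans (*-monoʳ (0≤sq L) (subst₂ _≤_ (((∀ x l → (- x - l) * (- x - l) ≡ (x - - l) * (x - - l)) ∋ solve-∀ ℚ-ring) x L) (sq- x) (sq-mono (≤⇒0≤ p') (0≤⇒≤ L 0≤L (((∀ x l → x ≡ x - l + l) ∋ solve-∀ ℚ-ring) (- x) L)))))
                 (*-monoˡ (0≤sq x) (subst (L * L ≤_) (sq- x) (sq-mono 0≤L p'))) }
    where
    p' : L ≤ - x
    p' = ℚP.neg-antimono-≤ p
    sq- : ∀ x → (- x) * (- x) ≡ x * x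
    sq- = solve-∀ ℚ-ring
  ... | no p | no q = record { lo = x ; -L≤ = <⇒≤ (ℚP.≰⇒> q) ; ≤L = <⇒≤ (ℚP.≰⇒> p) ; lo² = ≤-refl
        ; hi² = subst (_≤ x * x * (x * x)) (((∀ x → 0ℚ ≡ (x - x) * (x - x) * (L * L)) ∋ solve-∀ ℚ-ring) x) (0≤sq (x * x)) }

  lo : ℚ → ℚ
  lo x = Clamped.lo (clamp x)

  module _ {m n : ℕ} where
    pair : (Fin m → Fin n → ℚ) → (Fin m → Fin n → ℚ) → ℚ
    pair s h = sumℚ m (λ a → sumℚ n (λ b → s a b * h a b))

    pair-cong : ∀ s {g h} → (∀ a b → g a b ≡ h a b) → pair s g ≡ pair s h
    pair-cong s e = S-cong m (λ a → S-cong n (λ b → cong (s a b *_) (e a b)))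

    pair-lin : ∀ s c d g h → pair s (λ a b → c * g a b + d * h a b) ≡ c * pair s g + d * pair s h
    pair-lin s c d g h = trans (S-cong m (λ a → trans
        (S-cong n (λ b → ((∀ s c d x y → s * (c * x + d * y) ≡ c * (s * x) + d * (s * y)) ∋ solve-∀ ℚ-ring) (s a b) c d (g a b) (h a b)))
        (S-lin n c d (λ b → s a b * g a b) (λ b → s a b * h a b))))
      (S-lin m c d (λ a → sumℚ n (λ b → s a b * g a b)) (λ a → sumℚ n (λ b → s a b * h a b)))

    pair-* : ∀ s c h → pair s (λ a b → c * h a b) ≡ c * pair s h
    pair-* s c h = trans (pair-cong s (λ a b → ((∀ c x → c * x ≡ c * x + 0ℚ * x) ∋ solve-∀ ℚ-ring) c (h a b)))
      (trans (pair-lin s c 0ℚ h h) (((∀ c x → c * x + 0ℚ * x ≡ c * x) ∋ solve-∀ ℚ-ring) c (pair s h)))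

    pair-∑ : ∀ s (ωs : List I) (h : Fin m → Fin n → I → ℚ) → pair s (λ a b → ∑ ωs (h a b)) ≡ ∑ ωs (λ ω → pair s (λ a b → h a b ω))
    pair-∑ s ωs h = trans (S-cong m (λ a → trans (S-cong n (λ b → sym (∑-* ωs (s a b) (h a b))))
        (S-swap n (length ωs) (λ b i → s a b * h a b (lookup ωs i)))))
      (S-swap m (length ωs) (λ a i → sumℚ n (λ b → s a b * h a b (lookup ωs i))))

    pair-𝔼 : ∀ s (is : List I) (h : Fin m → Fin n → List ℚ → ℚ) → pair s (λ a b → 𝔼 is (h a b)) ≡ 𝔼 is (λ ω → pair s (λ a b → h a b ω))
    pair-𝔼 s is h = trans (pair-* s (root is * root is) (λ a b → ∑ (signs is) (h a b))) (cong (root is * root is *_) (pair-∑ s (signs is) h))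

  Unit : ∀ {m} → List I → (Fin m → I → ℚ) → Set
  Unit is u = ∀ a → ∑ is (λ i → u a i * u a i) ≤ 1ℚ

  ¼ : ℚ
  ¼ = ½ * ½

  module Split {I : Set} {m n : ℕ} (is : List I) (u : Fin m → I → ℚ) (v : Fin n → I → ℚ) where
    Index : Set
    Index = Bool × List ℚ

    js : List Index
    js = map (true ,_) (signs is) ++ map (false ,_) (signs is)

    Rᵤ : Fin m → List ℚ → ℚ
    Rᵤ a ω = rademacher is (u a) ω

    Rᵥ : Fin n → List ℚ → ℚ
    Rᵥ b ω = rademacher is (v b) ω

    8ℚ : ℚ
    8ℚ = ℕ→ℚ 8

    u' : Fin m → Index → ℚ
    u' a (true , ω) = root is * (½ * lo (Rᵤ a ω))
    u' a (false , ω) = root is * (8ℚ * (Rᵤ a ω - lo (Rᵤ a ω)))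

    v' : Fin n → Index → ℚ
    v' b (true , ω) = root is * (8ℚ * (Rᵥ b ω - lo (Rᵥ b ω)))
    v' b (false , ω) = root is * (½ * Rᵥ b ω)

    ∑js : ∀ (g h : Index → ℚ) (x y : List ℚ → ℚ) → (∀ ω → g (true , ω) * h (true , ω) ≡ root is * root is * x ω) → (∀ ω → g (false , ω) * h (false , ω) ≡ root is * root is * y ω) →
      ∑ js (λ j → g j * h j) ≡ 𝔼 is x + 𝔼 is y
    ∑js g h x y e f = trans (∑-++ (map (true ,_) (signs is)) (map (false ,_) (signs is)) (λ j → g j * h j))
      (cong₂ _+_ (trans (∑-map (true ,_) (signs is) (λ j → g j * h j)) (trans (∑-cong (signs is) e) (∑-* (signs is) (root is * root is) x)))
                 (trans (∑-map (false ,_) (signs is) (λ j → g j * h j)) (trans (∑-cong (signs is) f) (∑-* (signs is) (root is * root is) y))))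

    -- Pointwise pq = lo p · lo q + lo p · (q - lo q) + (p - lo p) · q. The last two terms are again
    -- an inner product, over a bit and a sign pattern; the weights ½ · 8 = 4 account for the factor
    -- ¼.
    inner : ∀ a b → ∑ is (λ i → u a i * v b i) ≡ 1ℚ * 𝔼 is (λ ω → lo (Rᵤ a ω) * lo (Rᵥ b ω)) + ¼ * ∑ js (λ j → u' a j * v' b j)
    inner a b = sym (begin
      1ℚ * 𝔼 is f + ¼ * ∑ js (λ j → u' a j * v' b j)
        ≡⟨ cong (λ t → 1ℚ * 𝔼 is f + ¼ * t) (∑js (u' a) (v' b) x y
             (λ ω → ((∀ r p q → r * (½ * p) * (r * (8ℚ * q)) ≡ r * r * (ℕ→ℚ 4 * (p * q))) ∋ solve-∀ ℚ-ring) (root is) (lo (Rᵤ a ω)) (Rᵥ b ω - lo (Rᵥ b ω)))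
             (λ ω → ((∀ r p q → r * (8ℚ * p) * (r * (½ * q)) ≡ r * r * (ℕ→ℚ 4 * (p * q))) ∋ solve-∀ ℚ-ring) (root is) (Rᵤ a ω - lo (Rᵤ a ω)) (Rᵥ b ω))) ⟩
      1ℚ * 𝔼 is f + ¼ * (𝔼 is x + 𝔼 is y) ≡⟨ cong (λ t → 1ℚ * 𝔼 is f + t) (((∀ c x y → c * (x + y) ≡ c * x + c * y) ∋ solve-∀ ℚ-ring) ¼ (𝔼 is x) (𝔼 is y)) ⟩
      1ℚ * 𝔼 is f + (¼ * 𝔼 is x + ¼ * 𝔼 is y) ≡⟨ cong (1ℚ * 𝔼 is f +_) (trans (sym (𝔼-lin is ¼ ¼ x y)) (sym (ℚP.*-identityˡ (𝔼 is (λ ω → ¼ * x ω + ¼ * y ω))))) ⟩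
      1ℚ * 𝔼 is f + 1ℚ * 𝔼 is (λ ω → ¼ * x ω + ¼ * y ω) ≡⟨ 𝔼-lin is 1ℚ 1ℚ f (λ ω → ¼ * x ω + ¼ * y ω) ⟨
      𝔼 is (λ ω → 1ℚ * f ω + 1ℚ * (¼ * x ω + ¼ * y ω))
        ≡⟨ 𝔼-cong is (λ ω → ((∀ p l q k → 1ℚ * (l * k) + 1ℚ * (¼ * (ℕ→ℚ 4 * (l * (q - k))) + ¼ * (ℕ→ℚ 4 * ((p - l) * q))) ≡ p * q) ∋ solve-∀ ℚ-ring) (Rᵤ a ω) (lo (Rᵤ a ω)) (Rᵥ b ω) (lo (Rᵥ b ω))) ⟩
      𝔼 is (λ ω → Rᵤ a ω * Rᵥ b ω) ≡⟨ second-moment is (u a) (v b) ⟩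
      ∑ is (λ i → u a i * v b i) ∎)
      where
      open ≡-Reasoning
      f x y : List ℚ → ℚ
      f ω = lo (Rᵤ a ω) * lo (Rᵥ b ω)
      x ω = ℕ→ℚ 4 * (lo (Rᵤ a ω) * (Rᵥ b ω - lo (Rᵥ b ω)))
      y ω = ℕ→ℚ 4 * ((Rᵤ a ω - lo (Rᵤ a ω)) * Rᵥ b ω)

    tail : ∀ (w : I → ℚ) → ∑ is (λ i → w i * w i) ≤ 1ℚ → 𝔼 is (λ ω → ℕ→ℚ 64 * ((rademacher is w ω - lo (rademacher is w ω)) * (rademacher is w ω - lo (rademacher is w ω)))) ≤ 3ℚ * ¼
    tail w h = ≤-trans (𝔼-mono is {h = λ ω → ¼ * q ω + 0ℚ * q ω} (λ ω → ≤-trans (≤-reflexive (((∀ x → ℕ→ℚ 64 * x ≡ ¼ * (x * (L * L))) ∋ solve-∀ ℚ-ring) ((R ω - lo (R ω)) * (R ω - lo (R ω)))))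
        (≤-trans (*-monoˡ (0≤* 0≤½ 0≤½) (Clamped.hi² (clamp (R ω)))) (≤-reflexive (((∀ c x → c * x ≡ c * x + 0ℚ * x) ∋ solve-∀ ℚ-ring) ¼ (q ω))))))
      (≤-trans (≤-reflexive (trans (𝔼-lin is ¼ 0ℚ q q) (((∀ c x → c * x + 0ℚ * x ≡ c * x) ∋ solve-∀ ℚ-ring) ¼ (𝔼 is q))))
      (≤-trans (*-monoˡ (0≤* 0≤½ 0≤½) (≤-trans (fourth-moment is w) (*-monoˡ (0≤ℕ 3) (≤-trans (sq-mono (0≤∑ is (λ i → 0≤sq (w i))) h) (≤-reflexive (ℚP.*-identityˡ 1ℚ)))))) (≤-reflexive refl)))
      where
      R : List ℚ → ℚ
      R = rademacher is w
      q : List ℚ → ℚ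
      q ω = R ω * R ω * (R ω * R ω)
      0≤½ : 0ℚ ≤ ½
      0≤½ = <⇒≤ (ℚP.positive⁻¹ ½)

    head : ∀ (w : I → ℚ) (g : List ℚ → ℚ) → ∑ is (λ i → w i * w i) ≤ 1ℚ → (∀ ω → g ω ≤ rademacher is w ω * rademacher is w ω) → 𝔼 is (λ ω → ¼ * g ω) ≤ ¼
    head w g h le = ≤-trans (≤-reflexive (trans (𝔼-cong is (λ ω → ((∀ c x → c * x ≡ c * x + 0ℚ * x) ∋ solve-∀ ℚ-ring) ¼ (g ω))) (trans (𝔼-lin is ¼ 0ℚ g g) (((∀ c x → c * x + 0ℚ * x ≡ c * x) ∋ solve-∀ ℚ-ring) ¼ (𝔼 is g)))))
      (*-monoˡ (<⇒≤ (ℚP.positive⁻¹ ¼)) (≤-trans (𝔼-mono is le) (≤-trans (≤-reflexive (second-moment is w w)) h)))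

    unit-u' : Unit is u → Unit js u'
    unit-u' h a = ≤-trans (≤-reflexive (∑js (u' a) (u' a) (λ ω → ¼ * (lo (Rᵤ a ω) * lo (Rᵤ a ω))) (λ ω → ℕ→ℚ 64 * ((Rᵤ a ω - lo (Rᵤ a ω)) * (Rᵤ a ω - lo (Rᵤ a ω))))
        (λ ω → ((∀ r p → r * (½ * p) * (r * (½ * p)) ≡ r * r * (¼ * (p * p))) ∋ solve-∀ ℚ-ring) (root is) (lo (Rᵤ a ω)))
        (λ ω → ((∀ r p → r * (8ℚ * p) * (r * (8ℚ * p)) ≡ r * r * (ℕ→ℚ 64 * (p * p))) ∋ solve-∀ ℚ-ring) (root is) (Rᵤ a ω - lo (Rᵤ a ω)))))
      (ℚP.+-mono-≤ (head (u a) (λ ω → lo (Rᵤ a ω) * lo (Rᵤ a ω)) (h a) (λ ω → Clamped.lo² (clamp (Rᵤ a ω)))) (tail (u a) (h a)))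

    unit-v' : Unit is v → Unit js v'
    unit-v' h b = ≤-trans (≤-reflexive (∑js (v' b) (v' b) (λ ω → ℕ→ℚ 64 * ((Rᵥ b ω - lo (Rᵥ b ω)) * (Rᵥ b ω - lo (Rᵥ b ω)))) (λ ω → ¼ * (Rᵥ b ω * Rᵥ b ω))
        (λ ω → ((∀ r p → r * (8ℚ * p) * (r * (8ℚ * p)) ≡ r * r * (ℕ→ℚ 64 * (p * p))) ∋ solve-∀ ℚ-ring) (root is) (Rᵥ b ω - lo (Rᵥ b ω)))
        (λ ω → ((∀ r p → r * (½ * p) * (r * (½ * p)) ≡ r * r * (¼ * (p * p))) ∋ solve-∀ ℚ-ring) (root is) (Rᵥ b ω))))
      (ℚP.+-mono-≤ (tail (v b) (h b)) (head (v b) (λ ω → Rᵥ b ω * Rᵥ b ω) (h b) (λ ω → ≤-refl)))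

  -- One truncation turns a bound K into L² + ¼K, because bounded factors cost L² and the remainder
  -- consists of unit vectors once more. The bottom value w is a crude bound.
  constant : ℕ → ℚ → ℚ
  constant zero w = w
  constant (suc j) w = L * L + ¼ * constant j w

  module _ {m n : ℕ} (s : Fin m → Fin n → ℚ) (β : ℚ) where
    BoundedOnCube : Set
    BoundedOnCube = ∀ (x : Fin m → ℚ) (y : Fin n → ℚ) → (∀ a → - 1ℚ ≤ x a) → (∀ a → x a ≤ 1ℚ) → (∀ b → - 1ℚ ≤ y b) → (∀ b → y b ≤ 1ℚ) → pair s (λ a b → x a * y b) ≤ β

    module _ (bound : BoundedOnCube) where
      clamped-bound : ∀ (x : Fin m → ℚ) (y : Fin n → ℚ) → pair s (λ a b → lo (x a) * lo (y b)) ≤ L * L * β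
      clamped-bound x y = ≤-trans (≤-reflexive (trans
          (pair-cong s (λ a b → ((∀ p q → p * q ≡ L * L * ((inv L * p) * (inv L * q))) ∋ solve-∀ ℚ-ring) (lo (x a)) (lo (y b))))
          (pair-* s (L * L) (λ a b → (inv L * lo (x a)) * (inv L * lo (y b))))))
        (*-monoˡ (0≤sq L) (bound (λ a → inv L * lo (x a)) (λ b → inv L * lo (y b))
          (λ a → *-monoˡ 0≤1/L (Clamped.-L≤ (clamp (x a)))) (λ a → *-monoˡ 0≤1/L (Clamped.≤L (clamp (x a))))
          (λ b → *-monoˡ 0≤1/L (Clamped.-L≤ (clamp (y b)))) (λ b → *-monoˡ 0≤1/L (Clamped.≤L (clamp (y b))))))
        where
        0≤1/L : 0ℚ ≤ inv L
        0≤1/L = <⇒≤ (0<inv (0<ℕ 15))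

      corner : ∀ x (i : Fin m) (j : Fin n) → (- 1ℚ ≤ x) → (x ≤ 1ℚ) → s i j * x ≤ β
      corner x i j -1≤x x≤1 = subst (_≤ β) single (bound (λ a → δ i a * x) (λ b → δ j b)
          (λ a → ≤-δ a i) (λ a → δ-≤ a i) (λ b → ≤-trans -1≤0 (0≤δ j b)) (λ b → δ≤1 j b))
        where
        -1≤0 : - 1ℚ ≤ 0ℚ
        -1≤0 = ℚP.neg-antimono-≤ 0≤1
        0≤δ : ∀ {k} (i j : Fin k) → 0ℚ ≤ δ i j
        0≤δ zero zero = 0≤1
        0≤δ zero (suc j) = ≤-refl
        0≤δ (suc i) zero = ≤-refl
        0≤δ (suc i) (suc j) = 0≤δ i j
        δ≤1 : ∀ {k} (i j : Fin k) → δ i j ≤ 1ℚ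
        δ≤1 zero zero = ≤-refl
        δ≤1 zero (suc j) = 0≤1
        δ≤1 (suc i) zero = 0≤1
        δ≤1 (suc i) (suc j) = δ≤1 i j
        ≤-δ : ∀ {k} (a i : Fin k) → - 1ℚ ≤ δ i a * x
        ≤-δ zero zero = ≤-trans -1≤x (≤-reflexive (sym (ℚP.*-identityˡ x)))
        ≤-δ zero (suc i) = ≤-trans -1≤0 (≤-reflexive (sym (ℚP.*-zeroˡ x)))
        ≤-δ (suc a) zero = ≤-trans -1≤0 (≤-reflexive (sym (ℚP.*-zeroˡ x)))
        ≤-δ (suc a) (suc i) = ≤-δ a i
        δ-≤ : ∀ {k} (a i : Fin k) → δ i a * x ≤ 1ℚ
        δ-≤ zero zero = ≤-trans (≤-reflexive (ℚP.*-identityˡ x)) x≤1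
        δ-≤ zero (suc i) = ≤-trans (≤-reflexive (ℚP.*-zeroˡ x)) 0≤1
        δ-≤ (suc a) zero = ≤-trans (≤-reflexive (ℚP.*-zeroˡ x)) 0≤1
        δ-≤ (suc a) (suc i) = δ-≤ a i
        single : pair s (λ a b → δ i a * x * δ j b) ≡ s i j * x
        single = trans (S-cong m (λ a → trans (S-cong n (λ b → ((∀ s d x e → s * (d * x * e) ≡ e * (d * (s * x))) ∋ solve-∀ ℚ-ring) (s a b) (δ i a) x (δ j b))) (S-δ n j (λ b → δ i a * (s a b * x)))))
          (S-δ m i (λ a → s a j * x))

      iterate : ∀ j {I : Set} (is : List I) (u : Fin m → I → ℚ) (v : Fin n → I → ℚ) → Unit is u → Unit is v →
        pair s (λ a b → ∑ is (λ i → u a i * v b i)) ≤ constant j (ℕ→ℚ (m ℕ.* n)) * β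
      iterate zero is u v hu hv = ≤-trans (S-mono m (λ a → S-mono n (λ b → corner (inn a b) a b (proj₁ (bd a b)) (proj₂ (bd a b)))))
        (≤-reflexive (trans (S-cong m (λ _ → S-const n β)) (trans (S-const m (ℕ→ℚ n * β)) (trans (sym (ℚP.*-assoc (ℕ→ℚ m) (ℕ→ℚ n) β)) (cong (_* β) (sym (ℕ→ℚ-* m n)))))))
        where
        inn : Fin m → Fin n → ℚ
        inn a b = ∑ is (λ i → u a i * v b i)
        U : Fin m → ℚ
        U a = ∑ is (λ i → u a i * u a i)
        V : Fin n → ℚ
        V b = ∑ is (λ i → v b i * v b i)
        expand : ∀ a b c → ∑ is (λ i → (u a i + c * v b i) * (u a i + c * v b i)) ≡ (U a + (c * c) * V b) + (c + c) * inn a b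
        expand a b c = trans (∑-cong is (λ i → ((∀ x y c → (x + c * y) * (x + c * y) ≡ 1ℚ * (1ℚ * (x * x) + (c * c) * (y * y)) + (c + c) * (x * y)) ∋ solve-∀ ℚ-ring) (u a i) (v b i) c))
          (trans (∑-lin is 1ℚ (c + c) (λ i → 1ℚ * (u a i * u a i) + (c * c) * (v b i * v b i)) (λ i → u a i * v b i))
          (trans (cong (λ t → 1ℚ * t + (c + c) * inn a b) (∑-lin is 1ℚ (c * c) (λ i → u a i * u a i) (λ i → v b i * v b i)))
          (((∀ U V c t → 1ℚ * (1ℚ * U + (c * c) * V) + (c + c) * t ≡ (U + (c * c) * V) + (c + c) * t) ∋ solve-∀ ℚ-ring) (U a) (V b) c (inn a b))))
        -- Cauchy-Schwarz without roots, from ‖u ± v‖² ≥ 0.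
        bd : ∀ a b → (- 1ℚ ≤ inn a b) × (inn a b ≤ 1ℚ)
        bd a b = 0≤⇒≤ _ (0≤* 0≤½ (0≤+ (0≤+ (≤⇒0≤ (hu a)) (≤⇒0≤ (hv b))) (0≤∑ is (λ i → 0≤sq (u a i + 1ℚ * v b i)))))
                    (trans (((∀ U V t → t ≡ - 1ℚ + ½ * (((1ℚ - U) + (1ℚ - V)) + ((U + (1ℚ * 1ℚ) * V) + (1ℚ + 1ℚ) * t))) ∋ solve-∀ ℚ-ring) (U a) (V b) (inn a b))
                      (cong (λ t → - 1ℚ + ½ * (((1ℚ - U a) + (1ℚ - V b)) + t)) (sym (expand a b 1ℚ))))
               , 0≤⇒≤ _ (0≤* 0≤½ (0≤+ (0≤+ (≤⇒0≤ (hu a)) (≤⇒0≤ (hv b))) (0≤∑ is (λ i → 0≤sq (u a i + - 1ℚ * v b i)))))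
                    (trans (((∀ U V t → 1ℚ ≡ t + ½ * (((1ℚ - U) + (1ℚ - V)) + ((U + (- 1ℚ * - 1ℚ) * V) + (- 1ℚ + - 1ℚ) * t))) ∋ solve-∀ ℚ-ring) (U a) (V b) (inn a b))
                      (cong (λ t → inn a b + ½ * (((1ℚ - U a) + (1ℚ - V b)) + t)) (sym (expand a b (- 1ℚ)))))
          where
          0≤½ : 0ℚ ≤ ½
          0≤½ = <⇒≤ (ℚP.positive⁻¹ ½)
      iterate (suc j) is u v hu hv = ≤-trans (≤-reflexive (trans (pair-cong s inner) (pair-lin s 1ℚ ¼ (λ a b → 𝔼 is (λ ω → lo (Rᵤ a ω) * lo (Rᵥ b ω))) (λ a b → ∑ js (λ i → u' a i * v' b i)))))
        (≤-trans (ℚP.+-mono-≤ (*-monoˡ 0≤1 low) (*-monoˡ (<⇒≤ (ℚP.positive⁻¹ ¼)) (iterate j js u' v' (unit-u' hu) (unit-v' hv))))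
          (≤-reflexive (((∀ l c k b → 1ℚ * (l * b) + c * (k * b) ≡ (l + c * k) * b) ∋ solve-∀ ℚ-ring) (L * L) ¼ (constant j (ℕ→ℚ (m ℕ.* n))) β)))
        where
        open Split is u v
        low : pair s (λ a b → 𝔼 is (λ ω → lo (Rᵤ a ω) * lo (Rᵥ b ω))) ≤ L * L * β
        low = ≤-trans (≤-reflexive (pair-𝔼 s is (λ a b ω → lo (Rᵤ a ω) * lo (Rᵥ b ω))))
          (≤-trans (𝔼-mono is (λ ω → clamped-bound (λ a → Rᵤ a ω) (λ b → Rᵥ b ω))) (≤-reflexive (𝔼-const is (L * L * β))))

  quarter : ℕ → ℚ
  quarter zero = 1ℚ
  quarter (suc j) = ¼ * quarter j

  constant≤ : ∀ j w → constant j w ≤ ℕ→ℚ 512 + quarter j * w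
  constant≤ zero w = 0≤⇒≤ (ℕ→ℚ 512) (0≤ℕ 512) (((∀ a w → a + 1ℚ * w ≡ w + a) ∋ solve-∀ ℚ-ring) (ℕ→ℚ 512) w)
  constant≤ (suc j) w = ≤-trans (ℚP.+-monoʳ-≤ (L * L) (*-monoˡ (<⇒≤ (ℚP.positive⁻¹ ¼)) (constant≤ j w)))
    (0≤⇒≤ (ℕ→ℚ 128) (0≤ℕ 128) (((∀ q w → ℕ→ℚ 512 + ¼ * q * w ≡ (L * L + ¼ * (ℕ→ℚ 512 + q * w)) + ℕ→ℚ 128) ∋ solve-∀ ℚ-ring) (quarter j) w))

  quarter*≤1 : ∀ j → 0ℚ ≤ quarter j × quarter j ≤ 1ℚ × quarter j * ℕ→ℚ j ≤ 1ℚ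
  quarter*≤1 zero = 0≤1 , ≤-refl , 0≤1
  quarter*≤1 (suc j) with quarter*≤1 j
  ... | p , q , r = 0≤* 0≤¼ p
    , 0≤⇒≤ _ (0≤+ (0≤* 0≤¼ (≤⇒0≤ q)) (0≤* 0≤¼ (0≤ℕ 3))) (((∀ q → 1ℚ ≡ ¼ * q + (¼ * (1ℚ - q) + ¼ * 3ℚ)) ∋ solve-∀ ℚ-ring) (quarter j))
    , subst (λ t → ¼ * quarter j * t ≤ 1ℚ) (sym (ℕ→ℚ-+ 1 j)) (0≤⇒≤ _ (0≤+ (0≤+ (0≤* 0≤¼ (≤⇒0≤ q)) (0≤* 0≤¼ (≤⇒0≤ r))) (0≤* 0≤¼ (0≤ℕ 2)))
        (((∀ q j → 1ℚ ≡ ¼ * q * (1ℚ + j) + ((¼ * (1ℚ - q) + ¼ * (1ℚ - q * j)) + ¼ * ℕ→ℚ 2)) ∋ solve-∀ ℚ-ring) (quarter j) (ℕ→ℚ j)))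
    where
    0≤¼ : 0ℚ ≤ ¼
    0≤¼ = <⇒≤ (ℚP.positive⁻¹ ¼)

  -- Bounding every entry separately gives the crude constant mn, which mn truncations shrink to at
  -- most 1. The rest stays below 512, as 256 + 512/4 < 512. The value 514 is even, which later
  -- gives E the form 2jΔ.
  grothendieck : ∀ {m n} (s : Fin m → Fin n → ℚ) {β} → 0ℚ ≤ β → BoundedOnCube s β → ∀ {I : Set} (is : List I) u v → Unit is u → Unit is v →
    pair s (λ a b → ∑ is (λ i → u a i * v b i)) ≤ ℕ→ℚ 514 * β
  grothendieck {m} {n} s {β} 0≤β bound is u v hu hv = ≤-trans (iterate s β bound N is u v hu hv)
    (*-monoʳ 0≤β (≤-trans (constant≤ N (ℕ→ℚ N)) (≤-trans (ℚP.+-monoʳ-≤ (ℕ→ℚ 512) (proj₂ (proj₂ (quarter*≤1 N)))) (ℕ→ℚ-mono {513} {514} (ℕP.n≤1+n 513)))))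
    where N = m ℕ.* n

-- Convex combinations of rectangles, by duality.

module Achievable where
  open Rationals
  open Exchange using (tuples; tuples-complete; argmax)
  open Grothendieck
  open import Data.Nat using (ℕ; zero; suc)
  open import Data.Rational using (ℚ; 0ℚ; 1ℚ; ½; _+_; _*_; _-_; -_; _≤_; _<_)
  open import Data.Rational.Properties as ℚP using (≤-trans; ≤-refl; ≤-reflexive; <⇒≤)
  open import Tactic.RingSolver using (solve-∀)

  𝟙 : Bool → ℚ
  𝟙 true = 1ℚ
  𝟙 false = 0ℚ

  𝟙-∧ : ∀ x y → 𝟙 x * 𝟙 y ≡ 𝟙 (x ∧ y)
  𝟙-∧ true y = ℚP.*-identityˡ (𝟙 y)
  𝟙-∧ false y = ℚP.*-zeroˡ (𝟙 y)

  linear-max : ∀ k (t x : Fin k → ℚ) → (∀ i → 0ℚ ≤ x i) → (∀ i → x i ≤ 1ℚ) → sumℚ k (λ i → t i * x i) ≤ sumℚ k (λ i → t i * 𝟙 ⌊ 0ℚ ℚP.≤? t i ⌋)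
  linear-max k t x lo hi = S-mono k λ i → term (t i) (x i) (lo i) (hi i)
    where
    term : ∀ t x → 0ℚ ≤ x → x ≤ 1ℚ → t * x ≤ t * 𝟙 ⌊ 0ℚ ℚP.≤? t ⌋
    term t x lo hi with 0ℚ ℚP.≤? t
    ... | yes p = *-monoˡ p hi
    ... | no p = 0≤⇒≤ _ (0≤* (≤⇒0≤ (<⇒≤ (ℚP.≰⇒> p))) lo) (((∀ t x → t * 0ℚ ≡ t * x + (0ℚ - t) * x) ∋ solve-∀ ℚ-ring) t x)

  power : ℚ → ℕ → ℚ
  power q zero = 1ℚ
  power q (suc t) = q * power q t

  module _ {m n : ℕ} where
    BoundedOnRectangles : (Fin m → Fin n → ℚ) → ℚ → Set
    BoundedOnRectangles s β = ∀ (x : Fin m → Bool) (y : Fin n → Bool) → pair s (λ a b → 𝟙 (x a) * 𝟙 (y b)) ≤ β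

    -- By duality: P is a convex combination of combinatorial rectangles.
    Achievable : (Fin m → Fin n → ℚ) → Set
    Achievable P = ∀ s β → BoundedOnRectangles s β → pair s P ≤ β

    -- A bilinear form on a cube is largest at a vertex: x is rounded for the given y, then y for
    -- the rounded x.
    unit-interval-bound : ∀ {s β} → BoundedOnRectangles s β → ∀ (x : Fin m → ℚ) (y : Fin n → ℚ) →
      (∀ a → 0ℚ ≤ x a) → (∀ a → x a ≤ 1ℚ) → (∀ b → 0ℚ ≤ y b) → (∀ b → y b ≤ 1ℚ) → pair s (λ a b → x a * y b) ≤ β
    unit-interval-bound {s} {β} bound x y x₀ x₁ y₀ y₁ = begin
      pair s (λ a b → x a * y b) ≡⟨ rows x y ⟩
      sumℚ m (λ a → t a * x a) ≤⟨ linear-max m t x x₀ x₁ ⟩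
      sumℚ m (λ a → t a * 𝟙 (X a)) ≡⟨ trans (sym (rows (𝟙 ∘ X) y)) (cols (𝟙 ∘ X) y) ⟩
      sumℚ n (λ b → w b * y b) ≤⟨ linear-max n w y y₀ y₁ ⟩
      sumℚ n (λ b → w b * 𝟙 (Y b)) ≡⟨ cols (𝟙 ∘ X) (𝟙 ∘ Y) ⟨
      pair s (λ a b → 𝟙 (X a) * 𝟙 (Y b)) ≤⟨ bound X Y ⟩
      β ∎
      where
      open ℚP.≤-Reasoning
      t : Fin m → ℚ
      t a = sumℚ n (λ b → s a b * y b)
      X : Fin m → Bool
      X a = ⌊ 0ℚ ℚP.≤? t a ⌋
      w : Fin n → ℚ
      w b = sumℚ m (λ a → s a b * 𝟙 (X a))
      Y : Fin n → Bool
      Y b = ⌊ 0ℚ ℚP.≤? w b ⌋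
      rows : ∀ (x : Fin m → ℚ) (y : Fin n → ℚ) → pair s (λ a b → x a * y b) ≡ sumℚ m (λ a → sumℚ n (λ b → s a b * y b) * x a)
      rows x y = S-cong m (λ a → trans (S-cong n (λ b → ((∀ s x y → s * (x * y) ≡ s * y * x) ∋ solve-∀ ℚ-ring) (s a b) (x a) (y b))) (S-*ʳ n (x a) (λ b → s a b * y b)))
      cols : ∀ (x : Fin m → ℚ) (y : Fin n → ℚ) → pair s (λ a b → x a * y b) ≡ sumℚ n (λ b → sumℚ m (λ a → s a b * x a) * y b)
      cols x y = trans (S-swap m n (λ a b → s a b * (x a * y b)))
        (S-cong n (λ b → trans (S-cong m (λ a → sym (ℚP.*-assoc (s a b) (x a) (y b)))) (S-*ʳ m (y b) (λ a → s a b * x a))))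

    -- If β bounds s on rectangles, then 4β - σ, where σ is the sum of all entries of s, bounds s on
    -- the cube of signs. Grothendieck's inequality carries this over to inner products, and its
    -- constant is absorbed by κ.
    achievable-inner : ∀ {I : Set} (is : List I) u v → Unit is u → Unit is v →
      Achievable (λ a b → ¼ * (1ℚ + inv (ℕ→ℚ 514) * ∑ is (λ i → u a i * v b i)))
    achievable-inner is u v hu hv s β bound = begin
      pair s (λ a b → ¼ * (1ℚ + κ * M a b)) ≡⟨ trans (pair-cong s (λ a b → ((∀ c k x → c * (1ℚ + k * x) ≡ c * 1ℚ + (c * k) * x) ∋ solve-∀ ℚ-ring) ¼ κ (M a b))) (pair-lin s ¼ (¼ * κ) (λ _ _ → 1ℚ) M) ⟩
      ¼ * σ + (¼ * κ) * pair s M ≤⟨ ℚP.+-monoʳ-≤ (¼ * σ) (*-monoˡ (<⇒≤ (0<* 0<¼ (0<inv (0<ℕ 513)))) (grothendieck s 0≤β' bound' is u v hu hv)) ⟩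
      ¼ * σ + (¼ * κ) * (ℕ→ℚ 514 * β') ≡⟨ ((∀ σ b → ¼ * σ + (¼ * κ) * (ℕ→ℚ 514 * (ℕ→ℚ 4 * b - σ)) ≡ b) ∋ solve-∀ ℚ-ring) σ β ⟩
      β ∎
      where
      open ℚP.≤-Reasoning
      κ σ β' : ℚ
      κ = inv (ℕ→ℚ 514)
      M : Fin m → Fin n → ℚ
      M a b = ∑ is (λ i → u a i * v b i)
      σ = pair s (λ _ _ → 1ℚ)
      β' = ℕ→ℚ 4 * β - σ
      0<¼ : 0ℚ < ¼
      0<¼ = ℚP.positive⁻¹ ¼
      0≤½ : 0ℚ ≤ ½
      0≤½ = <⇒≤ (ℚP.positive⁻¹ ½)
      -- (1 + xy)/4 is the mean of (1+x)/2 (1+y)/2 and (1-x)/2 (1-y)/2.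
      bound' : BoundedOnCube s β'
      bound' x y x₋ x₊ y₋ y₊ = 0≤⇒≤ _ (0≤+ (0≤* (0≤ℕ 2) (≤⇒0≤ plus)) (0≤* (0≤ℕ 2) (≤⇒0≤ minus)))
        (trans (((∀ b σ p q t → ℕ→ℚ 4 * b - σ ≡ t + ((ℕ→ℚ 2 * (b - p) + ℕ→ℚ 2 * (b - q)) + ((ℕ→ℚ 2 * p + ℕ→ℚ 2 * q) - (1ℚ * σ + 1ℚ * t)))) ∋ solve-∀ ℚ-ring) β σ P Q T)
          (trans (cong (λ w → T + ((ℕ→ℚ 2 * (β - P) + ℕ→ℚ 2 * (β - Q)) + (w - (1ℚ * σ + 1ℚ * T)))) combine)
          (((∀ t d e → t + (d + (e - e)) ≡ t + d) ∋ solve-∀ ℚ-ring) T (ℕ→ℚ 2 * (β - P) + ℕ→ℚ 2 * (β - Q)) (1ℚ * σ + 1ℚ * T))))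
        where
        P Q T : ℚ
        P = pair s (λ a b → (½ * (1ℚ + x a)) * (½ * (1ℚ + y b)))
        Q = pair s (λ a b → (½ * (1ℚ - x a)) * (½ * (1ℚ - y b)))
        T = pair s (λ a b → x a * y b)
        lo₊ : ∀ {z} → - 1ℚ ≤ z → 0ℚ ≤ ½ * (1ℚ + z)
        lo₊ {z} p = 0≤* 0≤½ (subst (0ℚ ≤_) (((∀ z → z - - 1ℚ ≡ 1ℚ + z) ∋ solve-∀ ℚ-ring) z) (≤⇒0≤ p))
        hi₊ : ∀ {z} → z ≤ 1ℚ → ½ * (1ℚ + z) ≤ 1ℚ
        hi₊ {z} p = 0≤⇒≤ _ (0≤* 0≤½ (≤⇒0≤ p)) (((∀ z → 1ℚ ≡ ½ * (1ℚ + z) + ½ * (1ℚ - z)) ∋ solve-∀ ℚ-ring) z)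
        lo₋ : ∀ {z} → z ≤ 1ℚ → 0ℚ ≤ ½ * (1ℚ - z)
        lo₋ p = 0≤* 0≤½ (≤⇒0≤ p)
        hi₋ : ∀ {z} → - 1ℚ ≤ z → ½ * (1ℚ - z) ≤ 1ℚ
        hi₋ {z} p = 0≤⇒≤ _ (lo₊ p) (((∀ z → 1ℚ ≡ ½ * (1ℚ - z) + ½ * (1ℚ + z)) ∋ solve-∀ ℚ-ring) z)
        plus : P ≤ β
        plus = unit-interval-bound {s} {β} bound (λ a → ½ * (1ℚ + x a)) (λ b → ½ * (1ℚ + y b)) (λ a → lo₊ (x₋ a)) (λ a → hi₊ (x₊ a)) (λ b → lo₊ (y₋ b)) (λ b → hi₊ (y₊ b))
        minus : Q ≤ β
        minus = unit-interval-bound {s} {β} bound (λ a → ½ * (1ℚ - x a)) (λ b → ½ * (1ℚ - y b)) (λ a → lo₋ (x₊ a)) (λ a → hi₋ (x₋ a)) (λ b → lo₋ (y₊ b)) (λ b → hi₋ (y₋ b))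
        combine : ℕ→ℚ 2 * P + ℕ→ℚ 2 * Q ≡ 1ℚ * σ + 1ℚ * T
        combine = trans (sym (pair-lin s (ℕ→ℚ 2) (ℕ→ℚ 2) (λ a b → (½ * (1ℚ + x a)) * (½ * (1ℚ + y b))) (λ a b → (½ * (1ℚ - x a)) * (½ * (1ℚ - y b)))))
          (trans (pair-cong s (λ a b → ((∀ x y → ℕ→ℚ 2 * ((½ * (1ℚ + x)) * (½ * (1ℚ + y))) + ℕ→ℚ 2 * ((½ * (1ℚ - x)) * (½ * (1ℚ - y))) ≡ 1ℚ * 1ℚ + 1ℚ * (x * y)) ∋ solve-∀ ℚ-ring) (x a) (y b)))
            (pair-lin s 1ℚ 1ℚ (λ _ _ → 1ℚ) (λ a b → x a * y b)))
      0≤β' : 0ℚ ≤ β'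
      0≤β' = subst (_≤ β') (S-0 m (λ a → S-0 n (λ b → ((∀ s → s * (0ℚ * 0ℚ) ≡ 0ℚ) ∋ solve-∀ ℚ-ring) (s a b))))
        (bound' (λ _ → 0ℚ) (λ _ → 0ℚ) (λ _ → ≤-trans (ℚP.neg-antimono-≤ 0≤1) ≤-refl) (λ _ → 0≤1) (λ _ → ≤-trans (ℚP.neg-antimono-≤ 0≤1) ≤-refl) (λ _ → 0≤1))

    -- Rectangles are closed under intersection. Dually, Q and then a single rectangle are moved
    -- into the weight s.
    Achievable-* : ∀ {P Q} → Achievable P → Achievable Q → Achievable (λ a b → P a b * Q a b)
    Achievable-* {P} {Q} hp hq s β bound = subst (_≤ β)
      (S-cong m (λ a → S-cong n (λ b → ((∀ s p q → s * q * p ≡ s * (p * q)) ∋ solve-∀ ℚ-ring) (s a b) (P a b) (Q a b))))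
      (hp (λ a b → s a b * Q a b) β λ x y → subst (_≤ β)
        (S-cong m (λ a → S-cong n (λ b → ((∀ s r q → s * r * q ≡ s * q * r) ∋ solve-∀ ℚ-ring) (s a b) (𝟙 (x a) * 𝟙 (y b)) (Q a b))))
        (hq (λ a b → s a b * (𝟙 (x a) * 𝟙 (y b))) β λ x' y' → subst (_≤ β)
          (S-cong m (λ a → S-cong n (λ b → trans (cong₂ (λ p q → s a b * (p * q)) (sym (𝟙-∧ (x a) (x' a))) (sym (𝟙-∧ (y b) (y' b))))
             (((∀ s p q r t → s * ((p * q) * (r * t)) ≡ s * (p * r) * (q * t)) ∋ solve-∀ ℚ-ring) (s a b) (𝟙 (x a)) (𝟙 (x' a)) (𝟙 (y b)) (𝟙 (y' b))))))
          (bound (λ a → x a ∧ x' a) (λ b → y b ∧ y' b))))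

    Achievable-power : ∀ {P} → Achievable P → ∀ t → Achievable (λ a b → power (P a b) t)
    Achievable-power hp zero s β bound = bound (λ _ → true) (λ _ → true)
    Achievable-power hp (suc t) = Achievable-* hp (Achievable-power hp t)

    -- Taking for β the maximum over the finitely many rectangles makes the dual inequality name a
    -- rectangle, with no convex combination at hand.
    best-rectangle : ∀ {P} → Achievable P → ∀ s → Σ (Fin m → Bool) λ x → Σ (Fin n → Bool) λ y → pair s P ≤ pair s (λ a b → 𝟙 (x a) * 𝟙 (y b))
    best-rectangle {P} hp s = result (argmax (λ _ → ⊤) (λ _ → yes tt) φ candidates (∈-cartesianProduct⁺ (proj₁ (proj₂ (find m (λ _ → true)))) (proj₁ (proj₂ (find n (λ _ → true))))) tt)
      where
      Rect = (Fin m → Bool) × (Fin n → Bool)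
      φ : Rect → ℚ
      φ (x , y) = pair s (λ a b → 𝟙 (x a) * 𝟙 (y b))
      bools : List Bool
      bools = true ∷ false ∷ []
      bool∈ : ∀ b → b ∈ bools
      bool∈ true = here refl
      bool∈ false = there (here refl)
      find : ∀ k (x : Fin k → Bool) → ∃ λ x' → x' ∈ tuples k bools × x' ≗ x
      find k x = tuples-complete k x (bool∈ ∘ x)
      candidates : List Rect
      candidates = cartesianProduct (tuples m bools) (tuples n bools)
      result : (∃ λ z → z ∈ candidates × ⊤ × (∀ {z'} → z' ∈ candidates → ⊤ → φ z' ≤ φ z)) → _
      result ((x , y) , _ , _ , max) = x , y , hp s (φ (x , y)) λ x' y' →
        ≤-trans (≤-reflexive (pair-cong s (λ a b → cong₂ (λ p q → 𝟙 p * 𝟙 q) (sym (proj₂ (proj₂ (find m x')) a)) (sym (proj₂ (proj₂ (find n y')) b)))))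
          (max (∈-cartesianProduct⁺ (proj₁ (proj₂ (find m x'))) (proj₁ (proj₂ (find n y')))) tt)

-- Passage between counts in ℕ and weighted sums in ℚ.

module Counting where
  open Rationals
  open Grothendieck
  open Achievable
  open import Data.Nat as ℕ using (ℕ; zero; suc; _^_; _∸_)
  import Data.Nat.Properties as ℕP
  open import Data.Rational using (ℚ; _+_; _*_; _-_; -_; _≤_)
  open import Tactic.RingSolver using (solve-∀)

  private variable
    A B : Set

  ∑ℕ : List A → (A → ℕ) → ℕ
  ∑ℕ [] g = 0
  ∑ℕ (x ∷ xs) g = g x ℕ.+ ∑ℕ xs g

  ∑ℕ² : List A → List B → (A → B → ℕ) → ℕ
  ∑ℕ² X Y h = ∑ℕ X (λ a → ∑ℕ Y (h a))

  ι : Bool → ℕ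
  ι true = 1
  ι false = 0

  ∑ℕ-cast : ∀ (xs : List A) (g : A → ℕ) → ℕ→ℚ (∑ℕ xs g) ≡ ∑ xs (λ x → ℕ→ℚ (g x))
  ∑ℕ-cast [] g = refl
  ∑ℕ-cast (x ∷ xs) g = trans (ℕ→ℚ-+ (g x) (∑ℕ xs g)) (cong (ℕ→ℚ (g x) +_) (∑ℕ-cast xs g))

  ∑ℕ²-cast : ∀ (X : List A) (Y : List B) h → ℕ→ℚ (∑ℕ² X Y h) ≡ ∑ X (λ a → ∑ Y (λ b → ℕ→ℚ (h a b)))
  ∑ℕ²-cast X Y h = trans (∑ℕ-cast X (λ a → ∑ℕ Y (h a))) (∑-cong X (λ a → ∑ℕ-cast Y (h a)))

  ∑-tabulate : ∀ k (t : Fin k → A) (g : A → ℚ) → ∑ (tabulate t) g ≡ sumℚ k (g ∘ t)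
  ∑-tabulate zero t g = refl
  ∑-tabulate (suc k) t g = cong (g (t zero) +_) (∑-tabulate k (t ∘ suc) g)

  -- Rows and columns are given as lists, possibly with repetitions. Multiplicities turn sums over
  -- lists into weights s for `pair`, to which duality applies.
  multiplicity : ∀ {m} → List (Fin m) → Fin m → ℚ
  multiplicity X a = ∑ X (λ x → δ x a)

  ∑-multiplicity : ∀ {m} (X : List (Fin m)) g → ∑ X g ≡ sumℚ m (λ a → multiplicity X a * g a)
  ∑-multiplicity {m} X g = trans (∑-cong X (λ x → sym (S-δ m x g)))
    (trans (S-swap (length X) m (λ i a → δ (lookup X i) a * g a)) (S-cong m (λ a → ∑-*ʳ X (g a) (λ x → δ x a))))

  ∑²-pair : ∀ {m n} (X : List (Fin m)) (Y : List (Fin n)) (c h : Fin m → Fin n → ℚ) →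
    ∑ X (λ a → ∑ Y (λ b → c a b * h a b)) ≡ pair (λ a b → multiplicity X a * (multiplicity Y b * c a b)) h
  ∑²-pair {m} {n} X Y c h = trans (∑-multiplicity X (λ a → ∑ Y (λ b → c a b * h a b)))
    (S-cong m (λ a → trans (cong (multiplicity X a *_) (∑-multiplicity Y (λ b → c a b * h a b)))
      (trans (sym (S-* n (multiplicity X a) (λ b → multiplicity Y b * (c a b * h a b))))
        (S-cong n (λ b → ((∀ x y c h → x * (y * (c * h)) ≡ x * (y * c) * h) ∋ solve-∀ ℚ-ring) (multiplicity X a) (multiplicity Y b) (c a b) (h a b))))))

  power-* : ∀ p q t → power (p * q) t ≡ power p t * power q t
  power-* p q zero = refl
  power-* p q (suc t) = trans (cong (p * q *_) (power-* p q t)) (((∀ p q x y → p * q * (x * y) ≡ p * x * (q * y)) ∋ solve-∀ ℚ-ring) p q (power p t) (power q t))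

  power-cast : ∀ e t → power (ℕ→ℚ e) t ≡ ℕ→ℚ (e ^ t)
  power-cast e zero = refl
  power-cast e (suc t) = trans (cong (ℕ→ℚ e *_) (power-cast e t)) (sym (ℕ→ℚ-* e (e ^ t)))

  ℕ→ℚ-∸ : ∀ {w E} → w ℕ.≤ E → ℕ→ℚ (E ∸ w) ≡ ℕ→ℚ E - ℕ→ℚ w
  ℕ→ℚ-∸ {w} {E} p = trans (((∀ x y → x ≡ (x + y) - y) ∋ solve-∀ ℚ-ring) (ℕ→ℚ (E ∸ w)) (ℕ→ℚ w))
    (cong (_- ℕ→ℚ w) (trans (sym (ℕ→ℚ-+ (E ∸ w) w)) (cong ℕ→ℚ (ℕP.m∸n+n≡m p))))

-- A rectangle favouring one value of f.

module Rectangle where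
  open Rationals
  open Linear using (FactorsOn)
  open Vectors
  open Grothendieck
  open Achievable
  open Counting
  open import Data.Nat as ℕ using (ℕ; suc; _^_; _∸_; _≡ᵇ_)
  import Data.Nat.Properties as ℕP
  open import Data.Rational using (ℚ; 0ℚ; 1ℚ; _+_; _*_; _-_; -_; _≤_; _<_)
  open import Data.Rational.Properties using (≤-trans; ≤-reflexive)
  open import Tactic.RingSolver using (solve-∀)

  -- The vectors are known to be short only on X and Y, while `Unit` speaks of all indices;
  -- elsewhere they are replaced by 0.
  restrict : ∀ {P : Set} {N} → Dec P → (Fin N → ℚ) → Fin N → ℚ
  restrict (yes _) p i = p i
  restrict (no _) p i = 0ℚ

  restrict-unit : ∀ {P : Set} {N} (d : Dec P) (p : Fin N → ℚ) → (P → sumℚ N (λ i → p i * p i) ≤ 1ℚ) → ∑ (allFin N) (λ i → restrict d p i * restrict d p i) ≤ 1ℚ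
  restrict-unit {N = N} (yes x) p h = ≤-trans (≤-reflexive (∑-tabulate N id (λ i → p i * p i))) (h x)
  restrict-unit {N = N} (no _) p h = ≤-trans (≤-reflexive (trans (∑-tabulate N id (λ _ → 0ℚ * 0ℚ)) (S-0 N (λ _ → refl)))) 0≤1

  restrict-yes : ∀ {P : Set} {N} (d : Dec P) (p : Fin N → ℚ) → P → ∀ i → restrict d p i ≡ p i
  restrict-yes (yes _) p x i = refl
  restrict-yes (no ¬x) p x i = ⊥-elim (¬x x)

  𝟙≡ι : ∀ x → 𝟙 x ≡ ℕ→ℚ (ι x)
  𝟙≡ι true = refl
  𝟙≡ι false = refl

  module _ {m n : ℕ} (f : Fin m → Fin n → ℕ) (X : List (Fin m)) (Y : List (Fin n)) where
    inside : (Fin m → Bool) → (Fin n → Bool) → (Fin m → Fin n → Bool) → ℕ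
    inside x y c = ∑ℕ² X Y (λ a b → ι (x a ∧ y b) ℕ.* ι (c a b))

    module _ (Δ s k : ℕ) (1≤Δ : 1 ℕ.≤ Δ) (1≤s : 1 ℕ.≤ s) (f≤ : ∀ {a b} → a ∈ X → b ∈ Y → f a b ℕ.≤ Δ)
      (2k≤s² : 2 ℕ.* k ℕ.≤ s ℕ.* s) (fac : FactorsOn X Y (λ a b → ℕ→ℚ (f a b)) k) where

      -- With 514 bounding the Grothendieck constant, (E - f)/(4 E) is a convex
      -- combination of rectangles.
      E : ℕ
      E = 514 ℕ.* (s ℕ.* Δ)

      private
        0<ℕ' : ∀ {x} → 1 ℕ.≤ x → 0ℚ < ℕ→ℚ x
        0<ℕ' {suc x} _ = 0<ℕ x
        g : Fin m → Fin n → ℚ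
        g a b = ℕ→ℚ (f a b)
        σ D : ℚ
        σ = ℕ→ℚ s
        D = ℕ→ℚ Δ
        vectors : UnitVectors X Y (λ a b → inv (σ * D) * g a b)
        vectors = unit-vectors k g (0<ℕ' 1≤s) (0<ℕ' 1≤Δ) (subst₂ _≤_ (ℕ→ℚ-* 2 k) (ℕ→ℚ-* s s) (ℕ→ℚ-mono 2k≤s²))
          (λ {a} {b} m n → sq-mono (0≤ℕ (f a b)) (ℕ→ℚ-mono {f a b} {Δ} (f≤ m n))) fac
        open UnitVectors vectors
        open import Data.List.Membership.DecPropositional (Fin._≟_ {m}) renaming (_∈?_ to _∈ᵃ?_) using ()
        open import Data.List.Membership.DecPropositional (Fin._≟_ {n}) renaming (_∈?_ to _∈ᵇ?_) using ()
        u : Fin m → Fin N → ℚ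
        u a = restrict (a ∈ᵃ? X) (p a)
        v : Fin n → Fin N → ℚ
        -- The sign makes P decrease with f, so that powers of P damp the larger values.
        v b = restrict (b ∈ᵇ? Y) (λ i → - q b i)
        sq- : ∀ x → - x * - x ≡ x * x
        sq- = solve-∀ ℚ-ring
        unit-u : Unit (allFin N) u
        unit-u a = restrict-unit (a ∈ᵃ? X) (p a) p≤
        unit-v : Unit (allFin N) v
        unit-v b = restrict-unit (b ∈ᵇ? Y) (λ i → - q b i) (λ m → ≤-trans (≤-reflexive (S-cong N (λ i → sq- (q b i)))) (q≤ m))
        P : Fin m → Fin n → ℚ
        P a b = ¼ * (1ℚ + inv (ℕ→ℚ 514) * ∑ (allFin N) (λ i → u a i * v b i))
        achievable : Achievable P
        achievable = achievable-inner (allFin N) u v unit-u unit-v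
        inner : ∀ {a b} → a ∈ X → b ∈ Y → ∑ (allFin N) (λ i → u a i * v b i) ≡ - 1ℚ * (inv (σ * D) * g a b)
        inner {a} {b} m n = trans (∑-tabulate N id (λ i → u a i * v b i))
          (trans (S-cong N (λ i → trans (cong₂ _*_ (restrict-yes (a ∈ᵃ? X) (p a) m i) (restrict-yes (b ∈ᵇ? Y) (λ i → - q b i) n i))
              (((∀ x y → x * - y ≡ - 1ℚ * (x * y)) ∋ solve-∀ ℚ-ring) (p a i) (q b i))))
          (trans (S-* N (- 1ℚ) (λ i → p a i * q b i)) (cong (- 1ℚ *_) (pq m n))))
        f≤E : ∀ {a b} → a ∈ X → b ∈ Y → f a b ℕ.≤ E
        f≤E m n = ℕP.≤-trans (f≤ m n) (ℕP.≤-trans (ℕP.m≤n*m Δ s {{ℕ.>-nonZero 1≤s}}) (ℕP.m≤n*m (s ℕ.* Δ) 514))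
        4E*P : ∀ {a b} → a ∈ X → b ∈ Y → ℕ→ℚ (4 ℕ.* E) * P a b ≡ ℕ→ℚ (E ∸ f a b)
        4E*P {a} {b} m n = begin
          ℕ→ℚ (4 ℕ.* E) * P a b ≡⟨ cong₂ (λ x y → x * (¼ * (1ℚ + κ * y))) (ℕ→ℚ-* 4 E) (inner m n) ⟩
          ℕ→ℚ 4 * ℕ→ℚ E * (¼ * (1ℚ + κ * (- 1ℚ * (i * g a b)))) ≡⟨ ((∀ e k i g → ℕ→ℚ 4 * e * (¼ * (1ℚ + k * (- 1ℚ * (i * g)))) ≡ e - e * k * i * g) ∋ solve-∀ ℚ-ring) (ℕ→ℚ E) κ i (g a b) ⟩
          ℕ→ℚ E - ℕ→ℚ E * κ * i * g a b ≡⟨ cong (λ t → ℕ→ℚ E - t * κ * i * g a b) (trans (ℕ→ℚ-* 514 (s ℕ.* Δ)) (cong (ℕ→ℚ 514 *_) (ℕ→ℚ-* s Δ))) ⟩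
          ℕ→ℚ E - ℕ→ℚ 514 * (σ * D) * κ * i * g a b ≡⟨ cong (λ t → ℕ→ℚ E - t) (((∀ c k z i g → c * z * k * i * g ≡ (c * k) * (z * i) * g) ∋ solve-∀ ℚ-ring) (ℕ→ℚ 514) κ (σ * D) i (g a b)) ⟩
          ℕ→ℚ E - (ℕ→ℚ 514 * κ) * (σ * D * i) * g a b ≡⟨ cong₂ (λ x y → ℕ→ℚ E - x * y * g a b) (inv-rightᵖ (0<ℕ 513)) (inv-rightᵖ (0<* (0<ℕ' 1≤s) (0<ℕ' 1≤Δ))) ⟩
          ℕ→ℚ E - 1ℚ * 1ℚ * g a b ≡⟨ cong (λ t → ℕ→ℚ E - t) (((∀ g → 1ℚ * 1ℚ * g ≡ g) ∋ solve-∀ ℚ-ring) (g a b)) ⟩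
          ℕ→ℚ E - g a b ≡⟨ ℕ→ℚ-∸ (f≤E m n) ⟨
          ℕ→ℚ (E ∸ f a b) ∎
          where
          open ≡-Reasoning
          κ = inv (ℕ→ℚ 514)
          i = inv (σ * D)

      -- The best rectangle for the weight 1 on entries equal to v and -L on the others, compared
      -- with the T-th power of (E - f)/(4E). Denominators are cleared and negative terms moved
      -- across, so the inequality lives in ℕ.
      weighted-rectangle : ∀ (v L T : ℕ) → Σ (Fin m → Bool) λ x → Σ (Fin n → Bool) λ y →
        ∑ℕ² X Y (λ a b → ι (f a b ≡ᵇ v) ℕ.* (E ∸ f a b) ^ T) ℕ.+ L ℕ.* (inside x y (λ a b → not (f a b ≡ᵇ v)) ℕ.* (4 ℕ.* E) ^ T)
        ℕ.≤ inside x y (λ a b → f a b ≡ᵇ v) ℕ.* (4 ℕ.* E) ^ T ℕ.+ L ℕ.* ∑ℕ² X Y (λ a b → ι (not (f a b ≡ᵇ v)) ℕ.* (E ∸ f a b) ^ T)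
      weighted-rectangle w L T = result (best-rectangle (Achievable-power {P = P} achievable T) weight)
        where
        eq neq : Fin m → Fin n → Bool
        eq a b = f a b ≡ᵇ w
        neq a b = not (f a b ≡ᵇ w)
        c : Fin m → Fin n → ℚ
        c a b = ℕ→ℚ (ι (eq a b)) - ℕ→ℚ L * ℕ→ℚ (ι (neq a b))
        weight : Fin m → Fin n → ℚ
        weight a b = multiplicity X a * (multiplicity Y b * c a b)
        cast : (Fin m → Fin n → ℕ) → ℚ
        cast h = ℕ→ℚ (∑ℕ² X Y h)
        PT : Fin m → Fin n → ℚ
        PT a b = power (P a b) T
        Q : ℚ
        Q = ℕ→ℚ ((4 ℕ.* E) ^ T)
        expand : ∀ (h : Fin m → Fin n → ℕ) → ∑ X (λ a → ∑ Y (λ b → c a b * ℕ→ℚ (h a b))) ≡ cast (λ a b → ι (eq a b) ℕ.* h a b) - ℕ→ℚ L * cast (λ a b → ι (neq a b) ℕ.* h a b)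
        expand h = begin
          ∑ X (λ a → ∑ Y (λ b → c a b * ℕ→ℚ (h a b)))
            ≡⟨ ∑-cong X (λ a → trans (∑-cong Y (λ b → trans (((∀ e l n h → (e - l * n) * h ≡ 1ℚ * (e * h) + (- l) * (n * h)) ∋ solve-∀ ℚ-ring) (ℕ→ℚ (ι (eq a b))) (ℕ→ℚ L) (ℕ→ℚ (ι (neq a b))) (ℕ→ℚ (h a b)))
                 (sym (cong₂ (λ x y → 1ℚ * x + (- ℕ→ℚ L) * y) (ℕ→ℚ-* (ι (eq a b)) (h a b)) (ℕ→ℚ-* (ι (neq a b)) (h a b))))))
                 (∑-lin Y 1ℚ (- ℕ→ℚ L) (λ b → ℕ→ℚ (ι (eq a b) ℕ.* h a b)) (λ b → ℕ→ℚ (ι (neq a b) ℕ.* h a b)))) ⟩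
          ∑ X (λ a → 1ℚ * ∑ Y (λ b → ℕ→ℚ (ι (eq a b) ℕ.* h a b)) + (- ℕ→ℚ L) * ∑ Y (λ b → ℕ→ℚ (ι (neq a b) ℕ.* h a b)))
            ≡⟨ ∑-lin X 1ℚ (- ℕ→ℚ L) (λ a → ∑ Y (λ b → ℕ→ℚ (ι (eq a b) ℕ.* h a b))) (λ a → ∑ Y (λ b → ℕ→ℚ (ι (neq a b) ℕ.* h a b))) ⟩
          1ℚ * ∑ X (λ a → ∑ Y (λ b → ℕ→ℚ (ι (eq a b) ℕ.* h a b))) + (- ℕ→ℚ L) * ∑ X (λ a → ∑ Y (λ b → ℕ→ℚ (ι (neq a b) ℕ.* h a b)))
            ≡⟨ sym (cong₂ (λ x y → 1ℚ * x + (- ℕ→ℚ L) * y) (∑ℕ²-cast X Y (λ a b → ι (eq a b) ℕ.* h a b)) (∑ℕ²-cast X Y (λ a b → ι (neq a b) ℕ.* h a b))) ⟩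
          1ℚ * cast (λ a b → ι (eq a b) ℕ.* h a b) + (- ℕ→ℚ L) * cast (λ a b → ι (neq a b) ℕ.* h a b)
            ≡⟨ ((∀ x l y → 1ℚ * x + (- l) * y ≡ x - l * y) ∋ solve-∀ ℚ-ring) (cast (λ a b → ι (eq a b) ℕ.* h a b)) (ℕ→ℚ L) (cast (λ a b → ι (neq a b) ℕ.* h a b)) ⟩
          cast (λ a b → ι (eq a b) ℕ.* h a b) - ℕ→ℚ L * cast (λ a b → ι (neq a b) ℕ.* h a b) ∎
          where open ≡-Reasoning
        left : Q * pair weight PT ≡ cast (λ a b → ι (eq a b) ℕ.* (E ∸ f a b) ^ T) - ℕ→ℚ L * cast (λ a b → ι (neq a b) ℕ.* (E ∸ f a b) ^ T)
        left = begin
          Q * pair weight PT ≡⟨ cong (Q *_) (∑²-pair X Y c PT) ⟨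
          Q * ∑ X (λ a → ∑ Y (λ b → c a b * PT a b)) ≡⟨ trans (∑-cong X (λ a → ∑-* Y Q (λ b → c a b * PT a b))) (∑-* X Q (λ a → ∑ Y (λ b → c a b * PT a b))) ⟨
          ∑ X (λ a → ∑ Y (λ b → Q * (c a b * PT a b)))
            ≡⟨ ∑-cong∈ X (λ {a} m → ∑-cong∈ Y (λ {b} n → trans (((∀ q c p → q * (c * p) ≡ c * (q * p)) ∋ solve-∀ ℚ-ring) Q (c a b) (PT a b))
                 (cong (c a b *_) (trans (cong (_* PT a b) (sym (power-cast (4 ℕ.* E) T))) (trans (sym (power-* (ℕ→ℚ (4 ℕ.* E)) (P a b) T))
                    (trans (cong (λ t → power t T) (4E*P m n)) (power-cast (E ∸ f a b) T))))))) ⟩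
          ∑ X (λ a → ∑ Y (λ b → c a b * ℕ→ℚ ((E ∸ f a b) ^ T))) ≡⟨ expand (λ a b → (E ∸ f a b) ^ T) ⟩
          _ ∎
          where open ≡-Reasoning
        right : ∀ (x : Fin m → Bool) (y : Fin n → Bool) → pair weight (λ a b → 𝟙 (x a) * 𝟙 (y b)) ≡ ℕ→ℚ (inside x y eq) - ℕ→ℚ L * ℕ→ℚ (inside x y neq)
        right x y = begin
          pair weight (λ a b → 𝟙 (x a) * 𝟙 (y b)) ≡⟨ pair-cong weight (λ a b → trans (𝟙-∧ (x a) (y b)) (𝟙≡ι (x a ∧ y b))) ⟩
          pair weight (λ a b → ℕ→ℚ (ι (x a ∧ y b))) ≡⟨ ∑²-pair X Y c (λ a b → ℕ→ℚ (ι (x a ∧ y b))) ⟨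
          ∑ X (λ a → ∑ Y (λ b → c a b * ℕ→ℚ (ι (x a ∧ y b)))) ≡⟨ expand (λ a b → ι (x a ∧ y b)) ⟩
          cast (λ a b → ι (eq a b) ℕ.* ι (x a ∧ y b)) - ℕ→ℚ L * cast (λ a b → ι (neq a b) ℕ.* ι (x a ∧ y b))
            ≡⟨ cong₂ (λ p q → ℕ→ℚ p - ℕ→ℚ L * ℕ→ℚ q) (flip eq) (flip neq) ⟩
          ℕ→ℚ (inside x y eq) - ℕ→ℚ L * ℕ→ℚ (inside x y neq) ∎
          where
          open ≡-Reasoning
          ∑ℕ-cong : ∀ {A : Set} (xs : List A) {g h : A → ℕ} → (∀ x → g x ≡ h x) → ∑ℕ xs g ≡ ∑ℕ xs h
          ∑ℕ-cong [] e = refl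
          ∑ℕ-cong (x ∷ xs) e = cong₂ ℕ._+_ (e x) (∑ℕ-cong xs e)
          flip : ∀ (c : Fin m → Fin n → Bool) → ∑ℕ² X Y (λ a b → ι (c a b) ℕ.* ι (x a ∧ y b)) ≡ inside x y c
          flip c = ∑ℕ-cong X (λ a → ∑ℕ-cong Y (λ b → ℕP.*-comm (ι (c a b)) (ι (x a ∧ y b))))
        result : (Σ (Fin m → Bool) λ x → Σ (Fin n → Bool) λ y → pair weight PT ≤ pair weight (λ a b → 𝟙 (x a) * 𝟙 (y b))) → _
        result (x , y , h) = x , y , ℕ→ℚ-cancel (subst₂ _≤_ (sym l) (sym r)
            (0≤⇒≤ _ (≤⇒0≤ (subst₂ _≤_ left (cong (Q *_) (right x y)) (*-monoˡ (0≤ℕ ((4 ℕ.* E) ^ T)) h)))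
              (((∀ q l G B g b → g * q + l * B ≡ (G + l * (b * q)) + (q * (g - l * b) - (G - l * B))) ∋ solve-∀ ℚ-ring) Q (ℕ→ℚ L) (ℕ→ℚ G₁) (ℕ→ℚ B₁) (ℕ→ℚ (inside x y eq)) (ℕ→ℚ (inside x y neq)))))
          where
          G₁ B₁ : ℕ
          G₁ = ∑ℕ² X Y (λ a b → ι (eq a b) ℕ.* (E ∸ f a b) ^ T)
          B₁ = ∑ℕ² X Y (λ a b → ι (neq a b) ℕ.* (E ∸ f a b) ^ T)
          l : ℕ→ℚ (G₁ ℕ.+ L ℕ.* (inside x y neq ℕ.* (4 ℕ.* E) ^ T)) ≡ ℕ→ℚ G₁ + ℕ→ℚ L * (ℕ→ℚ (inside x y neq) * Q)
          l = trans (ℕ→ℚ-+ G₁ _) (cong (ℕ→ℚ G₁ +_) (trans (ℕ→ℚ-* L _) (cong (ℕ→ℚ L *_) (ℕ→ℚ-* (inside x y neq) ((4 ℕ.* E) ^ T)))))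
          r : ℕ→ℚ (inside x y eq ℕ.* (4 ℕ.* E) ^ T ℕ.+ L ℕ.* B₁) ≡ ℕ→ℚ (inside x y eq) * Q + ℕ→ℚ L * ℕ→ℚ B₁
          r = trans (ℕ→ℚ-+ (inside x y eq ℕ.* (4 ℕ.* E) ^ T) (L ℕ.* B₁)) (cong₂ _+_ (ℕ→ℚ-* (inside x y eq) ((4 ℕ.* E) ^ T)) (ℕ→ℚ-* L B₁))

-- The numerical estimates behind the choice of v and T.

module Core where
  open import Data.Nat
  open import Data.Nat.Properties
  open import Data.Nat.Tactic.RingSolver using (solve-∀)

  find-step : ∀ (Q : ℕ → Set) → (∀ v → Dec (Q v)) → Q 0 → ∀ n → ¬ Q n → ∃ λ v → v < n × Q v × ¬ Q (suc v)
  find-step Q Q? q₀ zero ¬q = ⊥-elim (¬q q₀)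
  find-step Q Q? q₀ (suc n) ¬q with Q? n
  ... | yes q = n , ≤-refl , q , ¬q
  ... | no ¬q' = let v , v<n , r = find-step Q Q? q₀ n ¬q' in v , m≤n⇒m≤1+n v<n , r

  1≤^ : ∀ {x} n → 1 ≤ x → 1 ≤ x ^ n
  1≤^ {x} n p = m^n>0 x {{>-nonZero p}} n

  ^-distrib-* : ∀ x y n → (x * y) ^ n ≡ x ^ n * y ^ n
  ^-distrib-* x y zero = refl
  ^-distrib-* x y (suc n) = trans (cong (x * y *_) (^-distrib-* x y n)) (((∀ x y p q → x * y * (p * q) ≡ x * p * (y * q)) ∋ solve-∀) x y (x ^ n) (y ^ n))

  bernoulli : ∀ x n → x ^ n * (x + n) ≤ suc x ^ n * x
  bernoulli x zero = ≤-reflexive (((∀ x → 1 * (x + 0) ≡ 1 * x) ∋ solve-∀) x)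
  bernoulli x (suc n) = begin
    x * x ^ n * (x + suc n) ≡⟨ ((∀ x p n → x * p * (x + (1 + n)) ≡ p * (x * (x + n) + x)) ∋ solve-∀) x (x ^ n) n ⟩
    x ^ n * (x * (x + n) + x) ≤⟨ *-monoʳ-≤ (x ^ n) (+-monoʳ-≤ (x * (x + n)) (m≤m+n x n)) ⟩
    x ^ n * (x * (x + n) + (x + n)) ≡⟨ ((∀ x p n → p * (x * (x + n) + (x + n)) ≡ (1 + x) * (p * (x + n))) ∋ solve-∀) x (x ^ n) n ⟩
    suc x * (x ^ n * (x + n)) ≤⟨ *-monoʳ-≤ (suc x) (bernoulli x n) ⟩
    suc x * (suc x ^ n * x) ≡⟨ *-assoc (suc x) (suc x ^ n) x ⟨
    suc x * suc x ^ n * x ∎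
    where open ≤-Reasoning

  -- For x > 0 this is (1 + 1/x)^E ≥ 1 + E/x ≥ 2.
  double-power : ∀ x E → 1 ≤ E → x ≤ E → 2 * x ^ E ≤ suc x ^ E
  double-power zero (suc E) _ _ = z≤n
  double-power x@(suc _) E _ x≤E = *-cancelʳ-≤ (2 * x ^ E) (suc x ^ E) x (begin
    2 * x ^ E * x ≡⟨ ((∀ p x → 2 * p * x ≡ p * (x + x)) ∋ solve-∀) (x ^ E) x ⟩
    x ^ E * (x + x) ≤⟨ *-monoʳ-≤ (x ^ E) (+-monoʳ-≤ x x≤E) ⟩
    x ^ E * (x + E) ≤⟨ bernoulli x E ⟩
    suc x ^ E * x ∎)
    where open ≤-Reasoning

  -- The inequality (1 - 1/(y + 1))^n ≥ 1 - n/(y + 1); d stands for y + 1 - n and avoids truncated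
  -- subtraction.
  bernoulli' : ∀ y n d → suc y ≡ n + d → suc y ^ n * d ≤ y ^ n * suc y
  bernoulli' y zero d e = ≤-reflexive (trans (*-identityˡ d) (trans (sym e) (sym (*-identityˡ (suc y)))))
  bernoulli' y (suc n) d e = begin
    suc y * suc y ^ n * d ≡⟨ ((∀ y p d → (1 + y) * p * d ≡ p * (y * d + d)) ∋ solve-∀) y (suc y ^ n) d ⟩
    suc y ^ n * (y * d + d) ≤⟨ *-monoʳ-≤ (suc y ^ n) (+-monoʳ-≤ (y * d) (subst (d ≤_) (sym (suc-injective e)) (m≤n+m d n))) ⟩
    suc y ^ n * (y * d + y) ≡⟨ ((∀ y p d → p * (y * d + y) ≡ y * (p * (1 + d))) ∋ solve-∀) y (suc y ^ n) d ⟩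
    y * (suc y ^ n * suc d) ≤⟨ *-monoʳ-≤ y (bernoulli' y n (suc d) (trans e (sym (+-suc n d)))) ⟩
    y * (y ^ n * suc y) ≡⟨ *-assoc y (y ^ n) (suc y) ⟨
    y * y ^ n * suc y ∎
    where open ≤-Reasoning

  -- E rounds of damping cost the value v at most a factor 4^Δ: since v ≤ Δ, the ratio (E - v)/E is
  -- at least 1 - 1/(2j), whose j-th power is at least ½, and E = j · 2Δ.
  power-loss : ∀ j Δ v → 1 ≤ j → v ≤ Δ → let E = 2 * j * Δ in E ^ E ≤ 2 ^ (2 * Δ) * (E ∸ v) ^ E
  power-loss j@(suc i) Δ v _ v≤Δ = begin
    E ^ E ≡⟨ ^-distrib-* (2 * j) Δ E ⟩
    (2 * j) ^ E * Δ ^ E ≡⟨ cong (λ t → (2 * j) ^ t * Δ ^ E) E≡ ⟩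
    (2 * j) ^ (j * (2 * Δ)) * Δ ^ E ≡⟨ cong (_* Δ ^ E) (^-*-assoc (2 * j) j (2 * Δ)) ⟨
    ((2 * j) ^ j) ^ (2 * Δ) * Δ ^ E ≤⟨ *-monoˡ-≤ (Δ ^ E) (^-monoˡ-≤ (2 * Δ) halves) ⟩
    (2 * y ^ j) ^ (2 * Δ) * Δ ^ E ≡⟨ cong (_* Δ ^ E) (^-distrib-* 2 (y ^ j) (2 * Δ)) ⟩
    2 ^ (2 * Δ) * (y ^ j) ^ (2 * Δ) * Δ ^ E ≡⟨ cong (λ t → 2 ^ (2 * Δ) * t * Δ ^ E) (trans (^-*-assoc y j (2 * Δ)) (cong (y ^_) (sym E≡))) ⟩
    2 ^ (2 * Δ) * y ^ E * Δ ^ E ≡⟨ trans (*-assoc (2 ^ (2 * Δ)) (y ^ E) (Δ ^ E)) (cong (2 ^ (2 * Δ) *_) (sym (^-distrib-* y Δ E))) ⟩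
    2 ^ (2 * Δ) * (y * Δ) ^ E ≤⟨ *-monoʳ-≤ (2 ^ (2 * Δ)) (^-monoˡ-≤ E yΔ≤) ⟩
    2 ^ (2 * Δ) * (E ∸ v) ^ E ∎
    where
    open ≤-Reasoning
    E y : ℕ
    E = 2 * j * Δ
    y = i + j
    E≡ : E ≡ j * (2 * Δ)
    E≡ = ((∀ j Δ → 2 * j * Δ ≡ j * (2 * Δ)) ∋ solve-∀) j Δ
    2j≡ : 2 * j ≡ suc y
    2j≡ = cong (j +_) (+-identityʳ j)
    halves : (2 * j) ^ j ≤ 2 * y ^ j
    halves = *-cancelʳ-≤ ((2 * j) ^ j) (2 * y ^ j) j (begin
      (2 * j) ^ j * j ≡⟨ cong (λ t → t ^ j * j) 2j≡ ⟩
      suc y ^ j * j ≤⟨ bernoulli' y j j refl ⟩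
      y ^ j * suc y ≡⟨ cong (y ^ j *_) 2j≡ ⟨
      y ^ j * (2 * j) ≡⟨ ((∀ p j → p * (2 * j) ≡ 2 * p * j) ∋ solve-∀) (y ^ j) j ⟩
      2 * y ^ j * j ∎)
    yΔ≤ : y * Δ ≤ E ∸ v
    yΔ≤ = begin
      y * Δ ≡⟨ m+n∸m≡n Δ (y * Δ) ⟨
      (Δ + y * Δ) ∸ Δ ≡⟨ cong (λ t → t * Δ ∸ Δ) 2j≡ ⟨
      E ∸ Δ ≤⟨ ∸-monoʳ-≤ E v≤Δ ⟩
      E ∸ v ∎

  -- S stands for the number of all entries, C for those below v, e for those equal to v; L is the
  -- price of a wrong entry. By `few` and `many` the entries up to v are frequent only because of v
  -- itself.
  module _ {S C e ℓ κ Δ L j v : ℕ} (1≤ℓ : 1 ≤ ℓ) (1≤κ : 1 ≤ κ) (1≤Δ : 1 ≤ Δ) (1≤j : 1 ≤ j) (v≤Δ : v ≤ Δ)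
    (8L≤ : 8 * L ≤ 2 ^ ℓ) (few : C * 2 ^ (ℓ * (6 * Δ * κ)) ≤ S) (many : S < (C + e) * 2 ^ (ℓ * κ)) where

    private
      E lam T p q : ℕ
      E = 2 * j * Δ
      lam = ℓ * (κ + 1)
      -- Every E rounds at least double the advantage of v over v + 1, so T rounds gain 2^lam = p *
      -- q: the factor p makes up for the density of v, and q for the price L.
      T = E * lam
      p = 2 ^ (ℓ * κ)
      q = 2 ^ ℓ
      a b D : ℕ
      a = (E ∸ v) ^ T
      b = (E ∸ suc v) ^ T
      D = (4 * E) ^ T
      open ≤-Reasoning

      q≤p : q ≤ p
      q≤p = ^-monoʳ-≤ 2 (m≤m*n ℓ κ {{>-nonZero 1≤κ}})
      2≤p : 2 ≤ p
      2≤p = ≤-trans (^-monoʳ-≤ 2 {1} {ℓ} 1≤ℓ) q≤p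
      1≤p : 1 ≤ p
      1≤p = ≤-trans (s≤s z≤n) 2≤p
      instance
        p≢0 : NonZero p
        p≢0 = >-nonZero 1≤p
      2^κ : 2 ^ (ℓ * (6 * Δ * κ)) ≡ p ^ (6 * Δ)
      2^κ = trans (cong (2 ^_) (((∀ l d k → l * (6 * d * k) ≡ l * k * (6 * d)) ∋ solve-∀) ℓ Δ κ)) (sym (^-*-assoc 2 (ℓ * κ) (6 * Δ)))
      few' : C * p ^ (6 * Δ) ≤ S
      few' = subst (λ t → C * t ≤ S) 2^κ few
      pp≤ : ∀ c → 2 ≤ c → p * p ≤ p ^ (c * Δ)
      pp≤ c 2≤c = ≤-trans (≤-reflexive (cong (p *_) (sym (*-identityʳ p)))) (^-monoʳ-≤ p (≤-trans 2≤c (m≤m*n c Δ {{>-nonZero 1≤Δ}})))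
      Cp≤ : 2 * (C * p) ≤ S
      Cp≤ = begin
        2 * (C * p) ≡⟨ ((∀ c p → 2 * (c * p) ≡ c * (2 * p)) ∋ solve-∀) C p ⟩
        C * (2 * p) ≤⟨ *-monoʳ-≤ C (*-monoˡ-≤ p 2≤p) ⟩
        C * (p * p) ≤⟨ *-monoʳ-≤ C (pp≤ 6 (s≤s (s≤s z≤n))) ⟩
        C * p ^ (6 * Δ) ≤⟨ few' ⟩
        S ∎
      Cp<ep : C * p < e * p
      Cp<ep = +-cancelˡ-< (C * p) (C * p) (e * p) (begin-strict
        C * p + C * p ≡⟨ ((∀ x → x + x ≡ 2 * x) ∋ solve-∀) (C * p) ⟩
        2 * (C * p) ≤⟨ Cp≤ ⟩
        S <⟨ many ⟩
        (C + e) * p ≡⟨ *-distribʳ-+ p C e ⟩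
        C * p + e * p ∎)

    S≤2ep : S ≤ 2 * (e * p)
    S≤2ep = begin
      S ≤⟨ <⇒≤ many ⟩
      (C + e) * p ≡⟨ *-distribʳ-+ p C e ⟩
      C * p + e * p ≤⟨ +-monoˡ-≤ (e * p) (<⇒≤ Cp<ep) ⟩
      e * p + e * p ≡⟨ ((∀ x → x + x ≡ 2 * x) ∋ solve-∀) (e * p) ⟩
      2 * (e * p) ∎

    private
      1≤e : 1 ≤ e
      1≤e = *-cancelʳ-< p 0 e (≤-<-trans z≤n Cp<ep)
      1≤E : 1 ≤ E
      1≤E = *-mono-≤ {1} {2 * j} {1} {Δ} (*-mono-≤ {1} {2} {1} {j} (s≤s z≤n) 1≤j) 1≤Δ
      2Δ≤E : 2 * Δ ≤ E
      2Δ≤E = *-monoˡ-≤ Δ (m≤m*n 2 j {{>-nonZero 1≤j}})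
      v<E : v < E
      v<E = ≤-trans (s≤s v≤Δ) (≤-trans (≤-trans (≤-reflexive (+-comm 1 Δ)) (+-monoʳ-≤ Δ (≤-trans 1≤Δ (≤-reflexive (sym (+-identityʳ Δ)))))) 2Δ≤E)
      step : suc (E ∸ suc v) ≡ E ∸ v
      step = sym (+-∸-assoc 1 v<E)
      gap : p * q * b ≤ a
      gap = begin
        p * q * b ≡⟨ cong (_* b) (trans (sym (^-distribˡ-+-* 2 (ℓ * κ) ℓ)) (cong (2 ^_) (((∀ l k → l * k + l ≡ l * (k + 1)) ∋ solve-∀) ℓ κ))) ⟩
        2 ^ lam * (E ∸ suc v) ^ T ≡⟨ cong (2 ^ lam *_) (^-*-assoc (E ∸ suc v) E lam) ⟨
        2 ^ lam * ((E ∸ suc v) ^ E) ^ lam ≡⟨ ^-distrib-* 2 ((E ∸ suc v) ^ E) lam ⟨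
        (2 * (E ∸ suc v) ^ E) ^ lam ≤⟨ ^-monoˡ-≤ lam (double-power (E ∸ suc v) E 1≤E (m∸n≤m E (suc v))) ⟩
        (suc (E ∸ suc v) ^ E) ^ lam ≡⟨ cong (λ t → (t ^ E) ^ lam) step ⟩
        ((E ∸ v) ^ E) ^ lam ≡⟨ ^-*-assoc (E ∸ v) E lam ⟩
        a ∎
      above : 4 * (L * (S * b)) ≤ e * a
      above = begin
        4 * (L * (S * b)) ≤⟨ *-monoʳ-≤ 4 (*-monoʳ-≤ L (*-monoˡ-≤ b S≤2ep)) ⟩
        4 * (L * (2 * (e * p) * b)) ≡⟨ ((∀ L e p b → 4 * (L * (2 * (e * p) * b)) ≡ 8 * L * (e * p * b)) ∋ solve-∀) L e p b ⟩
        8 * L * (e * p * b) ≤⟨ *-monoˡ-≤ (e * p * b) 8L≤ ⟩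
        q * (e * p * b) ≡⟨ ((∀ q e p b → q * (e * p * b) ≡ e * (p * q * b)) ∋ solve-∀) q e p b ⟩
        e * (p * q * b) ≤⟨ *-monoʳ-≤ e gap ⟩
        e * a ∎
      loss : E ^ T ≤ p ^ (4 * Δ) * a
      loss = begin
        E ^ T ≡⟨ ^-*-assoc E E lam ⟨
        (E ^ E) ^ lam ≤⟨ ^-monoˡ-≤ lam (power-loss j Δ v 1≤j v≤Δ) ⟩
        (2 ^ (2 * Δ) * (E ∸ v) ^ E) ^ lam ≡⟨ ^-distrib-* (2 ^ (2 * Δ)) ((E ∸ v) ^ E) lam ⟩
        (2 ^ (2 * Δ)) ^ lam * ((E ∸ v) ^ E) ^ lam ≡⟨ cong₂ _*_ (^-*-assoc 2 (2 * Δ) lam) (^-*-assoc (E ∸ v) E lam) ⟩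
        2 ^ (2 * Δ * lam) * a ≤⟨ *-monoˡ-≤ a (^-monoʳ-≤ 2 expo) ⟩
        2 ^ (ℓ * κ * (4 * Δ)) * a ≡⟨ cong (_* a) (^-*-assoc 2 (ℓ * κ) (4 * Δ)) ⟨
        p ^ (4 * Δ) * a ∎
        where
        expo : 2 * Δ * (ℓ * (κ + 1)) ≤ ℓ * κ * (4 * Δ)
        expo = begin
          2 * Δ * (ℓ * (κ + 1)) ≤⟨ *-monoʳ-≤ (2 * Δ) (*-monoʳ-≤ ℓ (+-monoʳ-≤ κ 1≤κ)) ⟩
          2 * Δ * (ℓ * (κ + κ)) ≡⟨ ((∀ d l k → 2 * d * (l * (k + k)) ≡ l * k * (4 * d)) ∋ solve-∀) Δ ℓ κ ⟩
          ℓ * κ * (4 * Δ) ∎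
      -- The 6Δ of `few` is spent here: p^(4Δ) pays for `loss`, and the remaining p^(2Δ) ≥ p² pays
      -- for the density of v and for 8L ≤ p.
      small : 4 * (L * (C * p ^ (4 * Δ))) ≤ e
      small = *-cancelʳ-≤ (4 * (L * (C * p ^ (4 * Δ)))) e (p ^ (2 * Δ)) {{>-nonZero (1≤^ (2 * Δ) 1≤p)}} (begin
        4 * (L * (C * p ^ (4 * Δ))) * p ^ (2 * Δ) ≡⟨ ((∀ L C x y → 4 * (L * (C * x)) * y ≡ 4 * (L * (C * (x * y)))) ∋ solve-∀) L C (p ^ (4 * Δ)) (p ^ (2 * Δ)) ⟩
        4 * (L * (C * (p ^ (4 * Δ) * p ^ (2 * Δ)))) ≡⟨ cong (λ t → 4 * (L * (C * t))) (trans (sym (^-distribˡ-+-* p (4 * Δ) (2 * Δ))) (cong (p ^_) (((∀ d → 4 * d + 2 * d ≡ 6 * d) ∋ solve-∀) Δ))) ⟩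
        4 * (L * (C * p ^ (6 * Δ))) ≤⟨ *-monoʳ-≤ 4 (*-monoʳ-≤ L (≤-trans few' S≤2ep)) ⟩
        4 * (L * (2 * (e * p))) ≡⟨ ((∀ L e p → 4 * (L * (2 * (e * p))) ≡ 8 * L * (e * p)) ∋ solve-∀) L e p ⟩
        8 * L * (e * p) ≤⟨ *-monoˡ-≤ (e * p) (≤-trans 8L≤ q≤p) ⟩
        p * (e * p) ≡⟨ ((∀ e p → p * (e * p) ≡ e * (p * p)) ∋ solve-∀) e p ⟩
        e * (p * p) ≤⟨ *-monoʳ-≤ e (pp≤ 2 (s≤s (s≤s z≤n))) ⟩
        e * p ^ (2 * Δ) ∎)
      below : 4 * (L * (C * E ^ T)) ≤ e * a
      below = begin
        4 * (L * (C * E ^ T)) ≤⟨ *-monoʳ-≤ 4 (*-monoʳ-≤ L (*-monoʳ-≤ C loss)) ⟩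
        4 * (L * (C * (p ^ (4 * Δ) * a))) ≡⟨ ((∀ L C x a → 4 * (L * (C * (x * a))) ≡ 4 * (L * (C * x)) * a) ∋ solve-∀) L C (p ^ (4 * Δ)) a ⟩
        4 * (L * (C * p ^ (4 * Δ))) * a ≤⟨ *-monoˡ-≤ a small ⟩
        e * a ∎
      1≤a : 1 ≤ a
      1≤a = 1≤^ T (subst (1 ≤_) step (s≤s z≤n))
      D≤ : D ≤ 2 ^ (3 * T) * a
      D≤ = begin
        (4 * E) ^ T ≤⟨ ^-monoˡ-≤ T (*-monoʳ-≤ 4 E≤) ⟩
        (4 * (2 * (E ∸ v))) ^ T ≡⟨ cong (_^ T) (*-assoc 4 2 (E ∸ v)) ⟨
        (8 * (E ∸ v)) ^ T ≡⟨ ^-distrib-* 8 (E ∸ v) T ⟩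
        8 ^ T * a ≡⟨ cong (_* a) (^-*-assoc 2 3 T) ⟩
        2 ^ (3 * T) * a ∎
        where
        E≤ : E ≤ 2 * (E ∸ v)
        E≤ = begin
          E ≡⟨ m+n∸n≡m E E ⟨
          (E + E) ∸ E ≤⟨ ∸-monoʳ-≤ (E + E) (≤-trans (*-monoʳ-≤ 2 v≤Δ) 2Δ≤E) ⟩
          (E + E) ∸ 2 * v ≡⟨ cong (_∸ 2 * v) (((∀ x → x + x ≡ 2 * x) ∋ solve-∀) E) ⟩
          2 * E ∸ 2 * v ≡⟨ *-distribˡ-∸ 2 E v ⟨
          2 * (E ∸ v) ∎

    module _ {G B good bad : ℕ} (G≡ : G ≡ e * a) (B≤ : B ≤ C * E ^ T + S * b) (h : G + L * (bad * D) ≤ good * D + L * B) where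
      private
        -- `below` and `above` each cap their share of L * B by a quarter of e * a, so half of the
        -- weight of v survives.
        advantage : e * a + 2 * (L * bad) * D ≤ 2 * (good * D)
        advantage = *-cancelˡ-≤ 2 (+-cancelʳ-≤ (2 * (e * a)) (2 * (e * a + 2 * (L * bad) * D)) (2 * (2 * (good * D))) (begin
          2 * (e * a + 2 * (L * bad) * D) + 2 * (e * a) ≡⟨ ((∀ x L b D → 2 * (x + 2 * (L * b) * D) + 2 * x ≡ 4 * (x + L * (b * D))) ∋ solve-∀) (e * a) L bad D ⟩
          4 * (e * a + L * (bad * D)) ≡⟨ cong (λ t → 4 * (t + L * (bad * D))) G≡ ⟨
          4 * (G + L * (bad * D)) ≤⟨ *-monoʳ-≤ 4 (≤-trans h (+-monoʳ-≤ (good * D) (*-monoʳ-≤ L B≤))) ⟩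
          4 * (good * D + L * (C * E ^ T + S * b)) ≡⟨ ((∀ g D L x y → 4 * (g * D + L * (x + y)) ≡ 4 * (g * D) + (4 * (L * x) + 4 * (L * y))) ∋ solve-∀) good D L (C * E ^ T) (S * b) ⟩
          4 * (good * D) + (4 * (L * (C * E ^ T)) + 4 * (L * (S * b))) ≤⟨ +-monoʳ-≤ (4 * (good * D)) (+-mono-≤ below above) ⟩
          4 * (good * D) + (e * a + e * a) ≡⟨ ((∀ g x → 4 * g + (x + x) ≡ 2 * (2 * g) + 2 * x) ∋ solve-∀) (good * D) (e * a) ⟩
          2 * (2 * (good * D)) + 2 * (e * a) ∎))

      mostly-good : L * bad < good
      mostly-good = *-cancelʳ-< D (L * bad) good (*-cancelˡ-< 2 (L * bad * D) (good * D) (begin-strict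
        2 * (L * bad * D) ≡⟨ *-assoc 2 (L * bad) D ⟨
        2 * (L * bad) * D <⟨ +-monoˡ-≤ (2 * (L * bad) * D) (*-mono-≤ 1≤e 1≤a) ⟩
        e * a + 2 * (L * bad) * D ≤⟨ advantage ⟩
        2 * (good * D) ∎))

      large : S ≤ 2 ^ (3 * T + ℓ * κ + 2) * good
      large = begin
        S ≤⟨ S≤2ep ⟩
        2 * (e * p) ≤⟨ *-monoʳ-≤ 2 (*-monoˡ-≤ p e≤) ⟩
        2 * (2 * (good * 2 ^ (3 * T)) * p) ≡⟨ ((∀ g x p → 2 * (2 * (g * x) * p) ≡ x * p * 4 * g) ∋ solve-∀) good (2 ^ (3 * T)) p ⟩
        2 ^ (3 * T) * p * 4 * good ≡⟨ cong (_* good) (trans (cong (_* 4) (sym (^-distribˡ-+-* 2 (3 * T) (ℓ * κ)))) (sym (^-distribˡ-+-* 2 (3 * T + ℓ * κ) 2))) ⟩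
        2 ^ (3 * T + ℓ * κ + 2) * good ∎
        where
        e≤ : e ≤ 2 * (good * 2 ^ (3 * T))
        e≤ = *-cancelʳ-≤ e (2 * (good * 2 ^ (3 * T))) a {{>-nonZero 1≤a}} (begin
          e * a ≤⟨ m≤m+n (e * a) (2 * (L * bad) * D) ⟩
          e * a + 2 * (L * bad) * D ≤⟨ advantage ⟩
          2 * (good * D) ≤⟨ *-monoʳ-≤ 2 (*-monoʳ-≤ good D≤) ⟩
          2 * (good * (2 ^ (3 * T) * a)) ≡⟨ ((∀ g x a → 2 * (g * (x * a)) ≡ 2 * (g * x) * a) ∋ solve-∀) good (2 ^ (3 * T)) a ⟩
          2 * (good * 2 ^ (3 * T)) * a ∎)

-- Sums over lists of naturals and filtered lists.

module Sums where
  open Counting using (∑ℕ; ∑ℕ²; ι)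
  open import Data.Nat
  open import Data.Nat.Properties
  open import Data.Nat.Tactic.RingSolver using (solve-∀)
  open import Data.Bool using (T)

  private variable
    A B : Set

  ∑ℕ-mono∈ : ∀ (xs : List A) {g h : A → ℕ} → (∀ {x} → x ∈ xs → g x ≤ h x) → ∑ℕ xs g ≤ ∑ℕ xs h
  ∑ℕ-mono∈ [] e = z≤n
  ∑ℕ-mono∈ (x ∷ xs) e = +-mono-≤ (e (here refl)) (∑ℕ-mono∈ xs (e ∘ there))

  ∑ℕ-cong : ∀ (xs : List A) {g h : A → ℕ} → (∀ x → g x ≡ h x) → ∑ℕ xs g ≡ ∑ℕ xs h
  ∑ℕ-cong [] e = refl
  ∑ℕ-cong (x ∷ xs) e = cong₂ _+_ (e x) (∑ℕ-cong xs e)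

  ∑ℕ-+ : ∀ (xs : List A) (g h : A → ℕ) → ∑ℕ xs (λ x → g x + h x) ≡ ∑ℕ xs g + ∑ℕ xs h
  ∑ℕ-+ [] g h = refl
  ∑ℕ-+ (x ∷ xs) g h = trans (cong (g x + h x +_) (∑ℕ-+ xs g h)) (((∀ a b c d → a + b + (c + d) ≡ a + c + (b + d)) ∋ solve-∀) (g x) (h x) (∑ℕ xs g) (∑ℕ xs h))

  ∑ℕ-*ʳ : ∀ (xs : List A) (g : A → ℕ) c → ∑ℕ xs (λ x → g x * c) ≡ ∑ℕ xs g * c
  ∑ℕ-*ʳ [] g c = refl
  ∑ℕ-*ʳ (x ∷ xs) g c = trans (cong (g x * c +_) (∑ℕ-*ʳ xs g c)) (sym (*-distribʳ-+ c (g x) (∑ℕ xs g)))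

  ∑ℕ-*ˡ : ∀ (xs : List A) c (g : A → ℕ) → ∑ℕ xs (λ x → c * g x) ≡ c * ∑ℕ xs g
  ∑ℕ-*ˡ xs c g = trans (∑ℕ-cong xs (λ x → *-comm c (g x))) (trans (∑ℕ-*ʳ xs g c) (*-comm (∑ℕ xs g) c))

  ∑ℕ-const : ∀ (xs : List A) c → ∑ℕ xs (λ _ → c) ≡ length xs * c
  ∑ℕ-const [] c = refl
  ∑ℕ-const (x ∷ xs) c = cong (c +_) (∑ℕ-const xs c)

  ∑ℕ-swap : ∀ (X : List A) (Y : List B) (h : A → B → ℕ) → ∑ℕ X (λ a → ∑ℕ Y (h a)) ≡ ∑ℕ Y (λ b → ∑ℕ X (λ a → h a b))
  ∑ℕ-swap [] Y h = sym (trans (∑ℕ-const Y 0) (*-zeroʳ (length Y)))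
  ∑ℕ-swap (a ∷ X) Y h = trans (cong (∑ℕ Y (h a) +_) (∑ℕ-swap X Y h)) (sym (∑ℕ-+ Y (h a) (λ b → ∑ℕ X (λ a → h a b))))

  ∑ℕ-filter : ∀ (p : A → Bool) (xs : List A) (g : A → ℕ) → ∑ℕ xs (λ x → ι (p x) * g x) ≡ ∑ℕ (filterᵇ p xs) g
  ∑ℕ-filter p [] g = refl
  ∑ℕ-filter p (x ∷ xs) g with p x
  ... | true = cong₂ _+_ (+-identityʳ (g x)) (∑ℕ-filter p xs g)
  ... | false = ∑ℕ-filter p xs g

  length-filter : ∀ (p : A → Bool) (xs : List A) → length (filterᵇ p xs) ≡ ∑ℕ xs (ι ∘ p)
  length-filter p [] = refl
  length-filter p (x ∷ xs) with p x
  ... | true = cong suc (length-filter p xs)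
  ... | false = length-filter p xs

  length-filter-not : ∀ (p : A → Bool) (xs : List A) → length (filterᵇ p xs) + length (filterᵇ (not ∘ p) xs) ≡ length xs
  length-filter-not p [] = refl
  length-filter-not p (x ∷ xs) with p x
  ... | true = cong suc (length-filter-not p xs)
  ... | false = trans (+-suc _ _) (cong suc (length-filter-not p xs))

  filter-∧ : ∀ (p q : A → Bool) (xs : List A) → filterᵇ (λ x → p x ∧ q x) xs ≡ filterᵇ q (filterᵇ p xs)
  filter-∧ p q [] = refl
  filter-∧ p q (x ∷ xs) with p x
  ... | false = filter-∧ p q xs
  ... | true with q x
  ...   | true = cong (x ∷_) (filter-∧ p q xs)
  ...   | false = filter-∧ p q xs

  ∈-filter⁻ : ∀ (p : A → Bool) {x} {xs : List A} → x ∈ filterᵇ p xs → x ∈ xs × p x ≡ true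
  ∈-filter⁻ p {xs = y ∷ xs} m with p y in e
  ∈-filter⁻ p {xs = y ∷ xs} (here refl) | true = here refl , e
  ∈-filter⁻ p {xs = y ∷ xs} (there m) | true = let m' , q = ∈-filter⁻ p m in there m' , q
  ∈-filter⁻ p {xs = y ∷ xs} m | false = let m' , q = ∈-filter⁻ p m in there m' , q

  ∈-filter⁺ : ∀ (p : A → Bool) {x} {xs : List A} → x ∈ xs → p x ≡ true → x ∈ filterᵇ p xs
  ∈-filter⁺ p {xs = y ∷ xs} (here refl) e rewrite e = here refl
  ∈-filter⁺ p {xs = y ∷ xs} (there m) e with p y
  ... | true = there (∈-filter⁺ p m e)
  ... | false = ∈-filter⁺ p m e

  all-∈ : ∀ (p : A → Bool) (xs : List A) → all p xs ≡ true → ∀ {x} → x ∈ xs → p x ≡ true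
  all-∈ p (y ∷ xs) e m with p y in e'
  all-∈ p (y ∷ xs) e (here refl) | true = e'
  all-∈ p (y ∷ xs) e (there m) | true = all-∈ p xs e m

  ι-not-all : ∀ (p : A → Bool) (xs : List A) → ι (not (all p xs)) ≤ ∑ℕ xs (λ x → ι (not (p x)))
  ι-not-all p [] = z≤n
  ι-not-all p (x ∷ xs) with p x
  ... | true = ι-not-all p xs
  ... | false = s≤s z≤n

  ι-<ᵇ-suc : ∀ n v → ι (n <ᵇ suc v) ≡ ι (n <ᵇ v) + ι (n ≡ᵇ v)
  ι-<ᵇ-suc zero zero = refl
  ι-<ᵇ-suc zero (suc v) = refl
  ι-<ᵇ-suc (suc n) zero = refl
  ι-<ᵇ-suc (suc n) (suc v) = ι-<ᵇ-suc n v

  ι-eq-* : ∀ n v (g : ℕ → ℕ) → ι (n ≡ᵇ v) * g n ≡ ι (n ≡ᵇ v) * g v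
  ι-eq-* n v g with n ≡ᵇ v in e
  ... | true = cong (λ t → g t + 0) (≡ᵇ⇒≡ n v (subst T (sym e) tt))
  ... | false = refl

  -- Entries below v are charged as if undamped, to be outweighed by rarity; those above are at
  -- least v + 1, to be outweighed by damping.
  ι-≢-bound : ∀ n v E t → ι (not (n ≡ᵇ v)) * (E ∸ n) ^ t ≤ ι (n <ᵇ v) * E ^ t + (E ∸ suc v) ^ t
  ι-≢-bound n v E t with n <ᵇ v in e₁ | n ≡ᵇ v in e₂
  ... | _ | true = z≤n
  ... | true | false = ≤-trans (+-monoˡ-≤ 0 (^-monoˡ-≤ t (m∸n≤m E n))) (m≤m+n _ _)
  ... | false | false = ≤-trans (≤-reflexive (+-identityʳ _)) (^-monoˡ-≤ t (∸-monoʳ-≤ E (≤∧≢⇒< (≮⇒≥ (λ n<v → subst T e₁ (<⇒<ᵇ n<v))) (λ v≡n → subst T e₂ (≡⇒≡ᵇ n v (sym v≡n))))))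

  ∑ℕ²-mono∈ : ∀ (X : List A) (Y : List B) {g h : A → B → ℕ} → (∀ {a b} → a ∈ X → b ∈ Y → g a b ≤ h a b) → ∑ℕ² X Y g ≤ ∑ℕ² X Y h
  ∑ℕ²-mono∈ X Y e = ∑ℕ-mono∈ X (λ m → ∑ℕ-mono∈ Y (e m))

  ∑ℕ²-cong : ∀ (X : List A) (Y : List B) {g h : A → B → ℕ} → (∀ a b → g a b ≡ h a b) → ∑ℕ² X Y g ≡ ∑ℕ² X Y h
  ∑ℕ²-cong X Y e = ∑ℕ-cong X (λ a → ∑ℕ-cong Y (e a))

  ∑ℕ²-+ : ∀ (X : List A) (Y : List B) (g h : A → B → ℕ) → ∑ℕ² X Y (λ a b → g a b + h a b) ≡ ∑ℕ² X Y g + ∑ℕ² X Y h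
  ∑ℕ²-+ X Y g h = trans (∑ℕ-cong X (λ a → ∑ℕ-+ Y (g a) (h a))) (∑ℕ-+ X (λ a → ∑ℕ Y (g a)) (λ a → ∑ℕ Y (h a)))

  ∑ℕ²-*ʳ : ∀ (X : List A) (Y : List B) (g : A → B → ℕ) c → ∑ℕ² X Y (λ a b → g a b * c) ≡ ∑ℕ² X Y g * c
  ∑ℕ²-*ʳ X Y g c = trans (∑ℕ-cong X (λ a → ∑ℕ-*ʳ Y (g a) c)) (∑ℕ-*ʳ X (λ a → ∑ℕ Y (g a)) c)

  ∑ℕ²-const : ∀ (X : List A) (Y : List B) c → ∑ℕ² X Y (λ _ _ → c) ≡ length X * length Y * c
  ∑ℕ²-const X Y c = trans (∑ℕ-cong X (λ _ → ∑ℕ-const Y c)) (trans (∑ℕ-const X (length Y * c)) (sym (*-assoc (length X) (length Y) c)))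

  ∑ℕ²-filter : ∀ (x : A → Bool) (y : B → Bool) (X : List A) (Y : List B) (g : A → B → ℕ) →
    ∑ℕ² X Y (λ a b → ι (x a ∧ y b) * g a b) ≡ ∑ℕ² (filterᵇ x X) (filterᵇ y Y) g
  ∑ℕ²-filter x y X Y g = trans (∑ℕ-cong X (λ a → trans (∑ℕ-cong Y (λ b → split (x a) (y b) (g a b)))
      (trans (∑ℕ-*ˡ Y (ι (x a)) (λ b → ι (y b) * g a b)) (cong (ι (x a) *_) (∑ℕ-filter y Y (g a))))))
    (∑ℕ-filter x X (λ a → ∑ℕ (filterᵇ y Y) (g a)))
    where
    split : ∀ p q n → ι (p ∧ q) * n ≡ ι p * (ι q * n)
    split true q n = sym (+-identityʳ (ι q * n))
    split false q n = refl

-- Large monochromatic rectangles.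

module Mono where
  open Rationals
  open Linear
  open Vectors using (basis-expand)
  open Counting using (∑ℕ; ∑ℕ²; ι)
  open Sums
  open Rectangle using (inside; weighted-rectangle)
  open Core
  open import Data.Nat
  open import Data.Nat.Properties
  open import Data.Nat.Tactic.RingSolver using (solve-∀)
  open import Data.Bool using (T)
  import Data.Rational as ℚ
  import Data.Rational.Properties as ℚP
  import Tactic.RingSolver as R

  private variable
    A B : Set

  _⟪_⟫ : List A → (A → Bool) → List A
  xs ⟪ p ⟫ = filterᵇ p xs

  Monochromatic : (A → B → ℕ) → List A → List B → ℕ → Set
  Monochromatic f X Y v = ∀ {a b} → a ∈ X → b ∈ Y → f a b ≡ v

  ≡ᵇ-true : ∀ {n v} → (n ≡ᵇ v) ≡ true → n ≡ v
  ≡ᵇ-true {n} {v} e = ≡ᵇ⇒≡ n v (subst T (sym e) tt)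

  shift-rank : ∀ {k} {X : List A} {Y : List B} (f : A → B → ℕ) v → FactorsOn X Y (λ a b → ℕ→ℚ (f a b)) k →
    FactorsOn X Y (λ a b → ℕ→ℚ (f a b) ℚ.- ℕ→ℚ v) (suc k)
  shift-rank {k = k} f v (U , V , h) = (λ a → ℚ.- ℕ→ℚ v ◂ U a) , (λ b → ℚ.1ℚ ◂ V b) , λ {a} {b} m n →
    trans (cong (ℚ._- ℕ→ℚ v) (h m n)) (((∀ s w → s ℚ.- w ≡ (ℚ.- w) ℚ.* ℚ.1ℚ ℚ.+ s) ∋ R.solve-∀ ℚ-ring) (sumℚ k (λ i → U a i ℚ.* V b i)) (ℕ→ℚ v))

  FactorsOn-⊆ : ∀ {k} {X X' : List A} {Y Y' : List B} {g : A → B → ℚ.ℚ} → (∀ {a} → a ∈ X' → a ∈ X) → (∀ {b} → b ∈ Y' → b ∈ Y) → FactorsOn X Y g k → FactorsOn X' Y' g k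
  FactorsOn-⊆ p q (U , V , h) = U , V , λ m n → h (p m) (q n)

  -- Rows with few bad entries form at least half of the rectangle; on the
  -- columns where a basis of these rows is good, all of them are.
  purify : ∀ {k} {X : List A} {Y : List B} (f : A → B → ℕ) v → FactorsOn X Y (λ a b → ℕ→ℚ (f a b)) k →
    4 * suc k * ∑ℕ² X Y (λ a b → ι (not (f a b ≡ᵇ v))) < length X * length Y →
    Σ (A → Bool) λ x → Σ (B → Bool) λ y → Monochromatic f (X ⟪ x ⟫) (Y ⟪ y ⟫) v × length X * length Y ≤ 4 * (length (X ⟪ x ⟫) * length (Y ⟪ y ⟫))
  purify {A} {B} {k} {X} {Y} f v fac few = x , y , mono , (begin
      length X * length Y ≤⟨ *-mono-≤ rows columns ⟩
      2 * length X' * (2 * length Y') ≡⟨ ((∀ p q → 2 * p * (2 * q) ≡ 4 * (p * q)) ∋ solve-∀) (length X') (length Y') ⟩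
      4 * (length X' * length Y') ∎)
    where
    open ≤-Reasoning
    L = 4 * suc k
    bad : A → B → Bool
    bad a b = not (f a b ≡ᵇ v)
    badness : A → ℕ
    badness a = ∑ℕ Y (λ b → ι (bad a b))
    x : A → Bool
    -- By Markov's inequality at most half of the rows fail this. At most k + 1 basis rows passing
    -- it spoil at most (k + 1) · 2|Y|/L = |Y|/2 columns.
    x a = L * badness a ≤ᵇ 2 * length Y
    X' = X ⟪ x ⟫
    X'' = X ⟪ not ∘ x ⟫
    heavy : ∀ {a} → a ∈ X'' → 2 * length Y ≤ L * badness a
    heavy {a} m = h (x a) refl (proj₂ (∈-filter⁻ (not ∘ x) {xs = X} m))
      where
      h : ∀ t → x a ≡ t → not (x a) ≡ true → 2 * length Y ≤ L * badness a
      h false e _ = <⇒≤ (≰⇒> (λ le → subst T e (≤⇒≤ᵇ le)))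
      h true e q with trans (sym q) (cong not e)
      ... | ()
    light : ∀ {a} → a ∈ X' → L * badness a ≤ 2 * length Y
    light {a} m = ≤ᵇ⇒≤ (L * badness a) (2 * length Y) (subst T (sym (proj₂ (∈-filter⁻ x {xs = X} m))) tt)
    2X''< : 2 * length X'' * length Y < length X * length Y
    2X''< = begin-strict
      2 * length X'' * length Y ≡⟨ ((∀ p q → 2 * p * q ≡ p * (2 * q)) ∋ solve-∀) (length X'') (length Y) ⟩
      length X'' * (2 * length Y) ≡⟨ ∑ℕ-const X'' (2 * length Y) ⟨
      ∑ℕ X'' (λ _ → 2 * length Y) ≤⟨ ∑ℕ-mono∈ X'' heavy ⟩
      ∑ℕ X'' (λ a → L * badness a) ≡⟨ ∑ℕ-filter (not ∘ x) X (λ a → L * badness a) ⟨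
      ∑ℕ X (λ a → ι (not (x a)) * (L * badness a)) ≤⟨ ∑ℕ-mono∈ X (λ {a} _ → ι≤ (not (x a)) (L * badness a)) ⟩
      ∑ℕ X (λ a → L * badness a) ≡⟨ ∑ℕ-*ˡ X L badness ⟩
      L * ∑ℕ X badness <⟨ few ⟩
      length X * length Y ∎
      where
      ι≤ : ∀ t n → ι t * n ≤ n
      ι≤ true n = ≤-reflexive (+-identityʳ n)
      ι≤ false n = z≤n
    rows : length X ≤ 2 * length X'
    rows = +-cancelʳ-≤ (2 * length X'') (length X) (2 * length X') (begin
      length X + 2 * length X'' ≤⟨ +-monoʳ-≤ (length X) (<⇒≤ (*-cancelʳ-< (length Y) (2 * length X'') (length X) 2X''<)) ⟩
      length X + length X ≡⟨ cong (λ t → t + t) (length-filter-not x X) ⟨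
      (length X' + length X'') + (length X' + length X'') ≡⟨ ((∀ p q → (p + q) + (p + q) ≡ 2 * p + 2 * q) ∋ solve-∀) (length X') (length X'') ⟩
      2 * length X' + 2 * length X'' ∎)
    fac' : FactorsOn X' Y (λ a b → ℕ→ℚ (f a b) ℚ.- ℕ→ℚ v) (suc k)
    fac' = FactorsOn-⊆ {X = X} {X' = X'} {Y = Y} {Y' = Y} (λ m → proj₁ (∈-filter⁻ x m)) (λ m → m) (shift-rank {X = X} {Y = Y} f v fac)
    bs : Basis (suc k) X' (proj₁ fac')
    bs = basis (suc k) X' (proj₁ fac')
    open Basis bs
    es : List A
    es = tabulate e
    y : B → Bool
    y b = all (λ a → f a b ≡ᵇ v) es
    Y' = Y ⟪ y ⟫
    Y'' = Y ⟪ not ∘ y ⟫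
    es-light : ∀ {a} → a ∈ es → L * badness a ≤ 2 * length Y
    es-light m = let j , eq = ∈-tabulate⁻ {f = e} m in subst (λ a → L * badness a ≤ 2 * length Y) (sym eq) (light (e∈ j))
    removed : L * length Y'' ≤ suc k * (2 * length Y)
    removed = begin
      L * length Y'' ≡⟨ cong (L *_) (length-filter (not ∘ y) Y) ⟩
      L * ∑ℕ Y (λ b → ι (not (y b))) ≤⟨ *-monoʳ-≤ L (∑ℕ-mono∈ Y (λ {b} _ → ι-not-all (λ a → f a b ≡ᵇ v) es)) ⟩
      L * ∑ℕ Y (λ b → ∑ℕ es (λ a → ι (bad a b))) ≡⟨ cong (L *_) (∑ℕ-swap Y es (λ b a → ι (bad a b))) ⟩
      L * ∑ℕ es badness ≡⟨ ∑ℕ-*ˡ es L badness ⟨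
      ∑ℕ es (λ a → L * badness a) ≤⟨ ∑ℕ-mono∈ es es-light ⟩
      ∑ℕ es (λ _ → 2 * length Y) ≡⟨ ∑ℕ-const es (2 * length Y) ⟩
      length es * (2 * length Y) ≤⟨ *-monoˡ-≤ (2 * length Y) (≤-trans (≤-reflexive (length-tabulate e)) dim≤) ⟩
      suc k * (2 * length Y) ∎
    2Y''≤ : 2 * length Y'' ≤ length Y
    2Y''≤ = *-cancelˡ-≤ (2 * suc k) (begin
      2 * suc k * (2 * length Y'') ≡⟨ ((∀ k y → 2 * k * (2 * y) ≡ 4 * k * y) ∋ solve-∀) (suc k) (length Y'') ⟩
      L * length Y'' ≤⟨ removed ⟩
      suc k * (2 * length Y) ≡⟨ ((∀ k y → k * (2 * y) ≡ 2 * k * y) ∋ solve-∀) (suc k) (length Y) ⟩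
      2 * suc k * length Y ∎)
    columns : length Y ≤ 2 * length Y'
    columns = +-cancelʳ-≤ (2 * length Y'') (length Y) (2 * length Y') (begin
      length Y + 2 * length Y'' ≤⟨ +-monoʳ-≤ (length Y) 2Y''≤ ⟩
      length Y + length Y ≡⟨ cong (λ t → t + t) (length-filter-not y Y) ⟨
      (length Y' + length Y'') + (length Y' + length Y'') ≡⟨ ((∀ p q → (p + q) + (p + q) ≡ 2 * p + 2 * q) ∋ solve-∀) (length Y') (length Y'') ⟩
      2 * length Y' + 2 * length Y'' ∎)
    mono : Monochromatic f X' Y' v
    mono {a} {b} m n = ≤-antisym (ℕ→ℚ-cancel (ℚP.≤-reflexive eq)) (ℕ→ℚ-cancel (ℚP.≤-reflexive (sym eq)))
      where
      b∈ = proj₁ (∈-filter⁻ y {xs = Y} n)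
      good : ∀ j → f (e j) b ≡ v
      good j = ≡ᵇ-true (all-∈ (λ a → f a b ≡ᵇ v) es (proj₂ (∈-filter⁻ y {xs = Y} n)) (∈-tabulate⁺ {f = e} j))
      zero-difference : ℕ→ℚ (f a b) ℚ.- ℕ→ℚ v ≡ ℚ.0ℚ
      zero-difference = trans (basis-expand {X = X'} {Y = Y} fac' bs m b∈)
        (S-0 dim (λ j → trans (cong (λ t → W a j ℚ.* (ℕ→ℚ t ℚ.- ℕ→ℚ v)) (good j)) (((∀ w v → w ℚ.* (v ℚ.- v) ≡ ℚ.0ℚ) ∋ R.solve-∀ ℚ-ring) (W a j) (ℕ→ℚ v))))
      eq : ℕ→ℚ (f a b) ≡ ℕ→ℚ v
      eq = trans (((∀ x v → x ≡ (x ℚ.- v) ℚ.+ v) ∋ R.solve-∀ ℚ-ring) (ℕ→ℚ (f a b)) (ℕ→ℚ v)) (trans (cong (ℚ._+ ℕ→ℚ v) zero-difference) (ℚP.+-identityˡ (ℕ→ℚ v)))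

  -- The largest κ that can occur, reached when the jump is at v = 0.
  κmax : ℕ → ℕ
  κmax Δ = (6 * Δ) ^ Δ

  -- The exponent of `large` at the largest κ, plus 2 for the factor 4 lost in `purify`.
  density : (Δ s ℓ : ℕ) → ℕ
  density Δ s ℓ = 3 * (2 * (257 * s) * Δ * (ℓ * (κmax Δ + 1))) + ℓ * κmax Δ + 4

  LargeMonochromatic : (A → B → ℕ) → List A → List B → ℕ → Set
  LargeMonochromatic {A} {B} f X Y d = Σ ℕ λ v → Σ (A → Bool) λ x → Σ (B → Bool) λ y →
    Monochromatic f (X ⟪ x ⟫) (Y ⟪ y ⟫) v × length X * length Y ≤ 2 ^ d * (length (X ⟪ x ⟫) * length (Y ⟪ y ⟫))

  -- The value v is chosen where the number C v of entries below v jumps: the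
  -- entries below v are then so rare, and those above v so damped, that neither
  -- outweighs the entries equal to v when weighted by the T-th power of (E - f).
  large-monochromatic : ∀ {m n} (f : Fin m → Fin n → ℕ) (X : List (Fin m)) (Y : List (Fin n)) (Δ s k ℓ : ℕ) → 1 ≤ Δ → 1 ≤ s → 1 ≤ ℓ →
    (∀ {a b} → a ∈ X → b ∈ Y → f a b ≤ Δ) → 2 * k ≤ s * s → 8 * (4 * suc k) ≤ 2 ^ ℓ → FactorsOn X Y (λ a b → ℕ→ℚ (f a b)) k →
    1 ≤ length X * length Y → LargeMonochromatic f X Y (density Δ s ℓ)
  large-monochromatic {m} {n} f X Y Δ s k ℓ 1≤Δ 1≤s 1≤ℓ f≤ 2k≤ 8L≤ fac 1≤S =
    level (find-step Q (λ v → C v * 2 ^ (ℓ * κf v) ≤? S) q₀ (suc Δ) ¬qₙ)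
    where
    open ≤-Reasoning
    S L : ℕ
    S = length X * length Y
    L = 4 * suc k
    C κf : ℕ → ℕ
    C v = ∑ℕ² X Y (λ a b → ι (f a b <ᵇ v))
    -- Lowering v by one multiplies the exponent by 6Δ, so that Q at v and its failure at v + 1 are
    -- precisely `few` and `many`. At Δ + 1 the exponent is still 1, and Q fails there because all
    -- entries are counted.
    κf v = (6 * Δ) ^ (suc Δ ∸ v)
    Q : ℕ → Set
    Q v = C v * 2 ^ (ℓ * κf v) ≤ S
    6Δ≢0 : NonZero (6 * Δ)
    6Δ≢0 = >-nonZero (≤-trans 1≤Δ (m≤n*m Δ 6))
    q₀ : Q 0
    q₀ = subst (λ t → t * 2 ^ (ℓ * κf 0) ≤ S) (sym (trans (∑ℕ²-const X Y 0) (*-zeroʳ (length X * length Y)))) z≤n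
    S≤C : S ≤ C (suc Δ)
    S≤C = begin
      S ≡⟨ *-identityʳ S ⟨
      S * 1 ≡⟨ ∑ℕ²-const X Y 1 ⟨
      ∑ℕ² X Y (λ _ _ → 1) ≤⟨ ∑ℕ²-mono∈ X Y (λ {a} {b} p q → ι-T (f a b <ᵇ suc Δ) (<⇒<ᵇ (s≤s (f≤ p q)))) ⟩
      C (suc Δ) ∎
      where
      ι-T : ∀ t → T t → 1 ≤ ι t
      ι-T true _ = ≤-refl
    ¬qₙ : ¬ Q (suc Δ)
    ¬qₙ q = <-irrefl refl (begin-strict
      S <⟨ m<m+n S (subst (0 <_) (sym (+-identityʳ S)) 1≤S) ⟩
      2 * S ≡⟨ *-comm 2 S ⟩
      S * 2 ≤⟨ *-mono-≤ S≤C (^-monoʳ-≤ 2 {1} (≤-trans 1≤ℓ (≤-trans (≤-reflexive (sym (*-identityʳ ℓ))) (*-monoʳ-≤ ℓ (1≤^ (suc Δ ∸ suc Δ) (>-nonZero⁻¹ (6 * Δ) {{6Δ≢0}}))))) ) ⟩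
      C (suc Δ) * 2 ^ (ℓ * κf (suc Δ)) ≤⟨ q ⟩
      S ∎)
    level : (∃ λ v → v < suc Δ × Q v × ¬ Q (suc v)) → LargeMonochromatic f X Y (density Δ s ℓ)
    level (v , s≤s v≤Δ , q , ¬q) = rectangle (subst Weighted E≡ (weighted-rectangle f X Y Δ s k 1≤Δ 1≤s f≤ 2k≤ fac v L T'))
      where
      κ E T' e : ℕ
      κ = κf (suc v)
      E = 2 * (257 * s) * Δ
      T' = E * (ℓ * (κ + 1))
      e = ∑ℕ² X Y (λ a b → ι (f a b ≡ᵇ v))
      eq bad : Fin m → Fin n → Bool
      eq a b = f a b ≡ᵇ v
      bad a b = not (f a b ≡ᵇ v)
      E≡ : 514 * (s * Δ) ≡ E
      E≡ = trans (sym (*-assoc 514 s Δ)) (cong (_* Δ) (*-assoc 2 257 s))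
      Weighted : ℕ → Set
      Weighted E = Σ (Fin m → Bool) λ x → Σ (Fin n → Bool) λ y →
        ∑ℕ² X Y (λ a b → ι (eq a b) * (E ∸ f a b) ^ T') + L * (inside f X Y x y bad * (4 * E) ^ T')
        ≤ inside f X Y x y eq * (4 * E) ^ T' + L * ∑ℕ² X Y (λ a b → ι (bad a b) * (E ∸ f a b) ^ T')
      few : C v * 2 ^ (ℓ * (6 * Δ * κ)) ≤ S
      few = subst (λ t → C v * 2 ^ (ℓ * (6 * Δ) ^ t) ≤ S) (+-∸-assoc 1 v≤Δ) q
      many : S < (C v + e) * 2 ^ (ℓ * κ)
      many = subst (λ t → S < t * 2 ^ (ℓ * κ)) (trans (∑ℕ²-cong X Y (λ a b → ι-<ᵇ-suc (f a b) v)) (∑ℕ²-+ X Y (λ a b → ι (f a b <ᵇ v)) (λ a b → ι (f a b ≡ᵇ v)))) (≰⇒> ¬q)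
      1≤κ : 1 ≤ κ
      1≤κ = 1≤^ (Δ ∸ v) (>-nonZero⁻¹ (6 * Δ) {{6Δ≢0}})
      1≤j : 1 ≤ 257 * s
      1≤j = ≤-trans 1≤s (m≤n*m s 257)
      good≡ : ∑ℕ² X Y (λ a b → ι (eq a b) * (E ∸ f a b) ^ T') ≡ e * (E ∸ v) ^ T'
      good≡ = trans (∑ℕ²-cong X Y (λ a b → ι-eq-* (f a b) v (λ w → (E ∸ w) ^ T'))) (∑ℕ²-*ʳ X Y (λ a b → ι (eq a b)) ((E ∸ v) ^ T'))
      bad≤ : ∑ℕ² X Y (λ a b → ι (bad a b) * (E ∸ f a b) ^ T') ≤ C v * E ^ T' + S * (E ∸ suc v) ^ T'
      bad≤ = ≤-trans (∑ℕ²-mono∈ X Y (λ {a} {b} _ _ → ι-≢-bound (f a b) v E T'))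
        (≤-reflexive (trans (∑ℕ²-+ X Y (λ a b → ι (f a b <ᵇ v) * E ^ T') (λ _ _ → (E ∸ suc v) ^ T'))
          (cong₂ _+_ (∑ℕ²-*ʳ X Y (λ a b → ι (f a b <ᵇ v)) (E ^ T')) (∑ℕ²-const X Y ((E ∸ suc v) ^ T')))))
      rectangle : Weighted E → LargeMonochromatic f X Y (density Δ s ℓ)
      rectangle (x , y , h) = finish (purify {X = X₁} {Y = Y₁} f v
          (FactorsOn-⊆ {X = X} {X' = X₁} {Y = Y} {Y' = Y₁} (λ p → proj₁ (∈-filter⁻ x p)) (λ p → proj₁ (∈-filter⁻ y p)) fac) few-bad)
        where
        X₁ = X ⟪ x ⟫
        Y₁ = Y ⟪ y ⟫
        good-count bad-count : ℕ
        good-count = inside f X Y x y eq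
        bad-count = inside f X Y x y bad
        good≤ : good-count ≤ length X₁ * length Y₁
        good≤ = begin
          good-count ≡⟨ ∑ℕ²-filter x y X Y (λ a b → ι (eq a b)) ⟩
          ∑ℕ² X₁ Y₁ (λ a b → ι (eq a b)) ≤⟨ ∑ℕ²-mono∈ X₁ Y₁ (λ {a} {b} _ _ → ι≤1 (eq a b)) ⟩
          ∑ℕ² X₁ Y₁ (λ _ _ → 1) ≡⟨ trans (∑ℕ²-const X₁ Y₁ 1) (*-identityʳ (length X₁ * length Y₁)) ⟩
          length X₁ * length Y₁ ∎
          where
          ι≤1 : ∀ t → ι t ≤ 1
          ι≤1 true = ≤-refl
          ι≤1 false = z≤n
        few-bad : L * ∑ℕ² X₁ Y₁ (λ a b → ι (bad a b)) < length X₁ * length Y₁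
        few-bad = subst (λ t → L * t < length X₁ * length Y₁) (∑ℕ²-filter x y X Y (λ a b → ι (bad a b)))
          (<-≤-trans (mostly-good {S} {C v} {e} {ℓ} {κ} {Δ} {L} {257 * s} {v} 1≤ℓ 1≤κ 1≤Δ 1≤j v≤Δ 8L≤ few many {bad = bad-count} good≡ bad≤ h) good≤)
        finish : (Σ (Fin m → Bool) λ x' → Σ (Fin n → Bool) λ y' → Monochromatic f (X₁ ⟪ x' ⟫) (Y₁ ⟪ y' ⟫) v × length X₁ * length Y₁ ≤ 4 * (length (X₁ ⟪ x' ⟫) * length (Y₁ ⟪ y' ⟫))) →
          LargeMonochromatic f X Y (density Δ s ℓ)
        finish (x' , y' , mono , size) = v , (λ a → x a ∧ x' a) , (λ b → y b ∧ y' b)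
          , subst₂ (λ P Q → Monochromatic f P Q v) (sym (filter-∧ x x' X)) (sym (filter-∧ y y' Y)) mono
          , subst₂ (λ P Q → S ≤ 2 ^ density Δ s ℓ * (length P * length Q)) (sym (filter-∧ x x' X)) (sym (filter-∧ y y' Y)) (begin
            S ≤⟨ large {S} {C v} {e} {ℓ} {κ} {Δ} {L} {257 * s} {v} 1≤ℓ 1≤κ 1≤Δ 1≤j v≤Δ 8L≤ few many {bad = bad-count} good≡ bad≤ h ⟩
            2 ^ (3 * T' + ℓ * κ + 2) * good-count ≤⟨ *-monoʳ-≤ (2 ^ (3 * T' + ℓ * κ + 2)) (≤-trans good≤ size) ⟩
            2 ^ (3 * T' + ℓ * κ + 2) * (4 * R) ≡⟨ trans (sym (*-assoc (2 ^ (3 * T' + ℓ * κ + 2)) 4 R)) (cong (_* R) (trans (sym (^-distribˡ-+-* 2 (3 * T' + ℓ * κ + 2) 2)) (cong (2 ^_) (+-assoc (3 * T' + ℓ * κ) 2 2)))) ⟩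
            2 ^ (3 * T' + ℓ * κ + 4) * R ≤⟨ *-monoˡ-≤ R (^-monoʳ-≤ 2 (+-monoˡ-≤ 4 (+-mono-≤ (*-monoʳ-≤ 3 (*-monoʳ-≤ E (*-monoʳ-≤ ℓ (+-monoˡ-≤ 1 κ≤)))) (*-monoʳ-≤ ℓ κ≤)))) ⟩
            2 ^ density Δ s ℓ * R ∎)
          where
          R = length (X₁ ⟪ x' ⟫) * length (Y₁ ⟪ y' ⟫)
          κ≤ : κ ≤ κmax Δ
          κ≤ = ^-monoʳ-≤ (6 * Δ) {{6Δ≢0}} (m∸n≤m Δ v)

-- Protocols: sending numbers, merging equal rows, small rank.

module Protocols where
  open Rationals
  open Linear
  open Vectors using (basis-expand)
  open Sums
  open Core
  open Mono
  open import Data.Nat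
  open import Data.Nat.Properties
  open import Data.Bool using (T)
  import Data.Rational as ℚ
  import Data.Rational.Properties as ℚP

  private variable
    A B O A' B' : Set

  if-true : ∀ {t} {x y : O} → t ≡ true → (if t then x else y) ≡ x
  if-true refl = refl

  if-false : ∀ {t} {x y : O} → t ≡ false → (if t then x else y) ≡ y
  if-false refl = refl

  mapInputs : (A' → A) → (B' → B) → Protocol A B O → Protocol A' B' O
  mapInputs α β (leaf o) = leaf o
  mapInputs α β (alice g p q) = alice (g ∘ α) (mapInputs α β p) (mapInputs α β q)
  mapInputs α β (bob g p q) = bob (g ∘ β) (mapInputs α β p) (mapInputs α β q)

  run-mapInputs : ∀ (α : A' → A) (β : B' → B) (p : Protocol A B O) a b → run (mapInputs α β p) a b ≡ run p (α a) (β b)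
  run-mapInputs α β (leaf o) a b = refl
  run-mapInputs α β (alice g p q) a b = cong₂ (if g (α a) then_else_) (run-mapInputs α β p a b) (run-mapInputs α β q a b)
  run-mapInputs α β (bob g p q) a b = cong₂ (if g (β b) then_else_) (run-mapInputs α β p a b) (run-mapInputs α β q a b)

  depth-mapInputs : ∀ (α : A' → A) (β : B' → B) (p : Protocol A B O) → depth (mapInputs α β p) ≡ depth p
  depth-mapInputs α β (leaf o) = refl
  depth-mapInputs α β (alice g p q) = cong suc (cong₂ _⊔_ (depth-mapInputs α β p) (depth-mapInputs α β q))
  depth-mapInputs α β (bob g p q) = cong suc (cong₂ _⊔_ (depth-mapInputs α β p) (depth-mapInputs α β q))

  sendA : ℕ → (A → ℕ) → (ℕ → Protocol A B O) → Protocol A B O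
  sendA zero g c = c 0
  sendA (suc l) g c = alice (λ a → g a <ᵇ 2 ^ l) (sendA l g c) (sendA l (λ a → g a ∸ 2 ^ l) (λ i → c (2 ^ l + i)))

  sendB : ℕ → (B → ℕ) → (ℕ → Protocol A B O) → Protocol A B O
  sendB zero g c = c 0
  sendB (suc l) g c = bob (λ b → g b <ᵇ 2 ^ l) (sendB l g c) (sendB l (λ b → g b ∸ 2 ^ l) (λ i → c (2 ^ l + i)))

  private
    <ᵇ-true : ∀ {x y} → (x <ᵇ y) ≡ true → x < y
    <ᵇ-true {x} {y} e = <ᵇ⇒< x y (subst T (sym e) tt)

    <ᵇ-false : ∀ {x y} → (x <ᵇ y) ≡ false → y ≤ x
    <ᵇ-false e = ≮⇒≥ (λ lt → subst T e (<⇒<ᵇ lt))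

    rest< : ∀ {x} l → 2 ^ l ≤ x → x < 2 ^ suc l → x ∸ 2 ^ l < 2 ^ l
    rest< {x} l le lt = +-cancelˡ-< (2 ^ l) (x ∸ 2 ^ l) (2 ^ l) (subst₂ _<_ (sym (m+[n∸m]≡n le)) (cong (2 ^ l +_) (+-identityʳ (2 ^ l))) lt)

  run-sendA : ∀ l (g : A → ℕ) (c : ℕ → Protocol A B O) a b → g a < 2 ^ l → run (sendA l g c) a b ≡ run (c (g a)) a b
  run-sendA zero g c a b (s≤s lt) = cong (λ i → run (c i) a b) (sym (n≤0⇒n≡0 lt))
  run-sendA (suc l) g c a b lt with g a <ᵇ 2 ^ l in e
  ... | true = run-sendA l g c a b (<ᵇ-true e)
  ... | false = trans (run-sendA l (λ a → g a ∸ 2 ^ l) (λ i → c (2 ^ l + i)) a b (rest< l (<ᵇ-false e) lt)) (cong (λ i → run (c i) a b) (m+[n∸m]≡n {2 ^ l} (<ᵇ-false e)))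

  run-sendB : ∀ l (g : B → ℕ) (c : ℕ → Protocol A B O) a b → g b < 2 ^ l → run (sendB l g c) a b ≡ run (c (g b)) a b
  run-sendB zero g c a b (s≤s lt) = cong (λ i → run (c i) a b) (sym (n≤0⇒n≡0 lt))
  run-sendB (suc l) g c a b lt with g b <ᵇ 2 ^ l in e
  ... | true = run-sendB l g c a b (<ᵇ-true e)
  ... | false = trans (run-sendB l (λ b → g b ∸ 2 ^ l) (λ i → c (2 ^ l + i)) a b (rest< l (<ᵇ-false e) lt)) (cong (λ i → run (c i) a b) (m+[n∸m]≡n {2 ^ l} (<ᵇ-false e)))

  depth-sendA : ∀ l (g : A → ℕ) (c : ℕ → Protocol A B O) t → (∀ i → depth (c i) ≤ t) → depth (sendA l g c) ≤ l + t
  depth-sendA zero g c t h = h 0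
  depth-sendA (suc l) g c t h = s≤s (⊔-lub (depth-sendA l g c t h) (depth-sendA l (λ a → g a ∸ 2 ^ l) (λ i → c (2 ^ l + i)) t (λ i → h (2 ^ l + i))))

  depth-sendB : ∀ l (g : B → ℕ) (c : ℕ → Protocol A B O) t → (∀ i → depth (c i) ≤ t) → depth (sendB l g c) ≤ l + t
  depth-sendB zero g c t h = h 0
  depth-sendB (suc l) g c t h = s≤s (⊔-lub (depth-sendB l g c t h) (depth-sendB l (λ b → g b ∸ 2 ^ l) (λ i → c (2 ^ l + i)) t (λ i → h (2 ^ l + i))))

  record Reps (X : List A) (N : ℕ) (_~_ : A → A → Set) : Set where
    field
      list   : List A
      few    : length list ≤ N
      sub    : ∀ {a} → a ∈ list → a ∈ X
      covers : ∀ {a} → a ∈ X → ∃ λ a' → a' ∈ list × a ~ a'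

  Agree : List (A → ℕ) → A → A → Set
  Agree ts a a' = ∀ {t} → t ∈ ts → t a ≡ t a'

  private
    not-true : ∀ {b} → not b ≡ true → ¬ T b
    not-true {false} _ ()

    module _ (Good : A → Set) (t : A → ℕ) {ts : List (A → ℕ)} {N : ℕ} (reps : ∀ X → (∀ {a} → a ∈ X → Good a) → Reps X N (Agree ts)) where
      -- X is split by the values of t, each class getting its own representatives for the remaining
      -- tests; `Good` passes the bounds on those tests to the classes.
      reps-value : ∀ n X → (∀ {a} → a ∈ X → Good a) → (∀ {a} → a ∈ X → t a < n) → Reps X (n * N) (Agree (t ∷ ts))
      reps-value zero X good t< = record { list = [] ; few = z≤n ; sub = λ () ; covers = λ m → ⊥-elim (n≮0 (t< m)) }
      reps-value (suc n) X good t< = record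
        { list = R₁.list ++ R₂.list
        ; few = ≤-trans (≤-reflexive (length-++ R₁.list)) (+-mono-≤ R₁.few R₂.few)
        ; sub = λ m → sub (∈-++⁻ R₁.list m)
        ; covers = λ {a} m → covers a m (here? a) refl }
        where
        here? : A → Bool
        here? a = t a ≡ᵇ n
        X₁ = X ⟪ here? ⟫
        X₂ = X ⟪ not ∘ here? ⟫
        below-n : ∀ {a} → a ∈ X₂ → t a < n
        below-n {a} m = let m' , e = ∈-filter⁻ (not ∘ here?) {xs = X} m in
          ≤∧≢⇒< (s≤s⁻¹ (t< m')) (λ ta≡n → not-true e (≡⇒≡ᵇ (t a) n ta≡n))
        module R₁ = Reps (reps X₁ (λ m → good (proj₁ (∈-filter⁻ here? m))))
        module R₂ = Reps (reps-value n X₂ (λ m → good (proj₁ (∈-filter⁻ (not ∘ here?) m))) below-n)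
        sub : ∀ {a} → a ∈ R₁.list ⊎ a ∈ R₂.list → a ∈ X
        sub (inj₁ m) = proj₁ (∈-filter⁻ here? (R₁.sub m))
        sub (inj₂ m) = proj₁ (∈-filter⁻ (not ∘ here?) (R₂.sub m))
        covers : ∀ a → a ∈ X → ∀ b → here? a ≡ b → ∃ λ a' → a' ∈ R₁.list ++ R₂.list × Agree (t ∷ ts) a a'
        covers a m true e = let a' , m' , ag = R₁.covers (∈-filter⁺ here? m e) in a' , ∈-++⁺ˡ m' , λ
          { (here refl) → trans (≡ᵇ-true e) (sym (≡ᵇ-true (proj₂ (∈-filter⁻ here? {xs = X} (R₁.sub m'))))) ; (there q) → ag q }
        covers a m false e = let a' , m' , ag = R₂.covers (∈-filter⁺ (not ∘ here?) m (cong not e)) in a' , ∈-++⁺ʳ R₁.list m' , ag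

  representatives : ∀ (ts : List (A → ℕ)) n X → (∀ {a} → a ∈ X → ∀ {t} → t ∈ ts → t a < n) → Reps X (n ^ length ts) (Agree ts)
  representatives [] n [] t< = record { list = [] ; few = z≤n ; sub = λ () ; covers = λ () }
  representatives [] n (x ∷ X) t< = record { list = x ∷ [] ; few = ≤-refl ; sub = λ { (here refl) → here refl } ; covers = λ _ → x , here refl , λ () }
  representatives (t ∷ ts) n X t< = reps-value (λ a → ∀ {t} → t ∈ ts → t a < n) t (λ X' good → representatives ts n X' good) n X (λ m q → t< m (there q)) (λ m → t< m (here refl))

  module _ {m n : ℕ} (f : Fin m → Fin n → ℕ) where
    Solves : List (Fin m) → List (Fin n) → Protocol (Fin m) (Fin n) ℕ → Set
    Solves X Y P = ∀ {a b} → a ∈ X → b ∈ Y → run P a b ≡ f a b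

    Bounded : ℕ → List (Fin m) → List (Fin n) → Set
    Bounded Δ X Y = ∀ {a b} → a ∈ X → b ∈ Y → f a b ≤ Δ

    RankOn : List (Fin m) → List (Fin n) → ℕ → Set
    RankOn X Y k = FactorsOn X Y (λ a b → ℕ→ℚ (f a b)) k

  -- Rows are determined by their entries in a column basis.
  distinct-rows : ∀ {m n} (f : Fin m → Fin n → ℕ) Δ k X Y → Bounded f Δ X Y → RankOn f X Y k →
    Reps X (suc Δ ^ k) (λ a a' → ∀ {b} → b ∈ Y → f a b ≡ f a' b)
  distinct-rows {m} {n} f Δ k X Y f≤ fac = record
    { list = R.list
    ; few = ≤-trans R.few (^-monoʳ-≤ (suc Δ) (≤-trans (≤-reflexive (length-tabulate tests)) dim≤))
    ; sub = R.sub
    ; covers = λ {a} p → let a' , p' , ag = R.covers p in a' , p' , λ q → same p (R.sub p') q ag }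
    where
    fac' : FactorsOn Y X (λ b a → ℕ→ℚ (f a b)) k
    fac' = FactorsOn-swap {X = X} {Y = Y} fac
    bs : Basis k Y (proj₁ fac')
    bs = basis k Y (proj₁ fac')
    open Basis bs
    tests : Fin dim → Fin m → ℕ
    tests j a = f a (e j)
    bounded : ∀ {a} → a ∈ X → ∀ {t} → t ∈ tabulate tests → t a < suc Δ
    bounded {a} p q = let j , eq = ∈-tabulate⁻ {f = tests} q in subst (λ t → t a < suc Δ) (sym eq) (s≤s (f≤ p (e∈ j)))
    module R = Reps (representatives (tabulate tests) (suc Δ) X bounded)
    same : ∀ {a a'} → a ∈ X → a' ∈ X → ∀ {b} → b ∈ Y → Agree (tabulate tests) a a' → f a b ≡ f a' b
    same {a} {a'} p p' {b} q ag = ≤-antisym (ℕ→ℚ-cancel (ℚP.≤-reflexive eq)) (ℕ→ℚ-cancel (ℚP.≤-reflexive (sym eq)))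
      where
      eq : ℕ→ℚ (f a b) ≡ ℕ→ℚ (f a' b)
      eq = trans (basis-expand {X = Y} {Y = X} fac' bs q p)
        (trans (S-cong dim (λ j → cong (λ t → W b j ℚ.* ℕ→ℚ t) (ag (∈-tabulate⁺ {f = tests} j)))) (sym (basis-expand {X = Y} {Y = X} fac' bs q p')))

  answer : ∀ {m n} (f : Fin m → Fin n → ℕ) → ℕ → List (Fin m) → ℕ → Protocol (Fin m) (Fin n) ℕ
  -- A dummy for indices out of range.
  answer f Δ [] i = leaf 0
  answer f Δ (x ∷ xs) zero = sendB Δ (f x) leaf
  answer f Δ (x ∷ xs) (suc i) = answer f Δ xs i

  position : ∀ {x : A} {xs} → x ∈ xs → ℕ
  position (here _) = 0
  position (there m) = suc (position m)

  position< : ∀ {x : A} {xs} (m : x ∈ xs) → position m < length xs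
  position< (here _) = s≤s z≤n
  position< (there m) = s≤s (position< m)

  n<2^n : ∀ n → n < 2 ^ n
  n<2^n zero = s≤s z≤n
  n<2^n (suc n) = ≤-trans (≤-reflexive (+-comm 1 (suc n))) (+-mono-≤ (n<2^n n) (≤-trans (1≤^ n (s≤s z≤n)) (≤-reflexive (sym (+-identityʳ (2 ^ n))))))

  run-answer : ∀ {m n} (f : Fin m → Fin n → ℕ) Δ {xs x} (p : x ∈ xs) a b → f x b ≤ Δ → run (answer f Δ xs (position p)) a b ≡ f x b
  run-answer f Δ {x ∷ _} (here refl) a b le = run-sendB Δ (f x) leaf a b (≤-<-trans le (n<2^n Δ))
  run-answer f Δ (there p) a b le = run-answer f Δ p a b le

  depth-answer : ∀ {m n} (f : Fin m → Fin n → ℕ) Δ xs i → depth (answer f Δ xs i) ≤ Δ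
  depth-answer f Δ [] i = z≤n
  depth-answer f Δ (x ∷ xs) zero = ≤-trans (depth-sendB Δ (f x) leaf 0 (λ _ → z≤n)) (≤-reflexive (+-identityʳ Δ))
  depth-answer f Δ (x ∷ xs) (suc i) = depth-answer f Δ xs i

  Computable : ∀ {m n} → (Fin m → Fin n → ℕ) → List (Fin m) → List (Fin n) → ℕ → Set
  Computable {m} {n} f X Y t = Σ (Protocol (Fin m) (Fin n) ℕ) λ P → Solves f X Y P × depth P ≤ t

  -- At most (Δ + 1)³ ≤ 2^(3Δ) different rows are left. Alice names hers, and Bob sends the entry, a
  -- number below 2^Δ.
  low-rank : ∀ {m n} (f : Fin m → Fin n → ℕ) Δ k X Y → Bounded f Δ X Y → RankOn f X Y k → k ≤ 3 → Computable f X Y (Δ * 3 + Δ)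
  low-rank {m} {n} f Δ k X Y f≤ fac k≤3 = sendA (Δ * 3) code (answer f Δ R.list)
    , solves
    , depth-sendA (Δ * 3) code (answer f Δ R.list) Δ (depth-answer f Δ R.list)
    where
    open import Data.List.Membership.DecPropositional (Fin._≟_ {m}) using (_∈?_)
    module R = Reps (distinct-rows f Δ k X Y f≤ fac)
    few : length R.list ≤ 2 ^ (Δ * 3)
    few = begin
      length R.list ≤⟨ R.few ⟩
      suc Δ ^ k ≤⟨ ^-monoʳ-≤ (suc Δ) k≤3 ⟩
      suc Δ ^ 3 ≤⟨ ^-monoˡ-≤ 3 (n<2^n Δ) ⟩
      (2 ^ Δ) ^ 3 ≡⟨ ^-*-assoc 2 Δ 3 ⟩
      2 ^ (Δ * 3) ∎
      where open ≤-Reasoning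
    code' : ∀ {a} → Dec (a ∈ X) → ℕ
    code' (yes p) = position (proj₁ (proj₂ (R.covers p)))
    code' (no _) = 0
    code : Fin m → ℕ
    code a = code' (a ∈? X)
    solves : ∀ {a b} → a ∈ X → b ∈ Y → run (sendA (Δ * 3) code (answer f Δ R.list)) a b ≡ f a b
    solves {a} {b} p q = trans (run-sendA (Δ * 3) code (answer f Δ R.list) a b (code< (a ∈? X))) (correct (a ∈? X))
      where
      code< : (d : Dec (a ∈ X)) → code' d < 2 ^ (Δ * 3)
      code< (yes p) = <-≤-trans (position< (proj₁ (proj₂ (R.covers p)))) few
      code< (no _) = 1≤^ (Δ * 3) (s≤s z≤n)
      correct : (d : Dec (a ∈ X)) → run (answer f Δ R.list (code' d)) a b ≡ f a b
      correct (yes p) = let a' , p' , ag = R.covers p in trans (run-answer f Δ p' a b (f≤ (R.sub p') q)) (sym (ag q))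
      correct (no ¬p) = ⊥-elim (¬p p)

-- Exhausting a matrix by strips.

module Levels where
  open Sums
  open Core
  open Mono
  open Protocols
  open import Data.Nat
  open import Data.Nat.Properties
  open import Data.Nat.Tactic.RingSolver using (solve-∀)

  private variable
    A : Set

  filter-true : ∀ (X : List A) → X ⟪ (λ _ → true) ⟫ ≡ X
  filter-true [] = refl
  filter-true (x ∷ X) = cong (x ∷_) (filter-true X)

  filter-not-∨ : ∀ (p q : A → Bool) X → X ⟪ (λ a → not (p a ∨ q a)) ⟫ ≡ X ⟪ not ∘ p ⟫ ⟪ not ∘ q ⟫
  filter-not-∨ p q X = trans (congF X) (filter-∧ (not ∘ p) (not ∘ q) X)
    where
    not-∨ : ∀ x y → not (x ∨ y) ≡ not x ∧ not y
    not-∨ true y = refl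
    not-∨ false y = refl
    congF : ∀ X → X ⟪ (λ a → not (p a ∨ q a)) ⟫ ≡ X ⟪ (λ a → not (p a) ∧ not (q a)) ⟫
    congF [] = refl
    congF (x ∷ X) rewrite not-∨ (p x) (q x) with not (p x) ∧ not (q x)
    ... | true = cong (x ∷_) (congF X)
    ... | false = congF X

  nonempty : ∀ {x : A} {X} → x ∈ X → 1 ≤ length X
  nonempty {X = _ ∷ _} _ = s≤s z≤n

  module _ {m n : ℕ} (f : Fin m → Fin n → ℕ) where

    -- A full strip of rows or of columns, so that what remains after its removal is again a product
    -- set.
    Block : ℕ → ℕ → List (Fin m) → List (Fin n) → Set
    Block D' t X Y =
      (Σ (Fin m → Bool) λ x → Computable f (X ⟪ x ⟫) Y t × length X ≤ suc D' * length (X ⟪ x ⟫)) ⊎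
      (Σ (Fin n → Bool) λ y → Computable f X (Y ⟪ y ⟫) t × length Y ≤ suc D' * length (Y ⟪ y ⟫))

    -- Two bits tell which of two consecutive partial protocols to use, so a
    -- sequence of 2 ^ l blocks costs only 2 * l bits.
    record Partial (D' t l : ℕ) (X : List (Fin m)) (Y : List (Fin n)) : Set where
      field
        hA : Fin m → Bool
        hB : Fin n → Bool
        P : Protocol (Fin m) (Fin n) ℕ
        short : depth P ≤ t + 2 * l
        hits : ∀ {a b} → a ∈ X → b ∈ Y → hA a ∨ hB b ≡ true → run P a b ≡ f a b
        shrinks : suc D' ^ (2 ^ l) * (length (X ⟪ not ∘ hA ⟫) * length (Y ⟪ not ∘ hB ⟫)) ≤ D' ^ (2 ^ l) * (length X * length Y)

    module _ (D' t : ℕ) (Inv : List (Fin m) → List (Fin n) → Set) (inv-filter : ∀ {X Y} x y → Inv X Y → Inv (X ⟪ x ⟫) (Y ⟪ y ⟫))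
      (block : ∀ X Y → Inv X Y → 1 ≤ length X * length Y → Block D' t X Y) where
      private
        remaining : ∀ (X : List A) x → length X ≤ suc D' * length (X ⟪ x ⟫) → suc D' * length (X ⟪ not ∘ x ⟫) ≤ D' * length X
        remaining X x h = +-cancelˡ-≤ (length X) (suc D' * length (X ⟪ not ∘ x ⟫)) (D' * length X) (begin
          length X + suc D' * length (X ⟪ not ∘ x ⟫) ≤⟨ +-monoˡ-≤ (suc D' * length (X ⟪ not ∘ x ⟫)) h ⟩
          suc D' * length (X ⟪ x ⟫) + suc D' * length (X ⟪ not ∘ x ⟫) ≡⟨ *-distribˡ-+ (suc D') (length (X ⟪ x ⟫)) (length (X ⟪ not ∘ x ⟫)) ⟨
          suc D' * (length (X ⟪ x ⟫) + length (X ⟪ not ∘ x ⟫)) ≡⟨ cong (suc D' *_) (length-filter-not x X) ⟩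
          suc D' * length X ∎)
          where open ≤-Reasoning

      -- The second half of the blocks is found on what the first half leaves uncovered. If neither
      -- player's test for the first half succeeds, the input lies in X' × Y'. The first protocol
      -- occurs in two branches, which does not add to the depth.
      sweep : ∀ l X Y → Inv X Y → Partial D' t l X Y
      sweep zero X Y inv with 1 ≤? length X * length Y
      ... | no empty = record { hA = λ _ → false ; hB = λ _ → false ; P = leaf 0 ; short = z≤n ; hits = λ _ _ () ; shrinks = begin
          suc D' ^ 1 * (length (X ⟪ (λ _ → true) ⟫) * length (Y ⟪ (λ _ → true) ⟫)) ≡⟨ cong₂ (λ P Q → suc D' ^ 1 * (length P * length Q)) (filter-true X) (filter-true Y) ⟩
          suc D' ^ 1 * (length X * length Y) ≡⟨ cong (suc D' ^ 1 *_) (n<1⇒n≡0 (≰⇒> empty)) ⟩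
          suc D' ^ 1 * 0 ≡⟨ *-zeroʳ (suc D' ^ 1) ⟩
          0 ≤⟨ z≤n ⟩
          D' ^ 1 * (length X * length Y) ∎ }
        where open ≤-Reasoning
      ... | yes 1≤ = first (block X Y inv 1≤)
        where
        open ≤-Reasoning
        first : Block D' t X Y → Partial D' t zero X Y
        first (inj₁ (x , (P , solves , short) , large)) = record { hA = x ; hB = λ _ → false ; P = P ; short = ≤-trans short (m≤m+n t 0)
          ; hits = λ {a} {b} p q e → solves (∈-filter⁺ x p (∨-false (x a) e)) q
          ; shrinks = begin
            suc D' ^ 1 * (length (X ⟪ not ∘ x ⟫) * length (Y ⟪ (λ _ → true) ⟫)) ≡⟨ cong₂ (λ p Q → p * (length (X ⟪ not ∘ x ⟫) * length Q)) (*-identityʳ (suc D')) (filter-true Y) ⟩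
            suc D' * (length (X ⟪ not ∘ x ⟫) * length Y) ≡⟨ *-assoc (suc D') (length (X ⟪ not ∘ x ⟫)) (length Y) ⟨
            suc D' * length (X ⟪ not ∘ x ⟫) * length Y ≤⟨ *-monoˡ-≤ (length Y) (remaining X x large) ⟩
            D' * length X * length Y ≡⟨ trans (*-assoc D' (length X) (length Y)) (cong (_* (length X * length Y)) (sym (*-identityʳ D'))) ⟩
            D' ^ 1 * (length X * length Y) ∎ }
          where
          ∨-false : ∀ s → s ∨ false ≡ true → s ≡ true
          ∨-false true _ = refl
        first (inj₂ (y , (P , solves , short) , large)) = record { hA = λ _ → false ; hB = y ; P = P ; short = ≤-trans short (m≤m+n t 0)
          ; hits = λ p q e → solves p (∈-filter⁺ y q e)
          ; shrinks = begin
            suc D' ^ 1 * (length (X ⟪ (λ _ → true) ⟫) * length (Y ⟪ not ∘ y ⟫)) ≡⟨ cong₂ (λ p Q → p * (length Q * length (Y ⟪ not ∘ y ⟫))) (*-identityʳ (suc D')) (filter-true X) ⟩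
            suc D' * (length X * length (Y ⟪ not ∘ y ⟫)) ≡⟨ ((∀ d x y → d * (x * y) ≡ x * (d * y)) ∋ solve-∀) (suc D') (length X) (length (Y ⟪ not ∘ y ⟫)) ⟩
            length X * (suc D' * length (Y ⟪ not ∘ y ⟫)) ≤⟨ *-monoʳ-≤ (length X) (remaining Y y large) ⟩
            length X * (D' * length Y) ≡⟨ ((∀ d x y → x * (d * y) ≡ d * 1 * (x * y)) ∋ solve-∀) D' (length X) (length Y) ⟩
            D' ^ 1 * (length X * length Y) ∎ }
      sweep (suc l) X Y inv = record
        { hA = λ a → P₁.hA a ∨ P₂.hA a ; hB = λ b → P₁.hB b ∨ P₂.hB b
        ; P = alice P₁.hA P₁.P (bob P₁.hB P₁.P P₂.P)
        ; short = begin
            suc (depth P₁.P ⊔ suc (depth P₁.P ⊔ depth P₂.P)) ≤⟨ s≤s (⊔-lub (m≤n⇒m≤1+n P₁.short) (s≤s (⊔-lub P₁.short P₂.short))) ⟩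
            suc (suc (t + 2 * l)) ≡⟨ ((∀ t l → 2 + (t + 2 * l) ≡ t + 2 * (1 + l)) ∋ solve-∀) t l ⟩
            t + 2 * suc l ∎
        ; hits = λ {a} {b} p q → hits p q (P₁.hA a) (P₁.hB b) refl refl
        ; shrinks = begin
            suc D' ^ (2 * 2 ^ l) * (length (X ⟪ (λ a → not (P₁.hA a ∨ P₂.hA a)) ⟫) * length (Y ⟪ (λ b → not (P₁.hB b ∨ P₂.hB b)) ⟫))
              ≡⟨ cong₂ _*_ (double (suc D')) (cong₂ (λ P Q → length P * length Q) (filter-not-∨ P₁.hA P₂.hA X) (filter-not-∨ P₁.hB P₂.hB Y)) ⟩
            suc D' ^ (2 ^ l) * suc D' ^ (2 ^ l) * (length (X' ⟪ not ∘ P₂.hA ⟫) * length (Y' ⟪ not ∘ P₂.hB ⟫)) ≡⟨ *-assoc (suc D' ^ (2 ^ l)) (suc D' ^ (2 ^ l)) _ ⟩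
            suc D' ^ (2 ^ l) * (suc D' ^ (2 ^ l) * (length (X' ⟪ not ∘ P₂.hA ⟫) * length (Y' ⟪ not ∘ P₂.hB ⟫))) ≤⟨ *-monoʳ-≤ (suc D' ^ (2 ^ l)) P₂.shrinks ⟩
            suc D' ^ (2 ^ l) * (D' ^ (2 ^ l) * (length X' * length Y')) ≡⟨ ((∀ x y z → x * (y * z) ≡ y * (x * z)) ∋ solve-∀) (suc D' ^ (2 ^ l)) (D' ^ (2 ^ l)) (length X' * length Y') ⟩
            D' ^ (2 ^ l) * (suc D' ^ (2 ^ l) * (length X' * length Y')) ≤⟨ *-monoʳ-≤ (D' ^ (2 ^ l)) P₁.shrinks ⟩
            D' ^ (2 ^ l) * (D' ^ (2 ^ l) * (length X * length Y)) ≡⟨ trans (sym (*-assoc (D' ^ (2 ^ l)) (D' ^ (2 ^ l)) (length X * length Y))) (cong (_* (length X * length Y)) (sym (double D'))) ⟩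
            D' ^ (2 * 2 ^ l) * (length X * length Y) ∎ }
        where
        open ≤-Reasoning
        module P₁ = Partial (sweep l X Y inv)
        X' = X ⟪ not ∘ P₁.hA ⟫
        Y' = Y ⟪ not ∘ P₁.hB ⟫
        module P₂ = Partial (sweep l X' Y' (inv-filter (not ∘ P₁.hA) (not ∘ P₁.hB) inv))
        double : ∀ x → x ^ (2 * 2 ^ l) ≡ x ^ (2 ^ l) * x ^ (2 ^ l)
        double x = trans (cong (x ^_) (cong (2 ^ l +_) (+-identityʳ (2 ^ l)))) (^-distribˡ-+-* x (2 ^ l) (2 ^ l))
        hits : ∀ {a b} → a ∈ X → b ∈ Y → ∀ s u → P₁.hA a ≡ s → P₁.hB b ≡ u → (P₁.hA a ∨ P₂.hA a) ∨ (P₁.hB b ∨ P₂.hB b) ≡ true →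
          run (alice P₁.hA P₁.P (bob P₁.hB P₁.P P₂.P)) a b ≡ f a b
        hits p q true u e₁ e₂ _ = trans (if-true e₁) (P₁.hits p q (cong (_∨ _) e₁))
        hits {a} p q false true e₁ e₂ _ = trans (if-false e₁) (trans (if-true e₂) (P₁.hits p q (trans (cong (P₁.hA a ∨_) e₂) (∨-true (P₁.hA a)))))
          where
          ∨-true : ∀ s → s ∨ true ≡ true
          ∨-true true = refl
          ∨-true false = refl
        hits {a} {b} p q false false e₁ e₂ e = trans (if-false e₁) (trans (if-false e₂)
          (P₂.hits (∈-filter⁺ (not ∘ P₁.hA) p (cong not e₁)) (∈-filter⁺ (not ∘ P₁.hB) q (cong not e₂))
            (trans (sym (cong₂ (λ s u → (s ∨ P₂.hA a) ∨ (u ∨ P₂.hB b)) e₁ e₂)) e)))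

      -- Each block keeps at most the fraction 1 - 1/(D' + 1) of the area, and D' + 1 blocks at
      -- least halve it. After 2^g such rounds less than one entry is left, that is, none.
      exhaustive : ∀ g L X Y → 2 ^ L ≡ suc D' * 2 ^ g → Inv X Y → length X * length Y < 2 ^ (2 ^ g) → Computable f X Y (t + 2 * L)
      exhaustive g L X Y L≡ inv small = P , (λ {a} {b} p q → hits p q (hit p q (hA a) (hB b) refl refl)) , short
        where
        open ≤-Reasoning
        open Partial (sweep L X Y inv)
        S rest K G : ℕ
        S = length X * length Y
        rest = length (X ⟪ not ∘ hA ⟫) * length (Y ⟪ not ∘ hB ⟫)
        K = suc D' ^ (2 ^ L)
        G = 2 ^ (2 ^ g)
        halving : G * D' ^ (2 ^ L) ≤ K
        halving = begin
          G * D' ^ (2 ^ L) ≡⟨ cong (λ t → G * D' ^ t) L≡ ⟩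
          G * D' ^ (suc D' * 2 ^ g) ≡⟨ cong (G *_) (^-*-assoc D' (suc D') (2 ^ g)) ⟨
          G * (D' ^ suc D') ^ (2 ^ g) ≡⟨ ^-distrib-* 2 (D' ^ suc D') (2 ^ g) ⟨
          (2 * D' ^ suc D') ^ (2 ^ g) ≤⟨ ^-monoˡ-≤ (2 ^ g) (double-power D' (suc D') (s≤s z≤n) (n≤1+n D')) ⟩
          (suc D' ^ suc D') ^ (2 ^ g) ≡⟨ ^-*-assoc (suc D') (suc D') (2 ^ g) ⟩
          suc D' ^ (suc D' * 2 ^ g) ≡⟨ cong (suc D' ^_) L≡ ⟨
          K ∎
        rest≡0 : rest ≡ 0
        rest≡0 = n<1⇒n≡0 (*-cancelˡ-< G rest 1 (begin-strict
          G * rest ≤⟨ *-cancelˡ-≤ K {{>-nonZero (1≤^ (2 ^ L) (s≤s z≤n))}} (begin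
            K * (G * rest) ≡⟨ ((∀ k g r → k * (g * r) ≡ g * (k * r)) ∋ solve-∀) K G rest ⟩
            G * (K * rest) ≤⟨ *-monoʳ-≤ G shrinks ⟩
            G * (D' ^ (2 ^ L) * S) ≡⟨ *-assoc G (D' ^ (2 ^ L)) S ⟨
            G * D' ^ (2 ^ L) * S ≤⟨ *-monoˡ-≤ S halving ⟩
            K * S ∎) ⟩
          S <⟨ small ⟩
          G ≡⟨ *-identityʳ G ⟨
          G * 1 ∎))
        hit : ∀ {a b} → a ∈ X → b ∈ Y → ∀ s u → hA a ≡ s → hB b ≡ u → hA a ∨ hB b ≡ true
        hit p q true u e₁ e₂ = cong (_∨ _) e₁
        hit p q false true e₁ e₂ = cong₂ _∨_ e₁ e₂
        hit p q false false e₁ e₂ = ⊥-elim (<-irrefl (sym rest≡0) (*-mono-≤ (nonempty (∈-filter⁺ (not ∘ hA) p (cong not e₁))) (nonempty (∈-filter⁺ (not ∘ hB) q (cong not e₂)))))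

-- The recursion on the rank and the summation of its costs.

module Final where
  open Rationals
  open Linear
  open Sums
  open Core
  open Mono
  open Protocols
  open Levels
  import Data.Rational.Properties as ℚP
  open import Data.Nat
  open import Data.Nat.Properties
  open import Data.Nat.Induction using (<-rec)
  open import Data.Nat.Logarithm using (⌈log₂_⌉; ⌈log₂⌈n/2⌉⌉≡⌈log₂n⌉∸1; ⌈log₂⌉-mono-≤; ⌈log₂2^n⌉≡n)
  open import Data.Nat.Tactic.RingSolver using (solve-∀)

  -- An integer in place of the square root of 2^i, exact up to the factor √2.
  h : ℕ → ℕ
  h i = 2 ^ ⌈ i /2⌉

  -- For k ≤ 2 + 2^i with i ≥ 1, s = 4 h i satisfies 2k ≤ s², and ℓ = i + 7 satisfies 32(k + 1) ≤
  -- 2^ℓ.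
  bits : ℕ → ℕ → ℕ
  bits Δ i = density Δ (4 * h i) (i + 7)

  -- A level needs 2^(d + g) blocks, where 2^(-d) bounds the relative size of a block and 2^(2^g)
  -- the area. Finding the block costs two bits per doubling.
  level-depth : ℕ → ℕ → ℕ → ℕ
  level-depth Δ g zero = Δ * 3 + Δ
  level-depth Δ g (suc i) = level-depth Δ g i + 2 * (bits Δ (suc i) + g)

  2^i≤h² : ∀ i → 2 ^ i ≤ h i * h i
  2^i≤h² zero = ≤-refl
  2^i≤h² (suc zero) = s≤s (s≤s z≤n)
  2^i≤h² (suc (suc i)) = begin
    2 * (2 * 2 ^ i) ≡⟨ *-assoc 2 2 (2 ^ i) ⟨
    4 * 2 ^ i ≤⟨ *-monoʳ-≤ 4 (2^i≤h² i) ⟩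
    4 * (h i * h i) ≡⟨ ((∀ x → 4 * (x * x) ≡ 2 * x * (2 * x)) ∋ solve-∀) (h i) ⟩
    h (suc (suc i)) * h (suc (suc i)) ∎
    where open ≤-Reasoning

  h²≤2^i : ∀ i → h i * h i ≤ 2 * 2 ^ i
  h²≤2^i zero = s≤s z≤n
  h²≤2^i (suc zero) = ≤-refl
  h²≤2^i (suc (suc i)) = begin
    2 * h i * (2 * h i) ≡⟨ ((∀ x → 4 * (x * x) ≡ 2 * x * (2 * x)) ∋ solve-∀) (h i) ⟨
    4 * (h i * h i) ≤⟨ *-monoʳ-≤ 4 (h²≤2^i i) ⟩
    4 * (2 * 2 ^ i) ≡⟨ ((∀ x → 4 * (2 * x) ≡ 2 * (2 * (2 * x))) ∋ solve-∀) (2 ^ i) ⟩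
    2 * 2 ^ suc (suc i) ∎
    where open ≤-Reasoning

  1≤h : ∀ i → 1 ≤ h i
  1≤h i = 1≤^ ⌈ i /2⌉ (s≤s z≤n)

  -- The bound k < 3 + 2 ^ (i + 1) becomes k' < 3 + 2 ^ i for one of the two blocks,
  -- whose ranks p + 1 and q + 1 satisfy p + q ≤ k + 1.
  solve : ∀ {m n} (f : Fin m → Fin n → ℕ) Δ g → 1 ≤ Δ → ∀ i k X Y → Bounded f Δ X Y → RankOn f X Y k → k < 3 + 2 ^ i → length X * length Y < 2 ^ (2 ^ g) →
    Computable f X Y (level-depth Δ g i)
  solve f Δ g 1≤Δ zero k X Y f≤ fac k< small = low-rank f Δ k X Y f≤ fac (s≤s⁻¹ k<)
  solve {m} {n} f Δ g 1≤Δ (suc i) k X₀ Y₀ f≤ fac k< small =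
    exhaustive f (pred (2 ^ d)) (level-depth Δ g i) Inv inv-filter block g (d + g) X₀ Y₀
      (trans (^-distribˡ-+-* 2 d g) (cong (_* 2 ^ g) (sym 2^d))) (f≤ , fac , small) small
    where
    open ≤-Reasoning
    d s : ℕ
    d = bits Δ (suc i)
    s = 4 * h (suc i)
    2^d : suc (pred (2 ^ d)) ≡ 2 ^ d
    2^d = suc-pred (2 ^ d) {{>-nonZero (1≤^ d (s≤s z≤n))}}
    Inv : List (Fin m) → List (Fin n) → Set
    Inv X Y = Bounded f Δ X Y × RankOn f X Y k × length X * length Y < 2 ^ (2 ^ g)
    filter≤ : ∀ {A : Set} (p : A → Bool) X → length (X ⟪ p ⟫) ≤ length X
    filter≤ p X = ≤-trans (m≤m+n (length (X ⟪ p ⟫)) (length (X ⟪ not ∘ p ⟫))) (≤-reflexive (length-filter-not p X))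
    inv-filter : ∀ {X Y} x y → Inv X Y → Inv (X ⟪ x ⟫) (Y ⟪ y ⟫)
    inv-filter {X} {Y} x y (b , r , l) = (λ p q → b (proj₁ (∈-filter⁻ x p)) (proj₁ (∈-filter⁻ y q)))
      , FactorsOn-⊆ {X = X} {X' = X ⟪ x ⟫} {Y = Y} {Y' = Y ⟪ y ⟫} (λ p → proj₁ (∈-filter⁻ x p)) (λ q → proj₁ (∈-filter⁻ y q)) r
      , ≤-<-trans (*-mono-≤ (filter≤ x X) (filter≤ y Y)) l
    2k≤s² : 2 * k ≤ s * s
    2k≤s² = begin
      2 * k ≤⟨ *-monoʳ-≤ 2 (s≤s⁻¹ k<) ⟩
      2 * (2 + 2 ^ suc i) ≤⟨ *-monoʳ-≤ 2 (+-monoˡ-≤ (2 ^ suc i) (m≤m*n 2 (2 ^ i) {{>-nonZero (1≤^ i (s≤s z≤n))}})) ⟩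
      2 * (2 ^ suc i + 2 ^ suc i) ≡⟨ ((∀ x → 2 * (x + x) ≡ 4 * x) ∋ solve-∀) (2 ^ suc i) ⟩
      4 * 2 ^ suc i ≤⟨ *-mono-≤ (m≤m+n 4 12) (2^i≤h² (suc i)) ⟩
      16 * (h (suc i) * h (suc i)) ≡⟨ ((∀ x → 16 * (x * x) ≡ 4 * x * (4 * x)) ∋ solve-∀) (h (suc i)) ⟩
      s * s ∎
    8L≤ : 8 * (4 * suc k) ≤ 2 ^ (suc i + 7)
    8L≤ = begin
      8 * (4 * suc k) ≡⟨ *-assoc 8 4 (suc k) ⟨
      32 * suc k ≤⟨ *-monoʳ-≤ 32 (begin
        suc k ≤⟨ k< ⟩
        3 + 2 ^ suc i ≤⟨ +-monoˡ-≤ (2 ^ suc i) (m≤m*n 3 (2 ^ suc i) {{>-nonZero (1≤^ (suc i) (s≤s z≤n))}}) ⟩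
        3 * 2 ^ suc i + 2 ^ suc i ≡⟨ ((∀ x → 3 * x + x ≡ 4 * x) ∋ solve-∀) (2 ^ suc i) ⟩
        4 * 2 ^ suc i ∎) ⟩
      32 * (4 * 2 ^ suc i) ≡⟨ ((∀ x → 32 * (4 * x) ≡ x * 128) ∋ solve-∀) (2 ^ suc i) ⟩
      2 ^ suc i * 2 ^ 7 ≡⟨ ^-distribˡ-+-* 2 (suc i) 7 ⟨
      2 ^ (suc i + 7) ∎
    block : ∀ X Y → Inv X Y → 1 ≤ length X * length Y → Block f (pred (2 ^ d)) (level-depth Δ g i) X Y
    block X Y inv@(f≤ , fac , small) 1≤ = split (large-monochromatic f X Y Δ s k (suc i + 7) 1≤Δ (≤-trans (1≤h (suc i)) (m≤n*m (h (suc i)) 4)) (s≤s z≤n) f≤ 2k≤s² 8L≤ fac 1≤)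
      where
      instance
        X≢0 : NonZero (length X)
        X≢0 = m*n≢0⇒m≢0 (length X) {{>-nonZero 1≤}}
        Y≢0 : NonZero (length Y)
        Y≢0 = m*n≢0⇒n≢0 (length X) {{>-nonZero 1≤}}
      split : LargeMonochromatic f X Y d → Block f (pred (2 ^ d)) (level-depth Δ g i) X Y
      split (v , x , y , mono , large) = ranks (halve-rank {X = X} {X₁ = X₁} {Y = Y} {Y₁ = Y₁} (λ p → proj₁ (∈-filter⁻ x p)) (λ p → proj₁ (∈-filter⁻ y p)) fac (λ p q → cong ℕ→ℚ (mono p q)))
        where
        X₁ = X ⟪ x ⟫
        Y₁ = Y ⟪ y ⟫
        X≤ : length X ≤ 2 ^ d * length X₁
        X≤ = *-cancelʳ-≤ (length X) (2 ^ d * length X₁) (length Y) (begin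
          length X * length Y ≤⟨ large ⟩
          2 ^ d * (length X₁ * length Y₁) ≤⟨ *-monoʳ-≤ (2 ^ d) (*-monoʳ-≤ (length X₁) (filter≤ y Y)) ⟩
          2 ^ d * (length X₁ * length Y) ≡⟨ *-assoc (2 ^ d) (length X₁) (length Y) ⟨
          2 ^ d * length X₁ * length Y ∎)
        Y≤ : length Y ≤ 2 ^ d * length Y₁
        Y≤ = *-cancelˡ-≤ (length X) (begin
          length X * length Y ≤⟨ large ⟩
          2 ^ d * (length X₁ * length Y₁) ≤⟨ *-monoʳ-≤ (2 ^ d) (*-monoˡ-≤ (length Y₁) (filter≤ x X)) ⟩
          2 ^ d * (length X * length Y₁) ≡⟨ ((∀ d x y → d * (x * y) ≡ x * (d * y)) ∋ solve-∀) (2 ^ d) (length X) (length Y₁) ⟩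
          length X * (2 ^ d * length Y₁) ∎)
        ranks : (∃ λ p → ∃ λ q → p + q ≤ suc k × FactorsOn X₁ Y (λ a b → ℕ→ℚ (f a b)) (suc p) × FactorsOn X Y₁ (λ a b → ℕ→ℚ (f a b)) (suc q)) →
          Block f (pred (2 ^ d)) (level-depth Δ g i) X Y
        ranks (p , q , pq , facX , facY) = choose (suc p <? 3 + 2 ^ i) (suc q <? 3 + 2 ^ i)
          where
          choose : Dec (suc p < 3 + 2 ^ i) → Dec (suc q < 3 + 2 ^ i) → Block f (pred (2 ^ d)) (level-depth Δ g i) X Y
          choose (yes p<) _ = inj₁ (x , solve f Δ g 1≤Δ i (suc p) X₁ Y (λ m n → proj₁ inv (proj₁ (∈-filter⁻ x m)) n) facX p<
                  (≤-<-trans (*-monoˡ-≤ (length Y) (filter≤ x X)) small) , subst (λ t → length X ≤ t * length X₁) (sym 2^d) X≤)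
          choose (no _) (yes q<) = inj₂ (y , solve f Δ g 1≤Δ i (suc q) X Y₁ (λ m n → proj₁ inv m (proj₁ (∈-filter⁻ y n))) facY q<
                  (≤-<-trans (*-monoʳ-≤ (length X) (filter≤ y Y)) small) , subst (λ t → length Y ≤ t * length Y₁) (sym 2^d) Y≤)
          choose (no p≥) (no q≥) = ⊥-elim (<-irrefl refl (begin-strict
              suc k <⟨ s≤s k< ⟩
              4 + 2 ^ suc i ≡⟨ ((∀ x → 4 + 2 * x ≡ (2 + x) + (2 + x)) ∋ solve-∀) (2 ^ i) ⟩
              (2 + 2 ^ i) + (2 + 2 ^ i) ≤⟨ +-mono-≤ (s≤s⁻¹ (≮⇒≥ p≥)) (s≤s⁻¹ (≮⇒≥ q≥)) ⟩
              p + q ≤⟨ pq ⟩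
              suc k ∎))

  private
    2*⌊n/2⌋≤n : ∀ n → 2 * ⌊ n /2⌋ ≤ n
    2*⌊n/2⌋≤n n = ≤-trans (+-monoʳ-≤ ⌊ n /2⌋ (≤-trans (≤-reflexive (+-identityʳ ⌊ n /2⌋)) (⌊n/2⌋≤⌈n/2⌉ n))) (≤-reflexive (⌊n/2⌋+⌈n/2⌉≡n n))

    n≤2*⌈n/2⌉ : ∀ n → n ≤ 2 * ⌈ n /2⌉
    n≤2*⌈n/2⌉ n = ≤-trans (≤-reflexive (sym (⌊n/2⌋+⌈n/2⌉≡n n))) (≤-trans (+-monoˡ-≤ ⌈ n /2⌉ (⌊n/2⌋≤⌈n/2⌉ n)) (+-monoʳ-≤ ⌈ n /2⌉ (≤-reflexive (sym (+-identityʳ ⌈ n /2⌉)))))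

    log-step : ∀ n → 2 ≤ n → ⌈log₂ n ⌉ ≡ suc ⌈log₂ ⌈ n /2⌉ ⌉
    log-step n 2≤n = trans (sym (suc-pred ⌈log₂ n ⌉ {{>-nonZero 1≤}})) (cong suc (trans (pred[n]≡n∸1 ⌈log₂ n ⌉) (sym (⌈log₂⌈n/2⌉⌉≡⌈log₂n⌉∸1 n))))
      where
      1≤ : 1 ≤ ⌈log₂ n ⌉
      1≤ = subst (_≤ ⌈log₂ n ⌉) (⌈log₂2^n⌉≡n 1) (⌈log₂⌉-mono-≤ 2≤n)
      pred[n]≡n∸1 : ∀ n → pred n ≡ n ∸ 1
      pred[n]≡n∸1 zero = refl
      pred[n]≡n∸1 (suc n) = refl

  n≤2^⌈log₂n⌉ : ∀ n → n ≤ 2 ^ ⌈log₂ n ⌉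
  n≤2^⌈log₂n⌉ = <-rec (λ n → n ≤ 2 ^ ⌈log₂ n ⌉) go
    where
    go : ∀ n → (∀ {k} → k < n → k ≤ 2 ^ ⌈log₂ k ⌉) → n ≤ 2 ^ ⌈log₂ n ⌉
    go zero rec = z≤n
    go (suc zero) rec = 1≤^ {2} ⌈log₂ 1 ⌉ (s≤s z≤n)
    go n@(suc (suc n')) rec = begin
      n ≤⟨ n≤2*⌈n/2⌉ n ⟩
      2 * ⌈ n /2⌉ ≤⟨ *-monoʳ-≤ 2 (rec (⌈n/2⌉<n n')) ⟩
      2 ^ suc ⌈log₂ ⌈ n /2⌉ ⌉ ≡⟨ cong (2 ^_) (log-step n (s≤s (s≤s z≤n))) ⟨
      2 ^ ⌈log₂ n ⌉ ∎
      where open ≤-Reasoning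

  -- The converse estimate to `n≤2^⌈log₂n⌉`: it lets h at the top level be bounded by a constant
  -- times √r.
  2^⌈log₂⌉≤ : ∀ r → 1 ≤ r → 2 ^ ⌈log₂ suc r ⌉ ≤ 2 * r
  2^⌈log₂⌉≤ = <-rec (λ r → 1 ≤ r → 2 ^ ⌈log₂ suc r ⌉ ≤ 2 * r) go
    where
    go : ∀ r → (∀ {k} → k < r → 1 ≤ k → 2 ^ ⌈log₂ suc k ⌉ ≤ 2 * k) → 1 ≤ r → 2 ^ ⌈log₂ suc r ⌉ ≤ 2 * r
    go (suc zero) rec _ = ≤-reflexive (cong (2 ^_) (⌈log₂2^n⌉≡n 1))
    go r@(suc (suc r')) rec _ = begin
      2 ^ ⌈log₂ suc r ⌉ ≡⟨ cong (2 ^_) (log-step (suc r) (s≤s (s≤s z≤n))) ⟩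
      2 * 2 ^ ⌈log₂ suc ⌊ r /2⌋ ⌉ ≤⟨ *-monoʳ-≤ 2 (rec (⌊n/2⌋<n (suc r')) (s≤s z≤n)) ⟩
      2 * (2 * ⌊ r /2⌋) ≤⟨ *-monoʳ-≤ 2 (2*⌊n/2⌋≤n r) ⟩
      2 * r ∎
      where open ≤-Reasoning

  -- Each player first replaces the input by its representative. Columns are compared on the kept
  -- rows only, which suffices since every row equals a kept one. The area is then at most 2^(2Δr),
  -- whence g = I + Δ + 1.
  protocol : ∀ {m n} (f : Fin m → Fin n → ℕ) Δ r I → 1 ≤ Δ → (∀ a b → f a b ≤ Δ) → FactorsThrough f r → r < 2 ^ I →
    Σ (Protocol (Fin m) (Fin n) ℕ) λ P → (∀ a b → run P a b ≡ f a b) × depth P ≤ level-depth Δ (suc (I + Δ)) I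
  protocol {m} {n} f Δ r I 1≤Δ f≤ (U , V , fac) r< = result (solve f Δ g 1≤Δ I r RA.list RB.list (λ {a} {b} _ _ → f≤ a b) rank (≤-trans r< (m≤n+m (2 ^ I) 3)) small)
    where
    open ≤-Reasoning
    g : ℕ
    g = suc (I + Δ)
    rank : ∀ {X Y} → RankOn f X Y r
    rank = U , (λ b i → V i b) , λ {a} {b} _ _ → fac a b
    module RA = Reps (distinct-rows f Δ r (allFin m) (allFin n) (λ {a} {b} _ _ → f≤ a b) rank)
    module RB = Reps (distinct-rows (λ b a → f a b) Δ r (allFin n) RA.list (λ {b} {a} _ _ → f≤ a b) (FactorsOn-swap {X = RA.list} {Y = allFin n} rank))
    α : Fin m → Fin m
    α a = proj₁ (RA.covers (∈-allFin a))
    β : Fin n → Fin n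
    β b = proj₁ (RB.covers (∈-allFin b))
    α∈ : ∀ a → α a ∈ RA.list
    α∈ a = proj₁ (proj₂ (RA.covers (∈-allFin a)))
    β∈ : ∀ b → β b ∈ RB.list
    β∈ b = proj₁ (proj₂ (RB.covers (∈-allFin b)))
    powers : suc Δ ^ r ≤ 2 ^ (Δ * r)
    powers = ≤-trans (^-monoˡ-≤ r (n<2^n Δ)) (≤-reflexive (^-*-assoc 2 Δ r))
    small : length RA.list * length RB.list < 2 ^ (2 ^ g)
    small = begin-strict
      length RA.list * length RB.list ≤⟨ *-mono-≤ (≤-trans RA.few powers) (≤-trans RB.few powers) ⟩
      2 ^ (Δ * r) * 2 ^ (Δ * r) ≡⟨ ^-distribˡ-+-* 2 (Δ * r) (Δ * r) ⟨
      2 ^ (Δ * r + Δ * r) <⟨ ^-monoʳ-< 2 (s≤s (s≤s z≤n)) (begin-strict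
        Δ * r + Δ * r <⟨ +-mono-< Δr< Δr< ⟩
        2 ^ (I + Δ) + 2 ^ (I + Δ) ≡⟨ cong (2 ^ (I + Δ) +_) (+-identityʳ (2 ^ (I + Δ))) ⟨
        2 ^ g ∎) ⟩
      2 ^ (2 ^ g) ∎
      where
      Δr< : Δ * r < 2 ^ (I + Δ)
      Δr< = begin-strict
        Δ * r <⟨ *-mono-< (n<2^n Δ) r< ⟩
        2 ^ Δ * 2 ^ I ≡⟨ trans (*-comm (2 ^ Δ) (2 ^ I)) (sym (^-distribˡ-+-* 2 I Δ)) ⟩
        2 ^ (I + Δ) ∎
    result : Computable f RA.list RB.list (level-depth Δ g I) → Σ (Protocol (Fin m) (Fin n) ℕ) λ P → (∀ a b → run P a b ≡ f a b) × depth P ≤ level-depth Δ g I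
    result (P , solves , short) = mapInputs α β P
      , (λ a b → trans (run-mapInputs α β P a b) (trans (solves (α∈ a) (β∈ b))
          (trans (sym (proj₂ (proj₂ (RB.covers (∈-allFin b))) (α∈ a))) (sym (proj₂ (proj₂ (RA.covers (∈-allFin a))) (∈-allFin b))))))
      , ≤-trans (≤-reflexive (depth-mapInputs α β P)) short

  hsum : ℕ → ℕ
  hsum zero = 0
  hsum (suc i) = hsum i + h (suc i)

  -- The geometric series of the costs. As h doubles every second step, the induction goes by two.
  hsum≤ : ∀ i → hsum i ≤ 4 * h i
  hsum≤ zero = z≤n
  hsum≤ (suc zero) = m≤m+n 2 6
  hsum≤ (suc (suc i)) = begin
    hsum i + h (suc i) + 2 * h i ≤⟨ +-monoˡ-≤ (2 * h i) (+-mono-≤ (hsum≤ i) (^-monoʳ-≤ 2 {suc ⌊ i /2⌋} (s≤s (⌊n/2⌋≤⌈n/2⌉ i)))) ⟩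
    4 * h i + 2 * h i + 2 * h i ≡⟨ ((∀ x → 4 * x + 2 * x + 2 * x ≡ 4 * (2 * x)) ∋ solve-∀) (h i) ⟩
    4 * h (suc (suc i)) ∎
    where open ≤-Reasoning

  module _ (Δ I : ℕ) (1≤Δ : 1 ≤ Δ) (1≤I : 1 ≤ I) where
    open ≤-Reasoning
    private
      K Z g : ℕ
      K = κmax Δ + 1
      Z = Δ * (K * I)
      g = suc (I + Δ)
      instance
        Δ≢0 : NonZero Δ
        Δ≢0 = >-nonZero 1≤Δ
        I≢0 : NonZero I
        I≢0 = >-nonZero 1≤I
        K≢0 : NonZero K
        K≢0 = >-nonZero (m≤n+m 1 (κmax Δ))
      KI≤Z : K * I ≤ Z
      KI≤Z = m≤n*m (K * I) Δ
      I≤Z : I ≤ Z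
      I≤Z = ≤-trans (m≤n*m I K) KI≤Z
      1≤Z : 1 ≤ Z
      1≤Z = ≤-trans 1≤I I≤Z
      Δ≤Z : Δ ≤ Z
      Δ≤Z = m≤m*n Δ (K * I) {{>-nonZero (≤-trans 1≤I (m≤n*m I K))}}

      -- The main term is 49344 = 3 · 2 · 257 · 4 · 8. The resulting 98718 is rounded up to 99999 so
      -- that the total 4 + 4 · 99999 is 400000.
      step-cost : ∀ i → i ≤ I → 2 * (bits Δ i + g) ≤ 99999 * (h i * Z)
      step-cost i i≤I = begin
        2 * (3 * (2 * (257 * (4 * h i)) * Δ * (ℓ * K)) + ℓ * κmax Δ + 4 + g) ≤⟨ *-monoʳ-≤ 2 (+-mono-≤ (+-mono-≤ (+-mono-≤ t₁ t₂) t₃) t₄) ⟩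
        2 * (49344 * W + 8 * W + 4 * W + 3 * W) ≡⟨ collect 49344 W ⟩
        98718 * W ≤⟨ *-monoˡ-≤ W (m≤m+n 98718 1281) ⟩
        99999 * W ∎
        where
        collect : ∀ x w → 2 * (x * w + 8 * w + 4 * w + 3 * w) ≡ 2 * (x + 15) * w
        collect = solve-∀
        ℓ W : ℕ
        ℓ = i + 7
        W = h i * Z
        Z≤W : Z ≤ W
        Z≤W = m≤n*m Z (h i) {{>-nonZero (1≤h i)}}
        ℓ≤ : ℓ ≤ 8 * I
        ℓ≤ = +-mono-≤ i≤I (m≤m*n 7 I)
        t₁ : 3 * (2 * (257 * (4 * h i)) * Δ * (ℓ * K)) ≤ 49344 * W
        t₁ = begin
          3 * (2 * (257 * (4 * h i)) * Δ * (ℓ * K)) ≤⟨ *-monoʳ-≤ 3 (*-monoʳ-≤ (2 * (257 * (4 * h i)) * Δ) (*-monoˡ-≤ K ℓ≤)) ⟩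
          3 * (2 * (257 * (4 * h i)) * Δ * (8 * I * K)) ≡⟨ gather 3 2 257 4 8 (h i) Δ I K ⟩
          49344 * W ∎
          where
          gather : ∀ a b c e f h d i k → a * (b * (c * (e * h)) * d * (f * i * k)) ≡ a * b * c * e * f * (h * (d * (k * i)))
          gather = solve-∀
        t₂ : ℓ * κmax Δ ≤ 8 * W
        t₂ = begin
          ℓ * κmax Δ ≤⟨ *-mono-≤ ℓ≤ (m≤m+n (κmax Δ) 1) ⟩
          8 * I * K ≡⟨ ((∀ i k → 8 * i * k ≡ 8 * (k * i)) ∋ solve-∀) I K ⟩
          8 * (K * I) ≤⟨ *-monoʳ-≤ 8 (≤-trans KI≤Z Z≤W) ⟩
          8 * W ∎
        t₃ : 4 ≤ 4 * W
        t₃ = *-monoʳ-≤ 4 {1} (≤-trans 1≤Z Z≤W)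
        t₄ : suc (I + Δ) ≤ 3 * W
        t₄ = begin
          1 + (I + Δ) ≤⟨ +-mono-≤ (≤-trans 1≤Z Z≤W) (+-mono-≤ (≤-trans I≤Z Z≤W) (≤-trans Δ≤Z Z≤W)) ⟩
          W + (W + W) ≡⟨ ((∀ w → w + (w + w) ≡ 3 * w) ∋ solve-∀) W ⟩
          3 * W ∎

      total-cost : ∀ i → i ≤ I → level-depth Δ g i ≤ 4 * Δ + 99999 * (hsum i * Z)
      total-cost zero _ = ≤-reflexive (((∀ d → d * 3 + d ≡ 4 * d + 0) ∋ solve-∀) Δ)
      total-cost (suc i) i<I = begin
        level-depth Δ g i + 2 * (bits Δ (suc i) + g) ≤⟨ +-mono-≤ (total-cost i (<⇒≤ i<I)) (step-cost (suc i) i<I) ⟩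
        4 * Δ + 99999 * (hsum i * Z) + 99999 * (h (suc i) * Z) ≡⟨ distribute 99999 (4 * Δ) (hsum i) (h (suc i)) Z ⟩
        4 * Δ + 99999 * ((hsum i + h (suc i)) * Z) ∎
        where
        distribute : ∀ c d x y z → d + c * (x * z) + c * (y * z) ≡ d + c * ((x + y) * z)
        distribute = solve-∀

    level-depth≤ : ∀ c → 400000 ≤ c → level-depth Δ (suc (I + Δ)) I ≤ c * (h I * (Δ * ((κmax Δ + 1) * I)))
    level-depth≤ c ≤c = begin
      level-depth Δ g I ≤⟨ total-cost I ≤-refl ⟩
      4 * Δ + 99999 * (hsum I * Z) ≤⟨ +-mono-≤ (*-monoʳ-≤ 4 (≤-trans Δ≤Z (m≤n*m Z (h I) {{>-nonZero (1≤h I)}}))) (*-monoʳ-≤ 99999 (*-monoˡ-≤ Z (hsum≤ I))) ⟩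
      4 * (h I * Z) + 99999 * (4 * h I * Z) ≡⟨ collect 99999 (h I) Z ⟩
      400000 * (h I * Z) ≤⟨ *-monoˡ-≤ (h I * Z) ≤c ⟩
      c * (h I * Z) ∎
      where
      collect : ∀ c x z → 4 * (x * z) + c * (4 * x * z) ≡ (4 + c * 4) * (x * z)
      collect = solve-∀

  -- For Δ ≥ 2 the base 6 is at most Δ³. For Δ = 1 powers of Δ are 1, which forces a constant
  -- factor.
  κmax+1≤ : ∀ Δ → 1 ≤ Δ → κmax Δ + 1 ≤ 12 * Δ ^ (4 * Δ)
  κmax+1≤ Δ 1≤Δ = begin
    (6 * Δ) ^ Δ + 1 ≡⟨ cong (_+ 1) (^-distrib-* 6 Δ Δ) ⟩
    6 ^ Δ * Δ ^ Δ + 1 ≤⟨ +-mono-≤ (*-monoˡ-≤ (Δ ^ Δ) (six Δ 1≤Δ)) (≤-trans (1≤^ (4 * Δ) 1≤Δ) (m≤n*m (Δ ^ (4 * Δ)) 6)) ⟩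
    6 * Δ ^ (3 * Δ) * Δ ^ Δ + 6 * Δ ^ (4 * Δ) ≡⟨ cong (_+ 6 * Δ ^ (4 * Δ)) (trans (*-assoc 6 (Δ ^ (3 * Δ)) (Δ ^ Δ)) (cong (6 *_) (trans (sym (^-distribˡ-+-* Δ (3 * Δ) Δ)) (cong (Δ ^_) (((∀ d → 3 * d + d ≡ 4 * d) ∋ solve-∀) Δ))))) ⟩
    6 * Δ ^ (4 * Δ) + 6 * Δ ^ (4 * Δ) ≡⟨ ((∀ x → 6 * x + 6 * x ≡ 12 * x) ∋ solve-∀) (Δ ^ (4 * Δ)) ⟩
    12 * Δ ^ (4 * Δ) ∎
    where
    open ≤-Reasoning
    six : ∀ Δ → 1 ≤ Δ → 6 ^ Δ ≤ 6 * Δ ^ (3 * Δ)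
    six (suc zero) _ = ≤-refl
    six Δ@(suc (suc d)) _ = begin
      6 ^ Δ ≤⟨ ^-monoˡ-≤ Δ (≤-trans (m≤m+n 6 2) (^-monoˡ-≤ 3 {2} {Δ} (s≤s (s≤s z≤n)))) ⟩
      (Δ ^ 3) ^ Δ ≡⟨ ^-*-assoc Δ 3 Δ ⟩
      Δ ^ (3 * Δ) ≤⟨ m≤n*m (Δ ^ (3 * Δ)) 6 ⟩
      6 * Δ ^ (3 * Δ) ∎

  -- Here 576 = 12² · 4, from the factor 12 in `κmax+1≤` and from h² ≤ 4r, while 10 comes from Q² =
  -- Δ^(2 + 8Δ) ≤ Δ^(10Δ).
  square-bound : ∀ c C Δ I r t → 1 ≤ Δ → 10 ≤ C → 576 * (c * c) ≤ C → 2 ^ I ≤ 2 * r → t ≤ c * (h I * (Δ * ((κmax Δ + 1) * I))) →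
    t * t ≤ C * Δ ^ (C * Δ) * r * (I * I)
  square-bound c C Δ I r t 1≤Δ 10≤C 576c²≤C 2^I≤ t≤ = begin
    t * t ≤⟨ *-mono-≤ t≤' t≤' ⟩
    c * (h I * (12 * Q * I)) * (c * (h I * (12 * Q * I))) ≡⟨ ((∀ a c h q i → c * (h * (a * q * i)) * (c * (h * (a * q * i))) ≡ a * a * (c * c) * (h * h) * (q * q) * (i * i)) ∋ solve-∀) 12 c (h I) Q I ⟩
    144 * (c * c) * (h I * h I) * (Q * Q) * (I * I) ≤⟨ *-monoˡ-≤ (I * I) (*-mono-≤ (*-monoʳ-≤ (144 * (c * c)) h²≤) Q²≤) ⟩
    144 * (c * c) * (4 * r) * Δ ^ (C * Δ) * (I * I) ≡⟨ ((∀ a b x r q i → a * x * (b * r) * q * i ≡ a * b * x * q * r * i) ∋ solve-∀) 144 4 (c * c) r (Δ ^ (C * Δ)) (I * I) ⟩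
    576 * (c * c) * Δ ^ (C * Δ) * r * (I * I) ≤⟨ *-monoˡ-≤ (I * I) (*-monoˡ-≤ r (*-monoˡ-≤ (Δ ^ (C * Δ)) 576c²≤C)) ⟩
    C * Δ ^ (C * Δ) * r * (I * I) ∎
    where
    open ≤-Reasoning
    instance
      Δ≢0 : NonZero Δ
      Δ≢0 = >-nonZero 1≤Δ
    Q : ℕ
    Q = Δ * Δ ^ (4 * Δ)
    t≤' : t ≤ c * (h I * (12 * Q * I))
    t≤' = ≤-trans t≤ (*-monoʳ-≤ c (*-monoʳ-≤ (h I) (begin
      Δ * ((κmax Δ + 1) * I) ≤⟨ *-monoʳ-≤ Δ (*-monoˡ-≤ I (κmax+1≤ Δ 1≤Δ)) ⟩
      Δ * (12 * Δ ^ (4 * Δ) * I) ≡⟨ ((∀ d q i → d * (12 * q * i) ≡ 12 * (d * q) * i) ∋ solve-∀) Δ (Δ ^ (4 * Δ)) I ⟩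
      12 * Q * I ∎)))
    h²≤ : h I * h I ≤ 4 * r
    h²≤ = ≤-trans (h²≤2^i I) (≤-trans (*-monoʳ-≤ 2 2^I≤) (≤-reflexive (sym (*-assoc 2 2 r))))
    Q²≤ : Q * Q ≤ Δ ^ (C * Δ)
    Q²≤ = begin
      Q * Q ≡⟨ ^-distribˡ-+-* Δ (suc (4 * Δ)) (suc (4 * Δ)) ⟨
      Δ ^ (suc (4 * Δ) + suc (4 * Δ)) ≤⟨ ^-monoʳ-≤ Δ (begin
        suc (4 * Δ) + suc (4 * Δ) ≤⟨ +-mono-≤ (+-monoˡ-≤ (4 * Δ) 1≤Δ) (+-monoˡ-≤ (4 * Δ) 1≤Δ) ⟩
        (Δ + 4 * Δ) + (Δ + 4 * Δ) ≡⟨ ((∀ d → (d + 4 * d) + (d + 4 * d) ≡ 10 * d) ∋ solve-∀) Δ ⟩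
        10 * Δ ≤⟨ *-monoˡ-≤ Δ 10≤C ⟩
        C * Δ ∎) ⟩
      Δ ^ (C * Δ) ∎

  log-rank : ∀ c C → 400000 ≤ c → 10 ≤ C → 576 * (c * c) ≤ C → (m n Δ : ℕ) → 1 ≤ Δ → (f : Fin m → Fin n → ℕ) →
    ((a : Fin m) (b : Fin n) → f a b ≤ Δ) → (r : ℕ) → RankIs f r →
    Σ (Protocol (Fin m) (Fin n) ℕ) (λ P →
      ((a : Fin m) (b : Fin n) → run P a b ≡ f a b) ×
      (depth P * depth P ≤ C * Δ ^ (C * Δ) * r * (⌈log₂ (r + 1) ⌉ * ⌈log₂ (r + 1) ⌉)))
  log-rank c C ≤c 10≤C c≤C m n Δ 1≤Δ f f≤ zero ((U , V , fac) , _) =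
    -- Rank 0 forces f = 0, so no bit is sent, as the bound 0 demands.
    leaf 0 , (λ a b → sym (n≤0⇒n≡0 (ℕ→ℚ-cancel (ℚP.≤-reflexive (fac a b))))) , z≤n
  log-rank c C ≤c 10≤C c≤C m n Δ 1≤Δ f f≤ r@(suc r') (fac , _) = result (protocol f Δ r I 1≤Δ f≤ fac r<)
    where
    I : ℕ
    I = ⌈log₂ (r + 1) ⌉
    r+1 : r + 1 ≡ suc r
    r+1 = +-comm r 1
    r< : r < 2 ^ I
    r< = subst (_≤ 2 ^ I) r+1 (n≤2^⌈log₂n⌉ (r + 1))
    2^I≤ : 2 ^ I ≤ 2 * r
    2^I≤ = subst (λ t → 2 ^ ⌈log₂ t ⌉ ≤ 2 * r) (sym r+1) (2^⌈log₂⌉≤ r (s≤s z≤n))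
    1≤I : 1 ≤ I
    1≤I = subst (_≤ I) (⌈log₂2^n⌉≡n 1) (⌈log₂⌉-mono-≤ {2} {r + 1} (subst (2 ≤_) (sym r+1) (s≤s (s≤s z≤n))))
    result : (Σ (Protocol (Fin m) (Fin n) ℕ) λ P → (∀ a b → run P a b ≡ f a b) × depth P ≤ level-depth Δ (suc (I + Δ)) I) → _
    result (P , correct , short) = P , correct ,
      square-bound c C Δ I r (depth P) 1≤Δ 10≤C c≤C 2^I≤ (≤-trans short (level-depth≤ Δ I 1≤Δ 1≤I c ≤c))

  C₀ : ℕ
  C₀ = 576 * (400000 * 400000)

open import Data.Nat using (ℕ; _≤_; _+_; _*_; _^_)
open import Data.Nat.Properties using (≤-refl; ≤ᵇ⇒≤)
open import Data.Nat.Logarithm using (⌈log₂_⌉)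
open Final using (C₀; log-rank)

theorem1 : Σ ℕ (λ C → (m n Δ : ℕ) → 1 ≤ Δ → (f : Fin m → Fin n → ℕ) →
    ((a : Fin m) (b : Fin n) → f a b ≤ Δ) → (r : ℕ) → RankIs f r →
    Σ (Protocol (Fin m) (Fin n) ℕ) (λ P →
    ((a : Fin m) (b : Fin n) → run P a b ≡ f a b) ×
    (depth P * depth P ≤ C * Δ ^ (C * Δ) * r * (⌈log₂ (r + 1) ⌉ * ⌈log₂ (r + 1) ⌉))))
theorem1 = C₀ , log-rank 400000 C₀ ≤-refl (≤ᵇ⇒≤ 10 C₀ _) ≤-refl
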